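{- There is a polynomial-time algorithm that, given a connected cograph $G$ (with a parse tree) and a terminal set $X\subseteq V(G)$, outputs a simple path of $G$ containing all vertices of $X$ and using the minimum possible number of vertices of $V(G)\setminus X$, whenever a simple path containing all of $X$ exists.
   Context: A cograph is a finite simple graph with no induced path on four vertices; equivalently a graph built from single vertices by repeated disjoint union and join operations, recorded in a binary parse tree whose leaves are the vertices and whose internal nodes are labelled 0 (disjoint union) or 1 (join). -}

module Defs where

open import Data.Nat using (ℕ; zero; suc; _+_; _*_; _^_; _≤_)
open import Data.Bool using (Bool; true; false; T; if_then_else_)
open import Data.Fin using (Fin; toℕ; splitAt)
open import Data.Fin.Subset using (Subset; _∈_)
open import Data.Vec using (lookup)
open import Data.List using (List; []; _∷_; _++_; length; replicate; concatMap)
open import Data.List.Relation.Unary.Linked using (Linked)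
open import Data.List.Relation.Unary.Unique.Propositional using (Unique)
open import Data.List.Membership.Propositional renaming (_∈_ to _∈ₗ_)
open import Data.Maybe using (Maybe; just; nothing)
open import Data.Product using (Σ; ∃; _×_; _,_)
open import Data.Sum using (_⊎_; inj₁; inj₂)
open import Data.Empty using (⊥)
open import Relation.Binary.PropositionalEquality using (_≡_; _≢_)

-- Cographs given by a parse tree (cotree).
-- A `Cotree n` has exactly n leaves; the vertices of the cograph are the
-- leaves, identified with Fin n in left-to-right order.  An internal node
-- carries a label: false = 0 (disjoint union), true = 1 (join).

data Cotree : ℕ → Set where
  leaf : Cotree 1
  node : ∀ {m n} → Bool → Cotree m → Cotree n → Cotree (m + n)

Adj : ∀ {n} → Cotree n → Fin n → Fin n → Set
Adj leaf u v = ⊥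
Adj (node {m} b l r) u v with splitAt m u | splitAt m v
... | inj₁ u′ | inj₁ v′ = Adj l u′ v′
... | inj₂ u′ | inj₂ v′ = Adj r u′ v′
... | inj₁ _  | inj₂ _  = T b
... | inj₂ _  | inj₁ _  = T b

data Reach {n} (t : Cotree n) : Fin n → Fin n → Set where
  here : ∀ {u} → Reach t u u
  step : ∀ {u w v} → Adj t u w → Reach t w v → Reach t u v

Connected : ∀ {n} → Cotree n → Set
Connected t = ∀ u v → Reach t u v

IsSimplePath : ∀ {n} → Cotree n → List (Fin n) → Set
IsSimplePath t P = (P ≢ []) × Unique P × Linked (Adj t) P

Covers : ∀ {n} → Subset n → List (Fin n) → Set
Covers X P = ∀ x → x ∈ X → x ∈ₗ P

nonTerminals : ∀ {n} → Subset n → List (Fin n) → ℕ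
nonTerminals X [] = 0
nonTerminals X (v ∷ P) = if lookup X v then nonTerminals X P else suc (nonTerminals X P)

Optimal : ∀ {n} → Cotree n → Subset n → List (Fin n) → Set
Optimal t X P = IsSimplePath t P × Covers X P ×
  (∀ Q → IsSimplePath t Q → Covers X Q → nonTerminals X P ≤ nonTerminals X Q)

data Sym : Set where
  blank b0 b1 sep : Sym

data Move : Set where
  L R S : Move

record TM : Set where
  field
    states : ℕ
    start  : Fin states
    -- nothing = halt
    δ      : Fin states → Sym → Maybe (Fin states × Sym × Move)

record Config (M : TM) : Set where
  constructor conf
  field
    state : Fin (TM.states M)
    left  : List Sym     -- cells left of the head, nearest first
    head  : Sym
    right : List Sym     -- cells right of the head, nearest first

moveTape : Move → List Sym → Sym → List Sym → (List Sym × Sym × List Sym)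
moveTape L []      h r = [] , blank , h ∷ r
moveTape L (x ∷ l) h r = l , x , h ∷ r
moveTape R l h []      = h ∷ l , blank , []
moveTape R l h (x ∷ r) = h ∷ l , x , r
moveTape S l h r = l , h , r

run : (M : TM) → ℕ → Config M → Maybe (Config M)
run M fuel (conf q l h r) with TM.δ M q h
... | nothing = just (conf q l h r)
run M zero    (conf q l h r) | just _ = nothing
run M (suc f) (conf q l h r) | just (q′ , s , d) with moveTape d l s r
... | (l′ , h′ , r′) = run M f (conf q′ l′ h′ r′)

initial : (M : TM) → List Sym → Config M
initial M []      = conf (TM.start M) [] blank []
initial M (x ∷ w) = conf (TM.start M) [] x w

readOut : List Sym → List Sym
readOut [] = []
readOut (blank ∷ _) = []
readOut (x ∷ xs) = x ∷ readOut xs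

output : ∀ {M} → Config M → List Sym
output (conf _ _ h r) = readOut (h ∷ r)

HaltsWithin : TM → List Sym → ℕ → List Sym → Set
HaltsWithin M w time out = Σ (Config M) λ c → (run M time (initial M w) ≡ just c) × (output c ≡ out)

bit : Bool → Sym
bit false = b0
bit true  = b1

-- prefix-free encoding of the cotree
encTree : ∀ {n} → Cotree n → List Sym
encTree leaf = b1 ∷ []
encTree (node b l r) = b0 ∷ bit b ∷ (encTree l ++ encTree r)

encSubset : ∀ {n} → Subset n → List Sym
encSubset X = Data.List.map bit (Data.Vec.toList X)

encInput : ∀ {n} → Cotree n → Subset n → List Sym
encInput t X = encTree t ++ (sep ∷ encSubset X)

encPath : ∀ {n} → List (Fin n) → List Sym
encPath = concatMap (λ v → replicate (toℕ v) b1 ++ (b0 ∷ []))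

{-# OPTIONS --safe #-}
-- The algorithm works bottom-up on the parse tree.  For each subtree t it keeps a cover of the terminals of t by paths, written
-- as one list of terminals: consecutive terminals are joined, separated, or separated by a spare nonterminal that could join them.
-- For every path Q of G through all terminals, the number of paths in the cover is at most the number of maximal runs of Q inside t
-- plus the number of nonterminals of Q in t, and the number of proper breaks plus one is at most the number of those runs.
-- At a union the covers are concatenated.  At a join the cover with fewer paths is cut further until it has as many paths as the
-- other one or consists of single vertices; its pieces are inserted into the gaps of the other cover, proper breaks first, and the
-- nonterminals of that side become spare connectors for the gaps that remain.  The two bounds survive because the runs of Q inside
-- one side number at most the runs inside the join plus the vertices of Q on the other side.  At the root a path through all
-- terminals is a single run, hence no proper break is left, and inserting all spare connectors yields a path with
-- (number of pieces) - 1 nonterminals, which the first bound shows to be optimal.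
--
-- For the running time, the algorithm is a structured program on finitely many bit stacks whose loops all iterate at most |input|
-- times, so that a polynomial bound is read off the program text; each stack operation is a linear-time pass over the tape.
module Submission where

-- One cover has to be optimal in two senses at once: `pieces` counts its paths when no connecting
-- nonterminal is spent, `breaks` when all of them are. Connectors are recorded as `via` long before
-- it is known whether they are wanted, and `Bridge` can take them back: a segment from the other
-- side of a join closes the same gap without spending a nonterminal.
--
-- The induction at a join rests on a dichotomy. Either the new count is at most 1, and the bound is
-- immediate because the first terminal of the cover lies on `Q`; or the other side is used up, each
-- of its terminals (for `pieces`) or each of its vertices (for `breaks`) having lowered the count
-- by exactly one. That is also the most that one vertex of the other side can do for `Q`, so the
-- same number cancels on both sides. Filling proper breaks before vias serves `breaks`; cutting the
-- smaller cover further serves both counts, since the more segments there are, the more gaps they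
-- fill.
--
-- The passes over the covers are described by inductive relations (`Split`, `Close`, `Bridge`), so
-- that the combinatorics does not mention stacks and the stack programs do not mention optimality.

open import Defs renaming (L to goL; R to goR; S to stay)
open import Data.Bool as Bool using (Bool; true; false; _∧_; _∨_; not)
open import Data.Empty using (⊥; ⊥-elim)
open import Data.Fin using (Fin; zero; suc; #_; toℕ; splitAt; _↑ˡ_; _↑ʳ_)
open import Data.Fin.Properties using (_≟_; toℕ<n; toℕ-↑ˡ; toℕ-↑ʳ; splitAt-↑ˡ; splitAt-↑ʳ; ↑ˡ-injective; ↑ʳ-injective)
open import Data.Fin.Subset using (Subset)
open import Data.List using (List; []; _∷_; _++_; _ʳ++_; length; replicate; reverse; map; concatMap; lookup; tabulate)
open import Data.List.Membership.Propositional renaming (_∈_ to _∈ₗ_)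
open import Data.List.Membership.Propositional.Properties using (∈-++⁺ˡ; ∈-++⁺ʳ; ∈-++⁻; ∈-∃++; ∈-map⁺; ∈-concatMap⁺; ∈-tabulate⁺; ∈-tabulate⁻)
import Data.List.Membership.DecPropositional as DecMembership
open import Data.List.Properties
open import Data.List.Relation.Unary.All as All using (All; []; _∷_)
import Data.List.Relation.Unary.All.Properties as All
open import Data.List.Relation.Unary.AllPairs using ([]; _∷_)
open import Data.List.Relation.Unary.Any as Any using (here; there)
open import Data.List.Relation.Unary.Any.Properties using (lookup-index)
open import Data.List.Relation.Unary.Linked using (Linked; []; [-]; _∷_)
open import Data.List.Relation.Unary.Unique.Propositional using (Unique)
open import Data.List.Relation.Unary.Unique.Propositional.Properties using (tabulate⁺)
open import Data.Maybe using (Maybe; just; nothing)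
open import Data.Nat hiding (_≟_)
open import Data.Nat.Properties hiding (_≟_)
open import Data.Nat.Solver using (module +-*-Solver)
open import Data.Product using (Σ; ∃; _×_; _,_; proj₁; proj₂)
open import Data.Sum using (_⊎_; inj₁; inj₂)
open import Data.Unit using (⊤; tt)
open import Data.Vec as Vec using (Vec; []; _∷_; _[_]≔_)
open import Data.Vec.Properties using ([]≔-idempotent; []≔-commutes; []≔-lookup; lookup∘update; lookup∘update′; lookup⇒[]=; []=⇒lookup; lookup-++ˡ; lookup-++ʳ; toList-++; length-toList)
open import Function using (_∘_; id)
open import Relation.Binary using (DecidableEquality)
open import Relation.Binary.PropositionalEquality
open import Relation.Nullary using (¬_; yes; no; does)
open +-*-Solver using (solve; _:+_; _:*_; _:=_; con)

-- Turing machine fragments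

-- Left of the head (nearest first), and the head together with what is right of it; an exhausted list stands for blanks.
Tape : Set
Tape = List Sym × List Sym

hd : List Sym → Sym
hd []      = blank
hd (x ∷ _) = x

tl : List Sym → List Sym
tl []       = []
tl (_ ∷ xs) = xs

moveTo : Move → List Sym → Sym → List Sym → Tape
moveTo goL []      s r = [] , blank ∷ s ∷ r
moveTo goL (x ∷ l) s r = l , x ∷ s ∷ r
moveTo goR l       s r = s ∷ l , r
moveTo stay l       s r = l , s ∷ r

-- Repetitions in `elems` are harmless: a state is coded by the position that `complete` returns,
-- and looking up that position gives the state back.
record Finite (A : Set) : Set where
  field
    elems    : List A
    complete : ∀ a → a ∈ₗ elems

open Finite

⊤-finite : Finite ⊤
⊤-finite = record { elems = tt ∷ [] ; complete = λ _ → here refl }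

Bool-finite : Finite Bool
Bool-finite = record
  { elems    = true ∷ false ∷ []
  ; complete = λ { true → here refl ; false → there (here refl) } }

Sym-finite : Finite Sym
Sym-finite = record
  { elems    = blank ∷ b0 ∷ b1 ∷ sep ∷ []
  ; complete = λ { blank → here refl ; b0 → there (here refl) ; b1 → there (there (here refl))
                 ; sep → there (there (there (here refl))) } }

Maybe-finite : ∀ {A} → Finite A → Finite (Maybe A)
Maybe-finite F = record
  { elems    = nothing ∷ map just (elems F)
  ; complete = λ { nothing → here refl ; (just a) → there (∈-map⁺ just (complete F a)) } }

⊎-finite : ∀ {A B} → Finite A → Finite B → Finite (A ⊎ B)
⊎-finite F G = record
  { elems    = map inj₁ (elems F) ++ map inj₂ (elems G)
  ; complete = λ { (inj₁ a) → ∈-++⁺ˡ (∈-map⁺ inj₁ (complete F a))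
                 ; (inj₂ b) → ∈-++⁺ʳ (map inj₁ (elems F)) (∈-map⁺ inj₂ (complete G b)) } }

Σ-finite : ∀ {A} {B : A → Set} → Finite A → (∀ a → Finite (B a)) → Finite (Σ A B)
Σ-finite F G = record
  { elems    = concatMap row (elems F)
  ; complete = λ { (a , b) → ∈-concatMap⁺ row
                     (Any.map (λ { refl → ∈-map⁺ (a ,_) (complete (G a) b) }) (complete F a)) } }
  where row = λ a → map (a ,_) (elems (G a))

-- The exits are labelled by E; leaving through an exit still writes and moves.
record Mach (E : Set) : Set₁ where
  field
    State  : Set
    finite : Finite State
    entry  : State
    δ      : State → Sym → (State ⊎ E) × Sym × Move

open Mach

-- The number is an upper bound on the steps, not their exact count: `exit` leaves an arbitrary
-- slack `k`, so bounds can be weakened and padded freely.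
data Exec {E} (M : Mach E) : ℕ → State M → Tape → E → Tape → Set where
  exit : ∀ {k q l r e s d} → δ M q (hd r) ≡ (inj₂ e , s , d) →
         Exec M (suc k) q (l , r) e (moveTo d l s (tl r))
  cont : ∀ {k q l r q′ s d e τ} → δ M q (hd r) ≡ (inj₁ q′ , s , d) →
         Exec M k q′ (moveTo d l s (tl r)) e τ → Exec M (suc k) q (l , r) e τ

Exec-mono : ∀ {E} {M : Mach E} {j k q τ e τ′} → j ≤ k → Exec M j q τ e τ′ → Exec M k q τ e τ′
Exec-mono (s≤s j≤k) (exit eq)   = exit eq
Exec-mono (s≤s j≤k) (cont eq x) = cont eq (Exec-mono j≤k x)

infixl 1 _>>=_

module Bind {D E : Set} (F : Finite D) (M : Mach D) (N : D → Mach E) where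

  first : (State M ⊎ D) × Sym × Move → ((State M ⊎ Σ D (State ∘ N)) ⊎ E) × Sym × Move
  first (inj₁ q , s , d) = inj₁ (inj₁ q) , s , d
  first (inj₂ e , s , d) = inj₁ (inj₂ (e , entry (N e))) , s , d

  second : ∀ e → (State (N e) ⊎ E) × Sym × Move → ((State M ⊎ Σ D (State ∘ N)) ⊎ E) × Sym × Move
  second e (inj₁ q , s , d) = inj₁ (inj₂ (e , q)) , s , d
  second e (inj₂ f , s , d) = inj₂ f , s , d

  bind : Mach E
  bind .State          = State M ⊎ Σ D (State ∘ N)
  bind .finite         = ⊎-finite (finite M) (Σ-finite F (finite ∘ N))
  bind .entry          = inj₁ (entry M)
  bind .δ (inj₁ q) s       = first (δ M q s)
  bind .δ (inj₂ (e , q)) s = second e (δ (N e) q s)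

  Exec-second : ∀ {e k q τ f τ′} → Exec (N e) k q τ f τ′ → Exec bind k (inj₂ (e , q)) τ f τ′
  Exec-second {e} (exit eq)   = exit (cong (second e) eq)
  Exec-second {e} (cont eq x) = cont (cong (second e) eq) (Exec-second x)

  -- The last step of `M` is itself the jump to the entry of `N e`, so the bounds add without
  -- overhead. Slack in the first bound is passed on to the second machine.
  Exec-bind : ∀ {j k q τ e τ′ f τ″} → Exec M j q τ e τ′ → Exec (N e) k (entry (N e)) τ′ f τ″ →
              Exec bind (j + k) (inj₁ q) τ f τ″
  Exec-bind {suc j} {k} (exit eq) y = cont (cong first eq) (Exec-mono (m≤n+m k j) (Exec-second y))
  Exec-bind (cont eq x) y = cont (cong first eq) (Exec-bind x y)

open Bind using (bind; Exec-bind)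

_>>=_ : ∀ {E} → Mach ⊤ → (⊤ → Mach E) → Mach E
_>>=_ = bind ⊤-finite

module Loop (M : Mach Bool) where

  again : (State M ⊎ Bool) × Sym × Move → (State M ⊎ Bool) × Sym × Move
  again (inj₁ q     , s , d) = inj₁ q , s , d
  again (inj₂ true  , s , d) = inj₁ (entry M) , s , d
  again (inj₂ false , s , d) = inj₂ false , s , d

  loopM : Mach Bool
  loopM .State  = State M
  loopM .finite = finite M
  loopM .entry  = entry M
  loopM .δ q s  = again (δ M q s)

  Exec-more : ∀ {j k q τ τ′ e τ″} → Exec M j q τ true τ′ → Exec loopM k (entry M) τ′ e τ″ →
              Exec loopM (j + k) q τ e τ″
  Exec-more {suc j} {k} (exit eq) y = cont (cong again eq) (Exec-mono (m≤n+m k j) y)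
  Exec-more (cont eq x) y = cont (cong again eq) (Exec-more x y)

  Exec-stop : ∀ {k q τ τ′} → Exec M k q τ false τ′ → Exec loopM k q τ false τ′
  Exec-stop (exit eq)   = exit (cong again eq)
  Exec-stop (cont eq x) = cont (cong again eq) (Exec-stop x)

open Loop using (loopM; Exec-more; Exec-stop)

-- State `zero` of the Turing machine is the halting state, and all states of `M` are shifted past
-- it. A halted configuration persists under any remaining fuel, which turns the upper bound of
-- `Exec` into a value of `run`.
module Compile (M : Mach ⊤) where

  code : State M → Fin (suc (length (elems (finite M))))
  code q = suc (Any.index (complete (finite M) q))

  emit : (State M ⊎ ⊤) × Sym × Move → Fin (suc (length (elems (finite M)))) × Sym × Move
  emit (inj₁ q , s , d) = code q , s , d
  emit (inj₂ e , s , d) = zero , s , d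

  toTM : TM
  toTM .TM.states       = suc (length (elems (finite M)))
  toTM .TM.start        = code (entry M)
  toTM .TM.δ zero s     = nothing
  toTM .TM.δ (suc i) s  = just (emit (δ M (lookup (elems (finite M)) i) s))

  config : Fin (TM.states toTM) → Tape → Config toTM
  config q (l , r) = conf q l (hd r) (tl r)

  run-step : ∀ {q l h r q′ s d} k → TM.δ toTM q h ≡ just (q′ , s , d) →
             run toTM (suc k) (conf q l h r) ≡ run toTM k (config q′ (moveTo d l s r))
  run-step {l = []}    {d = goL} k eq rewrite eq = refl
  run-step {l = _ ∷ _} {d = goL} k eq rewrite eq = refl
  run-step {r = []}    {d = goR} k eq rewrite eq = refl
  run-step {r = _ ∷ _} {d = goR} k eq rewrite eq = refl
  run-step {d = stay} k eq rewrite eq = refl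

  run-halted : ∀ k τ → run toTM k (config zero τ) ≡ just (config zero τ)
  run-halted zero    τ = refl
  run-halted (suc k) τ = refl

  δ-code : ∀ q s → TM.δ toTM (code q) s ≡ just (emit (δ M q s))
  δ-code q s = cong (λ p → just (emit (δ M p s))) (sym (lookup-index (complete (finite M) q)))

  Exec⇒run : ∀ {k q τ e τ′} → Exec M k q τ e τ′ → run toTM k (config (code q) τ) ≡ just (config zero τ′)
  Exec⇒run {suc k} {q} {l , r} (exit {s = s} {d} eq) =
    trans (run-step k (trans (δ-code q (hd r)) (cong (just ∘ emit) eq))) (run-halted k (moveTo d l s (tl r)))
  Exec⇒run {suc k} {q} {l , r} (cont eq x) =
    trans (run-step k (trans (δ-code q (hd r)) (cong (just ∘ emit) eq))) (Exec⇒run x)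

-- Scanning and shifting

NonBlank : List Sym → Set
NonBlank = All (_≢ blank)

blanks : ℕ → List Sym
blanks m = replicate m blank

single : ∀ {E} → (Sym → (⊤ ⊎ E) × Sym × Move) → Mach E
single f .State  = ⊤
single f .finite = ⊤-finite
single f .entry  = tt
single f .δ _    = f

retM : ∀ {E} → E → Mach E
retM e = single λ s → inj₂ e , s , stay

moveM : Move → Mach ⊤
moveM d = single λ s → inj₂ tt , s , d

skipSep : Mach ⊤
skipSep = single λ { sep → inj₂ tt , sep , goR ; s → inj₁ tt , s , goR }

toEnd : Mach ⊤
toEnd = single λ { blank → inj₂ tt , blank , goL ; s → inj₁ tt , s , goR }

rewind : ∀ {E} → E → Mach E
rewind e = single λ { blank → inj₂ e , blank , goR ; s → inj₁ tt , s , goL }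

-- The step to the left comes first because the head may already stand on a blank, which `rewind`
-- would take for the left border.
home : ∀ {E} → E → Mach E
home e = moveM goL >>= λ _ → rewind e

-- The state is the symbol displaced by the previous write. The block up to the next blank is thus
-- shifted right by one cell, and `c` fills the gap.
carryR : Sym → Mach ⊤
carryR c .State     = Sym
carryR c .finite    = Sym-finite
carryR c .entry     = c
carryR c .δ x blank = inj₂ tt , x , goR
carryR c .δ x y     = inj₁ y , x , goR

-- Started at the right end: each cell receives the symbol formerly to its right, and the blank that
-- stops the scan is the cell being deleted.
carryL : Mach ⊤
carryL .State     = Sym
carryL .finite    = Sym-finite
carryL .entry     = blank
carryL .δ x blank = inj₂ tt , x , stay
carryL .δ x y     = inj₁ y , x , goL

bits : List Bool → List Sym
bits = map bit

bits-nonBlank : ∀ xs → NonBlank (bits xs)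
bits-nonBlank []           = []
bits-nonBlank (false ∷ xs) = (λ ()) ∷ bits-nonBlank xs
bits-nonBlank (true ∷ xs)  = (λ ()) ∷ bits-nonBlank xs

skipSep-exec : ∀ xs {l r} → Exec skipSep (suc (length xs)) tt (l , bits xs ++ sep ∷ r) tt (sep ∷ (bits xs ʳ++ l) , r)
skipSep-exec []           = exit refl
skipSep-exec (false ∷ xs) = cont refl (skipSep-exec xs)
skipSep-exec (true ∷ xs)  = cont refl (skipSep-exec xs)

-- The blank read at the end is taken from the `m` explicit ones, or supplied by `hd []` if there
-- are none; hence the truncated `m ∸ 1`.
toEnd-exec : ∀ {w l} m → NonBlank w →
             Exec toEnd (suc (length w)) tt (l , w ++ blanks m) tt (moveTo goL (w ʳ++ l) blank (blanks (m ∸ 1)))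
toEnd-exec zero    [] = exit refl
toEnd-exec (suc m) [] = exit refl
toEnd-exec {blank ∷ w} m (y ∷ ys) = ⊥-elim (y refl)
toEnd-exec {b0 ∷ w}    m (y ∷ ys) = cont refl (toEnd-exec m ys)
toEnd-exec {b1 ∷ w}    m (y ∷ ys) = cont refl (toEnd-exec m ys)
toEnd-exec {sep ∷ w}   m (y ∷ ys) = cont refl (toEnd-exec m ys)

carryR-exec : ∀ {c w l} x m → NonBlank w →
              Exec (carryR c) (suc (length w)) x (l , w ++ blanks m) tt ((x ∷ w) ʳ++ l , blanks (m ∸ 1))
carryR-exec x zero    [] = exit refl
carryR-exec x (suc m) [] = exit refl
carryR-exec {w = blank ∷ w} x m (y ∷ ys) = ⊥-elim (y refl)
carryR-exec {w = b0 ∷ w}    x m (y ∷ ys) = cont refl (carryR-exec b0 m ys)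
carryR-exec {w = b1 ∷ w}    x m (y ∷ ys) = cont refl (carryR-exec b1 m ys)
carryR-exec {w = sep ∷ w}   x m (y ∷ ys) = cont refl (carryR-exec sep m ys)

carryL-exec : ∀ {z l} x y r → NonBlank z →
              Exec carryL (suc (length z)) x (moveTo goL (z ++ blank ∷ l) y r) tt (l , z ʳ++ (x ∷ y ∷ r))
carryL-exec x y r [] = exit refl
carryL-exec {blank ∷ z} x y r (p ∷ ps) = ⊥-elim (p refl)
carryL-exec {b0 ∷ z}    x y r (p ∷ ps) = cont refl (carryL-exec b0 x (y ∷ r) ps)
carryL-exec {b1 ∷ z}    x y r (p ∷ ps) = cont refl (carryL-exec b1 x (y ∷ r) ps)
carryL-exec {sep ∷ z}   x y r (p ∷ ps) = cont refl (carryL-exec sep x (y ∷ r) ps)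

All-ʳ++ : ∀ {A : Set} {P : A → Set} {xs ys} → All P xs → All P ys → All P (xs ʳ++ ys)
All-ʳ++ []       qs = qs
All-ʳ++ (p ∷ ps) qs = All-ʳ++ ps (p ∷ qs)

rewind-exec : ∀ {E} {e : E} {z} x r → NonBlank z →
              Exec (rewind e) (suc (length z)) tt (moveTo goL (z ++ blank ∷ []) x r) e (blank ∷ [] , z ʳ++ (x ∷ r))
rewind-exec x r [] = exit refl
rewind-exec {z = blank ∷ z} x r (p ∷ ps) = ⊥-elim (p refl)
rewind-exec {z = b0 ∷ z}    x r (p ∷ ps) = cont refl (rewind-exec b0 (x ∷ r) ps)
rewind-exec {z = b1 ∷ z}    x r (p ∷ ps) = cont refl (rewind-exec b1 (x ∷ r) ps)
rewind-exec {z = sep ∷ z}   x r (p ∷ ps) = cont refl (rewind-exec sep (x ∷ r) ps)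

reverse-ʳ++ : ∀ {A : Set} (xs ys : List A) → reverse xs ʳ++ ys ≡ xs ++ ys
reverse-ʳ++ xs ys = trans (ʳ++-defn (reverse xs)) (cong (_++ ys) (reverse-involutive xs))

home-exec : ∀ {E} {e : E} {p} r → NonBlank p →
            Exec (home e) (2 + length p) (inj₁ tt) (p ʳ++ (blank ∷ []) , r) e (blank ∷ [] , p ++ hd r ∷ tl r)
home-exec {e = e} {p} r nb
  rewrite ʳ++-defn p {blank ∷ []} | sym (reverse-ʳ++ p (hd r ∷ tl r)) | sym (length-reverse p) =
  Exec-bind ⊤-finite (moveM goL) (λ _ → rewind e) {j = 1} (exit refl) (rewind-exec (hd r) (tl r) (All-ʳ++ nb []))

-- Bit stacks on the tape

Stacks : ℕ → Set
Stacks K = Vec (List Bool) K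

layout : ∀ {K} → Stacks K → List Sym
layout []       = []
layout (s ∷ ss) = bits s ++ sep ∷ layout ss

layout-nonBlank : ∀ {K} (ss : Stacks K) → NonBlank (layout ss)
layout-nonBlank []       = []
layout-nonBlank (s ∷ ss) = All.++⁺ (bits-nonBlank s) ((λ ()) ∷ layout-nonBlank ss)

-- The blank on the left is the border at which `rewind` stops. The number of trailing blanks is a
-- parameter because the operations change it in ways that do not matter for the stacks.
tapeOf : ∀ {K} → Stacks K → ℕ → Tape
tapeOf ss m = blank ∷ [] , layout ss ++ blanks m

at : ∀ {K E} → Fin K → Mach E → Mach E
at zero    M = M
at (suc i) M = skipSep >>= λ _ → at i M

before : ∀ {K} → Stacks K → Fin K → List Sym
before (s ∷ ss) zero    = []
before (s ∷ ss) (suc i) = bits s ++ sep ∷ before ss i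

after : ∀ {K} → Stacks K → Fin K → List Sym
after (s ∷ ss) zero    = layout ss
after (s ∷ ss) (suc i) = after ss i

before-nonBlank : ∀ {K} (ss : Stacks K) i → NonBlank (before ss i)
before-nonBlank (s ∷ ss) zero    = []
before-nonBlank (s ∷ ss) (suc i) = All.++⁺ (bits-nonBlank s) ((λ ()) ∷ before-nonBlank ss i)

after-nonBlank : ∀ {K} (ss : Stacks K) i → NonBlank (after ss i)
after-nonBlank (s ∷ ss) zero    = layout-nonBlank ss
after-nonBlank (s ∷ ss) (suc i) = after-nonBlank ss i

layout-update : ∀ {K} (ss : Stacks K) i xs →
                layout (ss [ i ]≔ xs) ≡ before ss i ++ bits xs ++ sep ∷ after ss i
layout-update (s ∷ ss) zero    xs = refl
layout-update (s ∷ ss) (suc i) xs =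
  trans (cong (λ w → bits s ++ sep ∷ w) (layout-update ss i xs)) (sym (++-assoc (bits s) _ _))

layout-lookup : ∀ {K} (ss : Stacks K) i →
                layout ss ≡ before ss i ++ bits (Vec.lookup ss i) ++ sep ∷ after ss i
layout-lookup (s ∷ ss) zero    = refl
layout-lookup (s ∷ ss) (suc i) =
  trans (cong (λ w → bits s ++ sep ∷ w) (layout-lookup ss i)) (sym (++-assoc (bits s) _ _))

bits-++-ʳ++ : ∀ xs (ys : List Sym) {l} → (bits xs ++ sep ∷ ys) ʳ++ l ≡ ys ʳ++ (sep ∷ (bits xs ʳ++ l))
bits-++-ʳ++ xs ys = ++-ʳ++ (bits xs)

at-exec : ∀ {K E} {M : Mach E} (ss : Stacks K) i {k l r e τ} →
          Exec M k (entry M) (before ss i ʳ++ l , r) e τ →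
          Exec (at i M) (length (before ss i) + k) (entry (at i M)) (l , before ss i ++ r) e τ
at-exec (s ∷ ss) zero x = x
at-exec {M = M} (s ∷ ss) (suc i) {k} {l} {r} x
  rewrite ++-assoc (bits s) (sep ∷ before ss i) r | bits-++-ʳ++ s (before ss i) {l} =
  Exec-mono (≤-reflexive time)
    (Exec-bind ⊤-finite skipSep (λ _ → at i M) (skipSep-exec s) (at-exec ss i x))
  where
  open ≡-Reasoning
  time : suc (length s) + (length (before ss i) + k) ≡ length (bits s ++ sep ∷ before ss i) + k
  time = begin
    suc (length s) + (length (before ss i) + k)      ≡⟨ sym (+-assoc (suc (length s)) _ k) ⟩
    suc (length s) + length (before ss i) + k        ≡⟨ cong (_+ k) (sym (+-suc (length s) _)) ⟩
    length s + suc (length (before ss i)) + k        ≡⟨ cong (λ z → z + suc (length (before ss i)) + k)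
      (sym (length-map bit s)) ⟩
    length (bits s) + suc (length (before ss i)) + k ≡⟨ cong (_+ k) (sym (length-++ (bits s))) ⟩
    length (bits s ++ sep ∷ before ss i) + k         ∎

-- A common bound for push and pop, which take at most `4 + 3 * z` and `5 + 4 * z` steps; the
-- coefficients leave room to spare.
opTime : ℕ → ℕ
opTime z = 10 + 10 * z

pushM : ∀ {K} → Fin K → Bool → Mach ⊤
pushM i a = at i (carryR (bit a)) >>= λ _ → home tt

bit-nonBlank : ∀ a → bit a ≢ blank
bit-nonBlank false = λ ()
bit-nonBlank true  = λ ()

hd-blanks : ∀ m → hd (blanks m) ∷ tl (blanks m) ≡ blanks (suc (m ∸ 1))
hd-blanks zero    = refl
hd-blanks (suc m) = refl

size : ∀ {K} → Stacks K → ℕ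
size = length ∘ layout

length-mid : ∀ (xs ys zs : List Sym) → length (xs ++ ys ++ zs) ≡ length xs + (length ys + length zs)
length-mid xs ys zs = trans (length-++ xs) (cong (length xs +_) (length-++ ys))

size-update : ∀ {K} (ss : Stacks K) i xs →
              size (ss [ i ]≔ xs) ≡ length (before ss i) + (length xs + suc (length (after ss i)))
size-update ss i xs = trans (cong length (layout-update ss i xs)) (trans (length-mid (before ss i) (bits xs) _)
  (cong (λ z → length (before ss i) + (z + suc (length (after ss i)))) (length-map bit xs)))

size-lookup : ∀ {K} (ss : Stacks K) i →
              size ss ≡ length (before ss i) + (length (Vec.lookup ss i) + suc (length (after ss i)))
size-lookup ss i = trans (cong length (layout-lookup ss i)) (trans (length-mid (before ss i) (bits (Vec.lookup ss i)) _)
  (cong (λ z → length (before ss i) + (z + suc (length (after ss i)))) (length-map bit (Vec.lookup ss i))))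

size-push : ∀ {K} (ss : Stacks K) i a → size (ss [ i ]≔ (a ∷ Vec.lookup ss i)) ≡ suc (size ss)
size-push ss i a = trans (size-update ss i _) (trans (+-suc _ _) (cong suc (sym (size-lookup ss i))))

push-time : ∀ {x y z} → x ≤ z → y ≤ z → x + suc y + (2 + suc z) ≤ opTime z
push-time {x} {y} {z} x≤z y≤z = begin
  x + suc y + (2 + suc z) ≤⟨ +-monoˡ-≤ (2 + suc z) (+-mono-≤ x≤z (s≤s y≤z)) ⟩
  z + suc z + (2 + suc z) ≡⟨ solve 1 (λ z → z :+ (con 1 :+ z) :+ (con 3 :+ z) := con 4 :+ con 3 :* z) refl z ⟩
  4 + 3 * z               ≤⟨ +-mono-≤ (m≤m+n 4 6) (*-monoˡ-≤ z (m≤m+n 3 7)) ⟩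
  opTime z                ∎
  where open ≤-Reasoning

pushM-exec : ∀ {K} (ss : Stacks K) i a m → ∃ λ m′ →
             Exec (pushM i a) (opTime (size ss)) (entry (pushM i a)) (tapeOf ss m)
                  tt (tapeOf (ss [ i ]≔ (a ∷ Vec.lookup ss i)) m′)
pushM-exec ss i a m = suc (m ∸ 1 ∸ 1) , Exec-mono time
  (subst₂ (λ u v → Exec (pushM i a) (length p + suc (length w) + (2 + length (p ++ bit a ∷ w)))
                        (entry (pushM i a)) (blank ∷ [] , u) tt (blank ∷ [] , v)) pre post
    (Exec-bind ⊤-finite (at i (carryR (bit a))) (λ _ → home tt) (at-exec ss i (carryR-exec (bit a) m nb)) back))
  where
  p = before ss i
  w = bits (Vec.lookup ss i) ++ sep ∷ after ss i
  nb : NonBlank w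
  nb = All.++⁺ (bits-nonBlank (Vec.lookup ss i)) ((λ ()) ∷ after-nonBlank ss i)
  nb′ : NonBlank (p ++ bit a ∷ w)
  nb′ = All.++⁺ (before-nonBlank ss i) (bit-nonBlank a ∷ nb)
  back : Exec (home tt) (2 + length (p ++ bit a ∷ w)) (inj₁ tt)
              ((bit a ∷ w) ʳ++ (p ʳ++ (blank ∷ [])) , blanks (m ∸ 1)) tt
              (blank ∷ [] , (p ++ bit a ∷ w) ++ hd (blanks (m ∸ 1)) ∷ tl (blanks (m ∸ 1)))
  back = subst (λ l → Exec (home tt) (2 + length (p ++ bit a ∷ w)) (inj₁ tt) (l , blanks (m ∸ 1)) tt
                 (blank ∷ [] , (p ++ bit a ∷ w) ++ hd (blanks (m ∸ 1)) ∷ tl (blanks (m ∸ 1))))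
               (++-ʳ++ p) (home-exec (blanks (m ∸ 1)) nb′)
  pre : p ++ w ++ blanks m ≡ layout ss ++ blanks m
  pre = trans (sym (++-assoc p w _)) (cong (_++ blanks m) (sym (layout-lookup ss i)))
  lay : p ++ bit a ∷ w ≡ layout (ss [ i ]≔ (a ∷ Vec.lookup ss i))
  lay = sym (layout-update ss i _)
  post : (p ++ bit a ∷ w) ++ hd (blanks (m ∸ 1)) ∷ tl (blanks (m ∸ 1)) ≡
         layout (ss [ i ]≔ (a ∷ Vec.lookup ss i)) ++ blanks (suc (m ∸ 1 ∸ 1))
  post = cong₂ _++_ lay (hd-blanks (m ∸ 1))
  len : size ss ≡ length p + length w
  len = trans (cong length (layout-lookup ss i)) (length-++ p)
  time : length p + suc (length w) + (2 + length (p ++ bit a ∷ w)) ≤ opTime (size ss)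
  time rewrite cong length lay | size-push ss i a = push-time
    (subst (length p ≤_) (sym len) (m≤m+n (length p) (length w)))
    (subst (length w ≤_) (sym len) (m≤n+m (length w) (length p)))

-- The head cell of the popped stack is blanked; this marks where the left shift has to stop.
readTop : Mach (Maybe Bool)
readTop = single λ { b0 → inj₂ (just false) , blank , goR ; b1 → inj₂ (just true) , blank , goR
                   ; s → inj₂ nothing , s , stay }

close : Maybe Bool → Mach (Maybe Bool)
close nothing  = home nothing
close (just a) = toEnd >>= λ _ → carryL >>= λ _ → home (just a)

popM : ∀ {K} → Fin K → Mach (Maybe Bool)
popM i = at i (bind (Maybe-finite Bool-finite) readTop close)

hd∷tl : ∀ xs {y ys} → hd (xs ++ y ∷ ys) ∷ tl (xs ++ y ∷ ys) ≡ xs ++ y ∷ ys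
hd∷tl []       = refl
hd∷tl (x ∷ xs) = refl

readTop-exec : ∀ a {l r} → Exec readTop 1 tt (l , bit a ∷ r) (just a) (blank ∷ l , r)
readTop-exec false = exit refl
readTop-exec true  = exit refl

pop-time : ∀ {x y z} → x ≤ z → y ≤ z → x + (1 + (suc y + (suc y + (2 + x)))) ≤ opTime z
pop-time {x} {y} {z} x≤z y≤z = begin
  x + (1 + (suc y + (suc y + (2 + x))))
    ≡⟨ solve 2 (λ x y → x :+ (con 1 :+ (con 1 :+ y :+ (con 1 :+ y :+ (con 2 :+ x)))) := con 5 :+
      (con 2 :* x :+ con 2 :* y)) refl x y ⟩
  5 + (2 * x + 2 * y) ≤⟨ +-monoʳ-≤ 5 (+-mono-≤ (*-monoʳ-≤ 2 x≤z) (*-monoʳ-≤ 2 y≤z)) ⟩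
  5 + (2 * z + 2 * z) ≡⟨ solve 1 (λ z → con 5 :+ (con 2 :* z :+ con 2 :* z) := con 5 :+ con 4 :* z) refl z ⟩
  5 + 4 * z           ≤⟨ +-mono-≤ (m≤m+n 5 5) (*-monoˡ-≤ z (m≤m+n 4 6)) ⟩
  opTime z            ∎
  where open ≤-Reasoning

module Pop {K : ℕ} (ss : Stacks K) (i : Fin K) (m : ℕ) where

  p : List Sym
  p = before ss i

  popM-empty : Vec.lookup ss i ≡ [] → ∃ λ m′ →
               Exec (popM i) (opTime (size ss)) (entry (popM i)) (tapeOf ss m) nothing (tapeOf ss m′)
  popM-empty eq = m , Exec-mono time
    (subst₂ (λ u v → Exec (popM i) (length p + (1 + (2 + length p))) (entry (popM i)) (blank ∷ [] , u) nothing (blank ∷ [] , v))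
      (sym lay) (sym lay)
      (at-exec ss i (Exec-bind (Maybe-finite Bool-finite) readTop close (exit {k = 0} refl)
        (home-exec (sep ∷ after ss i ++ blanks m) (before-nonBlank ss i)))))
    where
    lay₀ : layout ss ≡ p ++ sep ∷ after ss i
    lay₀ = trans (layout-lookup ss i) (cong (λ s → p ++ bits s ++ sep ∷ after ss i) eq)
    lay : layout ss ++ blanks m ≡ p ++ sep ∷ after ss i ++ blanks m
    lay = trans (cong (_++ blanks m) lay₀) (++-assoc p (sep ∷ after ss i) (blanks m))
    p≤ : length p ≤ size ss
    p≤ = subst (length p ≤_) (sym (trans (cong length lay₀) (length-++ p))) (m≤m+n (length p) (suc (length (after ss i))))
    time : length p + (1 + (2 + length p)) ≤ opTime (size ss)
    time = ≤-trans (+-monoʳ-≤ (length p) (+-monoʳ-≤ 1 (≤-trans (m≤n+m (2 + length p) 1) (m≤n+m (suc (2 + length p)) 1))))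
             (pop-time {y = 0} p≤ z≤n)

  popM-cons : ∀ {a xs} → Vec.lookup ss i ≡ a ∷ xs → ∃ λ m′ →
              Exec (popM i) (opTime (size ss)) (entry (popM i)) (tapeOf ss m) (just a) (tapeOf (ss [ i ]≔ xs) m′)
  -- Of the two extra blanks, one is read at the right end and one replaces the last nonblank cell,
  -- which has moved to the left.
  popM-cons {a} {xs} eq = 2 + (m ∸ 1) , Exec-mono time
    (subst₂ (λ u v → Exec (popM i) (length p + (1 + (suc (length w) + (suc (length w) + (2 + length p)))))
                          (entry (popM i)) (blank ∷ [] , u) (just a) (blank ∷ [] , v))
      (sym lay) post
      (at-exec ss i (Exec-bind (Maybe-finite Bool-finite) readTop close (readTop-exec a)
        (Exec-bind ⊤-finite toEnd (λ _ → carryL >>= λ _ → home (just a)) (toEnd-exec m w-nb)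
          (Exec-bind ⊤-finite carryL (λ _ → home (just a)) shift
            (home-exec (w ++ blanks (2 + (m ∸ 1))) (before-nonBlank ss i)))))))
    where
    w = bits xs ++ sep ∷ after ss i
    w-nb : NonBlank w
    w-nb = All.++⁺ (bits-nonBlank xs) ((λ ()) ∷ after-nonBlank ss i)
    l = p ʳ++ (blank ∷ [])
    lay₀ : layout ss ≡ p ++ bit a ∷ w
    lay₀ = trans (layout-lookup ss i) (cong (λ s → p ++ bits s ++ sep ∷ after ss i) eq)
    lay : layout ss ++ blanks m ≡ p ++ bit a ∷ w ++ blanks m
    lay = trans (cong (_++ blanks m) lay₀) (++-assoc p (bit a ∷ w) (blanks m))
    shift : Exec carryL (suc (length w)) blank (moveTo goL (w ʳ++ (blank ∷ l)) blank (blanks (m ∸ 1)))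
                 tt (l , w ++ blanks (2 + (m ∸ 1)))
    shift = subst₂ (λ u v → Exec carryL (suc v) blank (moveTo goL u blank (blanks (m ∸ 1)))
                      tt (l , w ++ blanks (2 + (m ∸ 1)))) (sym (ʳ++-defn w)) (length-reverse w)
              (subst (λ u → Exec carryL (suc (length (reverse w))) blank
                (moveTo goL (reverse w ++ blank ∷ l) blank (blanks (m ∸ 1)))
                      tt (l , u)) (reverse-ʳ++ w (blanks (2 + (m ∸ 1))))
                (carryL-exec blank blank (blanks (m ∸ 1)) (All-ʳ++ w-nb [])))
    full : hd (w ++ blanks (2 + (m ∸ 1))) ∷ tl (w ++ blanks (2 + (m ∸ 1))) ≡ w ++ blanks (2 + (m ∸ 1))
    full = hd∷tl w
    post : p ++ hd (w ++ blanks (2 + (m ∸ 1))) ∷ tl (w ++ blanks (2 + (m ∸ 1))) ≡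
           layout (ss [ i ]≔ xs) ++ blanks (2 + (m ∸ 1))
    post = trans (cong (p ++_) full) (trans (sym (++-assoc p w _))
      (cong (_++ blanks (2 + (m ∸ 1))) (sym (layout-update ss i xs))))
    len : size ss ≡ length p + suc (length w)
    len = trans (cong length lay₀) (length-++ p)
    time : length p + (1 + (suc (length w) + (suc (length w) + (2 + length p)))) ≤ opTime (size ss)
    time = pop-time (subst (length p ≤_) (sym len) (m≤m+n (length p) (suc (length w))))
                    (subst (length w ≤_) (sym len) (≤-trans (n≤1+n (length w)) (m≤n+m (suc (length w)) (length p))))

  size-pop : ∀ {a xs} → Vec.lookup ss i ≡ a ∷ xs → size (ss [ i ]≔ xs) ≤ size ss
  size-pop {a} {xs} eq = begin
    size (ss [ i ]≔ xs)                                           ≡⟨ size-update ss i xs ⟩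
    length p + (length xs + suc (length (after ss i)))            ≤⟨ +-monoʳ-≤ (length p) (n≤1+n _) ⟩
    length p + (length (a ∷ xs) + suc (length (after ss i)))      ≡⟨ cong
      (λ s → length p + (length s + suc (length (after ss i)))) (sym eq) ⟩
    length p + (length (Vec.lookup ss i) + suc (length (after ss i))) ≡⟨ sym (size-lookup ss i) ⟩
    size ss ∎
    where open ≤-Reasoning

open Pop using (popM-empty; popM-cons; size-pop)

-- Stack programs

infixr 4 _⟫_

data Prog (K : ℕ) : Set where
  ret  : Bool → Prog K
  push : Fin K → Bool → Prog K
  pop  : Fin K → (empty zer one : Prog K) → Prog K
  _⟫_  : Prog K → Prog K → Prog K
  loop : Prog K → Prog K

compile : ∀ {K} → Prog K → Mach Bool
compile (ret b)       = retM b
compile (push i a)    = pushM i a >>= λ _ → retM true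
compile (pop i p q r) = bind (Maybe-finite Bool-finite) (popM i) branch
  where
  branch : Maybe Bool → Mach Bool
  branch nothing      = compile p
  branch (just false) = compile q
  branch (just true)  = compile r
compile (p ⟫ q)       = bind Bool-finite (compile p) (λ _ → compile q)
compile (loop p)      = loopM (compile p)

mutual

  -- Bounding the iterations of every loop by the same N makes `steps p N` a bound that depends on the program text alone.
  data Run {K} (N : ℕ) : Prog K → Stacks K → Bool → Stacks K → Set where
    ret   : ∀ {b s} → Run N (ret b) s b s
    push  : ∀ {i a s} → Run N (push i a) s true (s [ i ]≔ (a ∷ Vec.lookup s i))
    pop∅  : ∀ {i p q r s b s′} → Vec.lookup s i ≡ [] → Run N p s b s′ → Run N (pop i p q r) s b s′
    pop₀  : ∀ {i p q r s xs b s′} → Vec.lookup s i ≡ false ∷ xs → Run N q (s [ i ]≔ xs) b s′ → Run N (pop i p q r) s b s′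
    pop₁  : ∀ {i p q r s xs b s′} → Vec.lookup s i ≡ true ∷ xs → Run N r (s [ i ]≔ xs) b s′ → Run N (pop i p q r) s b s′
    _⟫_   : ∀ {p q s a s′ b s″} → Run N p s a s′ → Run N q s′ b s″ → Run N (p ⟫ q) s b s″
    loop  : ∀ {p k s s′ s″} → Iter N p k s s′ → k ≤ N → Run N p s′ false s″ → Run N (loop p) s false s″

  data Iter {K} (N : ℕ) (p : Prog K) : ℕ → Stacks K → Stacks K → Set where
    []  : ∀ {s} → Iter N p 0 s s
    _∷_ : ∀ {k s s′ s″} → Run N p s true s′ → Iter N p k s′ s″ → Iter N p (suc k) s s″

-- Serves twice: it bounds the number of stack operations, and it bounds the growth of the tape,
-- because one operation adds at most one cell. The three branches of a pop are added instead of
-- taking their maximum, so that only sums and products of polynomials arise; a loop has one extra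
-- summand for the run of its body that ends it.
steps : ∀ {K} → Prog K → ℕ → ℕ
steps (ret b)       N = 1
steps (push i a)    N = 2
steps (pop i p q r) N = 1 + (steps p N + steps q N + steps r N)
steps (p ⟫ q)       N = steps p N + steps q N
steps (loop p)      N = steps p N + N * steps p N

Run-size : ∀ {K N} {p : Prog K} {s b s′} → Run N p s b s′ → size s′ ≤ steps p N + size s
Iter-size : ∀ {K N} {p : Prog K} {k s s′} → Iter N p k s s′ → size s′ ≤ k * steps p N + size s

Run-size ret = n≤1+n _
Run-size {N = N} {s = s} (push {i} {a}) = ≤-trans (≤-reflexive (size-push s i a)) (n≤1+n (suc (size s)))
Run-size {N = N} {pop i p q r} {s} (pop∅ eq x) = ≤-trans (Run-size x)
  (+-monoˡ-≤ (size s) (m≤n⇒m≤1+n (≤-trans (m≤m+n (steps p N) (steps q N)) (m≤m+n (steps p N + steps q N) (steps r N)))))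
Run-size {N = N} {pop i p q r} {s} (pop₀ eq x) = ≤-trans (Run-size x)
  (+-mono-≤ (m≤n⇒m≤1+n (≤-trans (m≤n+m (steps q N) (steps p N)) (m≤m+n (steps p N + steps q N) (steps r N))))
    (size-pop s i 0 eq))
Run-size {N = N} {pop i p q r} {s} (pop₁ eq x) = ≤-trans (Run-size x)
  (+-mono-≤ (m≤n⇒m≤1+n (m≤n+m (steps r N) (steps p N + steps q N))) (size-pop s i 0 eq))
Run-size {N = N} {p ⟫ q} {s} (x ⟫ y) = ≤-trans (Run-size y) (≤-trans (+-monoʳ-≤ (steps q N) (Run-size x))
  (≤-reflexive (trans (sym (+-assoc (steps q N) (steps p N) (size s))) (cong (_+ size s) (+-comm (steps q N) (steps p N))))))
Run-size {N = N} {loop p} {s} (loop {k = k} xs k≤N y) = ≤-trans (Run-size y)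
  (≤-trans (+-monoʳ-≤ (steps p N) (≤-trans (Iter-size xs) (+-monoˡ-≤ (size s) (*-monoˡ-≤ (steps p N) k≤N))))
    (≤-reflexive (sym (+-assoc (steps p N) (N * steps p N) (size s)))))

Iter-size [] = ≤-refl
Iter-size {N = N} {p} {suc k} {s} (x ∷ xs) = ≤-trans (Iter-size xs) (≤-trans (+-monoʳ-≤ (k * steps p N) (Run-size x))
  (≤-reflexive (trans (sym (+-assoc (k * steps p N) (steps p N) (size s)))
    (cong (_+ size s) (+-comm (k * steps p N) (steps p N))))))

tapeOf-hd : ∀ {K} (ss : Stacks K) m → ∃ λ m′ →
            hd (layout ss ++ blanks m) ∷ tl (layout ss ++ blanks m) ≡ layout ss ++ blanks m′
tapeOf-hd []       m = suc (m ∸ 1) , hd-blanks m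
tapeOf-hd (s ∷ ss) m = m , subst (λ w → hd w ∷ tl w ≡ w) (sym (++-assoc (bits s) (sep ∷ layout ss) (blanks m))) (hd∷tl (bits s))

Exec-ret : ∀ {K} (ss : Stacks K) (b : Bool) m k → ∃ λ m′ → Exec (retM b) (suc k) tt (tapeOf ss m) b (tapeOf ss m′)
Exec-ret ss b m k = let m′ , eq = tapeOf-hd ss m in
  m′ , subst (λ r → Exec (retM b) (suc k) tt (tapeOf ss m) b (blank ∷ [] , r)) eq (exit refl)

opTime-mono : ∀ {x y} → x ≤ y → opTime x ≤ opTime y
opTime-mono x≤y = +-monoʳ-≤ 10 (*-monoʳ-≤ 10 x≤y)

module Simulation {K : ℕ} (N W : ℕ) where

  Simulates : (p : Prog K) → Stacks K → Bool → Stacks K → Set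
  Simulates p s b s′ = ∀ m → ∃ λ m′ →
    Exec (compile p) (steps p N * opTime W) (entry (compile p)) (tapeOf s m) b (tapeOf s′ m′)

  pop-time-≤ : ∀ {z a} c → z ≤ W → a ≤ c → opTime z + a * opTime W ≤ suc c * opTime W
  pop-time-≤ c z≤W a≤c = +-mono-≤ (opTime-mono z≤W) (*-monoˡ-≤ (opTime W) a≤c)

  -- `W` bounds all layouts that can occur, so every operation costs at most `opTime W`. The
  -- hypothesis passes to later parts of a program because `Run-size` charges their growth to the
  -- steps already spent.
  simulate : ∀ {p s b s′} → Run N p s b s′ → steps p N + size s ≤ W → Simulates p s b s′
  simulate-loop : ∀ {p k s s′ s″} → Iter N p k s s′ → Run N p s′ false s″ →
                  steps p N + k * steps p N + size s ≤ W → ∀ m → ∃ λ m′ →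
                  Exec (loopM (compile p)) ((steps p N + k * steps p N) * opTime W)
                       (entry (compile p)) (tapeOf s m) false (tapeOf s″ m′)

  simulate {ret b} {s} ret _ m = Exec-ret s b m _
  simulate {push i a} {s} push fits m =
    let m′ , x = pushM-exec s i a m
        m″ , y = Exec-ret (s [ i ]≔ (a ∷ Vec.lookup s i)) true m′ 0
    in m″ , Exec-mono (+-mono-≤ (opTime-mono (≤-trans (m≤n+m (size s) 2) fits)) (≤-trans (s≤s z≤n) (m≤m+n (opTime W) 0)))
              (Exec-bind ⊤-finite (pushM i a) (λ _ → retM true) x y)
  simulate {pop i p q r} {s} (pop∅ eq x) fits m =
    let a≤   = ≤-trans (m≤m+n (steps p N) (steps q N)) (m≤m+n (steps p N + steps q N) (steps r N))
        m′ , u = popM-empty s i m eq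
        m″ , v = simulate x (≤-trans (+-monoˡ-≤ (size s) (m≤n⇒m≤1+n a≤)) fits) m′
    in m″ , Exec-mono (pop-time-≤ (steps p N + steps q N + steps r N) (≤-trans (m≤n+m (size s) _) fits) a≤)
              (Exec-bind (Maybe-finite Bool-finite) (popM i) _ u v)
  simulate {pop i p q r} {s} (pop₀ eq x) fits m =
    let a≤   = ≤-trans (m≤n+m (steps q N) (steps p N)) (m≤m+n (steps p N + steps q N) (steps r N))
        m′ , u = popM-cons s i m eq
        m″ , v = simulate x (≤-trans (+-mono-≤ (m≤n⇒m≤1+n a≤) (size-pop s i m eq)) fits) m′
    in m″ , Exec-mono (pop-time-≤ (steps p N + steps q N + steps r N) (≤-trans (m≤n+m (size s) _) fits) a≤)
              (Exec-bind (Maybe-finite Bool-finite) (popM i) _ u v)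
  simulate {pop i p q r} {s} (pop₁ eq x) fits m =
    let a≤   = m≤n+m (steps r N) (steps p N + steps q N)
        m′ , u = popM-cons s i m eq
        m″ , v = simulate x (≤-trans (+-mono-≤ (m≤n⇒m≤1+n a≤) (size-pop s i m eq)) fits) m′
    in m″ , Exec-mono (pop-time-≤ (steps p N + steps q N + steps r N) (≤-trans (m≤n+m (size s) _) fits) a≤)
              (Exec-bind (Maybe-finite Bool-finite) (popM i) _ u v)
  simulate {p ⟫ q} {s} (_⟫_ {s′ = s′} x y) fits m =
    let m′ , u = simulate x (≤-trans (+-monoˡ-≤ (size s) (m≤m+n (steps p N) (steps q N))) fits) m
        m″ , v = simulate y (≤-trans (+-monoʳ-≤ (steps q N) (Run-size x)) (≤-trans (≤-reflexive
                   (trans (sym (+-assoc (steps q N) (steps p N) (size s)))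
                     (cong (_+ size s) (+-comm (steps q N) (steps p N))))) fits)) m′
    in m″ , Exec-mono (≤-reflexive (sym (*-distribʳ-+ (opTime W) (steps p N) (steps q N))))
              (Exec-bind Bool-finite (compile p) (λ _ → compile q) u v)
  simulate {loop p} {s} (loop {k = k} xs k≤N y) fits m =
    let le = +-monoʳ-≤ (steps p N) (*-monoˡ-≤ (steps p N) k≤N)
        m′ , u = simulate-loop xs y (≤-trans (+-monoˡ-≤ (size s) le) fits) m
    in m′ , Exec-mono (*-monoˡ-≤ (opTime W) le) u

  simulate-loop {p} {s = s} [] y fits m =
    let m′ , u = simulate y (≤-trans (+-monoˡ-≤ (size s) (m≤m+n (steps p N) 0)) fits) m
    in m′ , Exec-mono (*-monoˡ-≤ (opTime W) (m≤m+n (steps p N) 0)) (Exec-stop (compile p) u)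
  simulate-loop {p} {suc k} {s} (x ∷ xs) y fits m =
    let a = steps p N
        m′ , u = simulate x (≤-trans (+-monoˡ-≤ (size s) (m≤m+n a (a + k * a))) fits) m
        m″ , v = simulate-loop xs y (≤-trans (+-monoʳ-≤ (a + k * a) (Run-size x)) (≤-trans (≤-reflexive
                   (trans (sym (+-assoc (a + k * a) a (size s))) (cong (_+ size s) (+-comm (a + k * a) a)))) fits)) m′
    in m″ , Exec-mono (≤-reflexive (sym (*-distribʳ-+ (opTime W) a (a + k * a))))
              (Exec-more (compile p) u v)

-- Polynomial bounds

Poly : (ℕ → ℕ) → Set
Poly f = ∃ λ c → ∃ λ k → ∀ n → f n ≤ c * suc n ^ k

poly-const : ∀ a → Poly (λ _ → a)
poly-const a = a , 0 , λ n → ≤-reflexive (sym (*-identityʳ a))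

poly-id : Poly (λ n → n)
poly-id = 1 , 1 , λ n → ≤-trans (n≤1+n n) (≤-reflexive (sym (trans (*-identityˡ _) (*-identityʳ (suc n)))))

poly-+ : ∀ {f g} → Poly f → Poly g → Poly (λ n → f n + g n)
poly-+ (c , j , p) (d , k , q) = c + d , j + k , λ n → ≤-trans
  (+-mono-≤ (≤-trans (p n) (*-monoʳ-≤ c (^-monoʳ-≤ (suc n) (m≤m+n j k))))
            (≤-trans (q n) (*-monoʳ-≤ d (^-monoʳ-≤ (suc n) (m≤n+m k j)))))
  (≤-reflexive (sym (*-distribʳ-+ (suc n ^ (j + k)) c d)))

poly-* : ∀ {f g} → Poly f → Poly g → Poly (λ n → f n * g n)
poly-* (c , j , p) (d , k , q) = c * d , j + k , λ n → ≤-trans (*-mono-≤ (p n) (q n))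
  (≤-reflexive (trans ([m*n]*[o*p]≡[m*o]*[n*p] c (suc n ^ j) d (suc n ^ k))
    (cong (c * d *_) (sym (^-distribˡ-+-* (suc n) j k)))))

poly-steps : ∀ {K} (p : Prog K) → Poly (steps p)
poly-steps (ret b)       = poly-const 1
poly-steps (push i a)    = poly-const 2
poly-steps (pop i p q r) = poly-+ (poly-const 1) (poly-+ (poly-+ (poly-steps p) (poly-steps q)) (poly-steps r))
poly-steps (p ⟫ q)       = poly-+ (poly-steps p) (poly-steps q)
poly-steps (loop p)      = poly-+ (poly-steps p) (poly-* poly-id (poly-steps p))

^-distribʳ-* : ∀ k m n → (m * n) ^ k ≡ m ^ k * n ^ k
^-distribʳ-* zero    m n = refl
^-distribʳ-* (suc k) m n =
  trans (cong (m * n *_) (^-distribʳ-* k m n)) ([m*n]*[o*p]≡[m*o]*[n*p] m n (m ^ k) (n ^ k))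

-- For `1 ≤ n` one has `suc n ≤ 2 * n`, and the factor `2 ^ k` is absorbed into the constant.
poly-bound : ∀ {f} → Poly f → ∃ λ c → ∃ λ k → ∀ n → 1 ≤ n → f n ≤ c * n ^ k + c
poly-bound {f} (c , k , p) = c * 2 ^ k , k , bound
  where
  open ≤-Reasoning
  bound : ∀ n → 1 ≤ n → f n ≤ c * 2 ^ k * n ^ k + c * 2 ^ k
  bound n 1≤n = begin
    f n                       ≤⟨ p n ⟩
    c * suc n ^ k             ≤⟨ *-monoʳ-≤ c (^-monoˡ-≤ k (+-mono-≤ 1≤n (≤-reflexive (sym (+-identityʳ n))))) ⟩
    c * (2 * n) ^ k           ≡⟨ cong (c *_) (^-distribʳ-* k 2 n) ⟩
    c * (2 ^ k * n ^ k)       ≡⟨ sym (*-assoc c (2 ^ k) (n ^ k)) ⟩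
    c * 2 ^ k * n ^ k         ≤⟨ m≤m+n _ _ ⟩
    c * 2 ^ k * n ^ k + c * 2 ^ k ∎

-- From stack programs to Turing machines

appendSep : Mach ⊤
appendSep = single λ { blank → inj₂ tt , sep , goR ; s → inj₁ tt , s , goR }

appendSeps : ℕ → Mach ⊤
appendSeps zero    = home tt
appendSeps (suc k) = appendSep >>= λ _ → appendSeps k

-- One step left and one step back turn the cell before the input into an explicit blank, the border
-- needed by `rewind`.
setup : ℕ → Mach ⊤
setup k = moveM goL >>= λ _ → moveM goR >>= λ _ → appendSeps k

-- Blanking the first separator makes `readOut` stop exactly at the end of the first stack.
cutTape : Mach ⊤
cutTape = single λ { sep → inj₂ tt , blank , goL ; s → inj₁ tt , s , goR }

finish : Mach ⊤
finish = cutTape >>= λ _ → rewind tt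

appendSep-exec : ∀ {w l} → NonBlank w → Exec appendSep (suc (length w)) tt (l , w) tt (sep ∷ (w ʳ++ l) , [])
appendSep-exec [] = exit refl
appendSep-exec {blank ∷ w} (p ∷ ps) with () ← p refl
appendSep-exec {b0 ∷ w}    (p ∷ ps) = cont refl (appendSep-exec ps)
appendSep-exec {b1 ∷ w}    (p ∷ ps) = cont refl (appendSep-exec ps)
appendSep-exec {sep ∷ w}   (p ∷ ps) = cont refl (appendSep-exec ps)

seps : ℕ → List Sym
seps k = replicate k sep

appendSeps-exec : ∀ {w} v k → NonBlank w → NonBlank v →
                  Exec (appendSeps (suc k)) (suc (length v) + (k + (2 + length (w ++ v ++ seps (suc k)))))
                       (entry (appendSeps (suc k)))
                       (w ʳ++ (blank ∷ []) , v) tt (blank ∷ [] , (w ++ v ++ seps (suc k)) ++ blank ∷ [])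
appendSeps-exec {w} v zero nb nb′ = Exec-bind ⊤-finite appendSep (λ _ → home tt) (appendSep-exec nb′)
  (subst (λ l → Exec (home tt) (2 + length (w ++ v ++ seps 1)) (inj₁ tt) (l , []) tt
                 (blank ∷ [] , (w ++ v ++ seps 1) ++ blank ∷ []))
    (trans (++-ʳ++ w) (++-ʳ++ v)) (home-exec [] (All.++⁺ nb (All.++⁺ nb′ ((λ ()) ∷ [])))))
appendSeps-exec {w} v (suc k) nb nb′ = Exec-bind ⊤-finite appendSep (λ _ → appendSeps (suc k)) (appendSep-exec nb′)
  (subst₂ (λ l u → Exec (appendSeps (suc k)) (1 + (k + (2 + length u))) (entry (appendSeps (suc k)))
             (l , []) tt (blank ∷ [] , u ++ blank ∷ []))
    (trans (++-ʳ++ w) (++-ʳ++ v)) (trans (++-assoc w (v ++ sep ∷ []) _) (cong (w ++_) (++-assoc v (sep ∷ []) _)))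
    (appendSeps-exec [] k (All.++⁺ nb (All.++⁺ nb′ ((λ ()) ∷ []))) []))

cutTape-exec : ∀ xs {l r} → Exec cutTape (suc (length xs)) tt (l , bits xs ++ sep ∷ r) tt (moveTo goL (bits xs ʳ++ l) blank r)
cutTape-exec []           = exit refl
cutTape-exec (false ∷ xs) = cont refl (cutTape-exec xs)
cutTape-exec (true ∷ xs)  = cont refl (cutTape-exec xs)

finish-exec : ∀ xs {r} → Exec finish (suc (length xs) + suc (length xs)) (entry finish)
              (blank ∷ [] , bits xs ++ sep ∷ r) tt (blank ∷ [] , bits xs ++ blank ∷ r)
finish-exec xs {r} = Exec-bind ⊤-finite cutTape (λ _ → rewind tt) (cutTape-exec xs)
  (subst₂ (λ u t → Exec (rewind tt) (suc t) tt (moveTo goL u blank r) tt (blank ∷ [] , bits xs ++ blank ∷ r))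
    (sym (ʳ++-defn (bits xs))) (trans (length-reverse (bits xs)) (length-map bit xs))
    (subst (λ u → Exec (rewind tt) (suc (length (reverse (bits xs)))) tt
                    (moveTo goL (reverse (bits xs) ++ blank ∷ []) blank r) tt (blank ∷ [] , u))
      (reverse-ʳ++ (bits xs) (blank ∷ r)) (rewind-exec blank r (All-ʳ++ (bits-nonBlank xs) []))))

readOut-bits : ∀ xs {r} → readOut (bits xs ++ blank ∷ r) ≡ bits xs
readOut-bits []           = refl
readOut-bits (false ∷ xs) = cong (b0 ∷_) (readOut-bits xs)
readOut-bits (true ∷ xs)  = cong (b1 ∷_) (readOut-bits xs)

module Machine {k : ℕ} (p : Prog (3 + k)) where

  machine : Mach ⊤
  machine = setup (2 + k) >>= λ _ → bind Bool-finite (compile p) (λ _ → finish)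

  open Compile machine public using (toTM; config; Exec⇒run)

  -- The size of the initial layout, which is the input and the appended separators, plus the
  -- largest possible growth.
  space : ℕ → ℕ
  space n = steps p n + (n + (2 + k))

  time : ℕ → ℕ
  time n = (2 + (suc n + (suc k + (2 + (n + (2 + k)))))) + (steps p n * opTime (space n) + (suc (space n) + suc (space n)))

  poly-time : Poly time
  poly-time = poly-+ (poly-+ (poly-const 2) (poly-+ (poly-+ (poly-const 1) poly-id) (poly-+ (poly-const (suc k))
      (poly-+ (poly-const 2) (poly-+ poly-id (poly-const (2 + k)))))))
    (poly-+ (poly-* (poly-steps p) (poly-+ (poly-const 10) (poly-* (poly-const 10) poly-space)))
      (poly-+ (poly-+ (poly-const 1) poly-space) (poly-+ (poly-const 1) poly-space)))
    where
    poly-space : Poly space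
    poly-space = poly-+ (poly-steps p) (poly-+ poly-id (poly-const (2 + k)))

  start : List Bool → List Bool → Stacks (3 + k)
  start xs ys = xs ∷ ys ∷ Vec.replicate (suc k) []

  layout-empty : ∀ j → layout (Vec.replicate j []) ≡ seps j
  layout-empty zero    = refl
  layout-empty (suc j) = cong (sep ∷_) (layout-empty j)

  -- The separator inside the input already closes the first stack, so only `2 + k` of the `3 + k`
  -- separators have to be appended.
  layout-start : ∀ xs ys → (bits xs ++ sep ∷ bits ys) ++ seps (2 + k) ≡ layout (start xs ys)
  layout-start xs ys = trans (++-assoc (bits xs) _ _)
    (cong (λ w → bits xs ++ sep ∷ bits ys ++ sep ∷ w) (sym (layout-empty (suc k))))

  module _ (xs ys : List Bool) where

    input : List Sym
    input = bits xs ++ sep ∷ bits ys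

    n : ℕ
    n = length input

    size-start : size (start xs ys) ≡ n + (2 + k)
    size-start = trans (cong length (sym (layout-start xs ys)))
      (trans (length-++ input) (cong (n +_) (length-replicate (2 + k))))

    setup-exec : Exec (setup (2 + k)) (2 + (suc n + (suc k + (2 + (n + (2 + k))))))
                      (entry (setup (2 + k))) ([] , input) tt (tapeOf (start xs ys) 1)
    setup-exec = Exec-bind ⊤-finite (moveM goL) (λ _ → moveM goR >>= λ _ → appendSeps (2 + k)) {j = 1} (exit refl)
      (Exec-bind ⊤-finite (moveM goR) (λ _ → appendSeps (2 + k)) {j = 1} (exit refl)
        (subst₂ (λ u t → Exec (appendSeps (2 + k)) (suc n + (suc k + (2 + t))) (entry (appendSeps (2 + k)))
                          (blank ∷ [] , hd input ∷ tl input) tt (blank ∷ [] , u ++ blank ∷ []))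
          (layout-start xs ys) (trans (length-++ input) (cong (n +_) (length-replicate (2 + k))))
          (subst (λ v → Exec (appendSeps (2 + k)) (suc n + (suc k + (2 + length (input ++ seps (2 + k)))))
                          (entry (appendSeps (2 + k))) (blank ∷ [] , v) tt (blank ∷ [] , (input ++ seps (2 + k)) ++ blank ∷ []))
            (sym (hd∷tl (bits xs)))
            (appendSeps-exec input (suc k) [] (All.++⁺ (bits-nonBlank xs) ((λ ()) ∷ bits-nonBlank ys))))))

    initial-config : initial toTM input ≡ config (TM.start toTM) ([] , input)
    initial-config with input
    ... | []    = refl
    ... | x ∷ w = refl

    halts : ∀ {b zs ss t} → Run n p (start xs ys) b (zs ∷ ss) → time n ≤ t → HaltsWithin toTM input t (bits zs)
    halts {b} {zs} {ss} {t} x time≤t =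
      config zero (blank ∷ [] , bits zs ++ blank ∷ layout ss ++ blanks m) ,
      trans (cong (run toTM t) initial-config) (Exec⇒run (Exec-mono time≤t whole)) ,
      trans (cong readOut (hd∷tl (bits zs))) (readOut-bits zs)
      where
      fits : steps p n + size (start xs ys) ≤ space n
      fits = ≤-reflexive (cong (steps p n +_) size-start)
      simulated = Simulation.simulate n (space n) x fits 1
      m = proj₁ simulated
      zs≤ : length zs ≤ space n
      zs≤ = ≤-trans (≤-trans (≤-trans (≤-reflexive (sym (length-map bit zs))) (m≤m+n _ _))
                      (≤-trans (≤-reflexive (sym (length-++ (bits zs)))) (Run-size x))) fits
      last : Exec finish (suc (space n) + suc (space n)) (entry finish) (tapeOf (zs ∷ ss) m) tt
                  (blank ∷ [] , bits zs ++ blank ∷ layout ss ++ blanks m)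
      last = Exec-mono (+-mono-≤ (s≤s zs≤) (s≤s zs≤))
        (subst (λ v → Exec finish (suc (length zs) + suc (length zs)) (entry finish) (blank ∷ [] , v) tt
                 (blank ∷ [] , bits zs ++ blank ∷ layout ss ++ blanks m))
          (sym (++-assoc (bits zs) (sep ∷ layout ss) (blanks m))) (finish-exec zs))
      whole : Exec machine (time n) (entry machine) ([] , input) tt
                   (blank ∷ [] , bits zs ++ blank ∷ layout ss ++ blanks m)
      whole = Exec-bind ⊤-finite (setup (2 + k)) (λ _ → bind Bool-finite (compile p) (λ _ → finish)) setup-exec
        (Exec-bind Bool-finite (compile p) (λ _ → finish) (proj₂ simulated) last)

-- Covers by paths

-- A cover is the list of all terminals; `new` opens a new path, `adj` continues the current one, and `via u w` opens
-- a path that could be joined to the current one through the nonterminal u.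
data Item (V : Set) : Set where
  new adj : V → Item V
  via     : V → V → Item V

Segment : Set → Set
Segment V = V × List V

module _ {V : Set} where

  verts : List (Item V) → List V
  verts []             = []
  verts (new w ∷ S)    = w ∷ verts S
  verts (adj w ∷ S)    = w ∷ verts S
  verts (via u w ∷ S)  = u ∷ w ∷ verts S

  vias : List (Item V) → List V
  vias []            = []
  vias (new w ∷ S)   = vias S
  vias (adj w ∷ S)   = vias S
  vias (via u w ∷ S) = u ∷ vias S

  pieces : List (Item V) → ℕ
  pieces []            = 0
  pieces (new w ∷ S)   = suc (pieces S)
  pieces (adj w ∷ S)   = pieces S
  pieces (via u w ∷ S) = suc (pieces S)

  breaks : List (Item V) → ℕ
  breaks []            = 0
  breaks (new w ∷ S)   = suc (breaks S)
  breaks (adj w ∷ S)   = breaks S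
  breaks (via u w ∷ S) = breaks S

  vertsOf : List (Segment V) → List V
  vertsOf []             = []
  vertsOf ((y , ys) ∷ Q) = y ∷ ys ++ vertsOf Q

  segments : List (Segment V) → List (Item V)
  segments []             = []
  segments ((y , ys) ∷ Q) = new y ∷ map adj ys ++ segments Q

  attached : List (Segment V) → List (Item V)
  attached []             = []
  attached ((y , ys) ∷ Q) = adj y ∷ map adj ys ++ segments Q

  -- Split k S p Q: dropping the vias of S and cutting it at its first k links leaves the initial run p and the segments Q.
  data Split : ℕ → List (Item V) → List V → List (Segment V) → Set where
    []  : ∀ {k} → Split k [] [] []
    new : ∀ {k S p Q w} → Split k S p Q → Split k (new w ∷ S) [] ((w , p) ∷ Q)
    via : ∀ {k S p Q u w} → Split k S p Q → Split k (via u w ∷ S) [] ((w , p) ∷ Q)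
    cut : ∀ {k S p Q w} → Split k S p Q → Split (suc k) (adj w ∷ S) [] ((w , p) ∷ Q)
    adj : ∀ {S p Q w} → Split 0 S p Q → Split 0 (adj w ∷ S) (w ∷ p) Q

  -- While segments remain, each `new` is a gap between two paths, and the next segment is placed
  -- there with an edge of the join at either end. Vias are passed over: they are left to `Bridge`,
  -- since only proper breaks are beyond the reach of connectors.
  data Close : List (Item V) → List (Segment V) → List (Item V) → List (Segment V) → Set where
    []   : ∀ {Q} → Close [] Q [] Q
    keep : ∀ {S S′ Q′ w} → Close S [] S′ Q′ → Close (new w ∷ S) [] (new w ∷ S′) Q′
    new  : ∀ {S Q S′ Q′ w y ys} → Close S Q S′ Q′ →
           Close (new w ∷ S) ((y , ys) ∷ Q) (adj y ∷ map adj ys ++ adj w ∷ S′) Q′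
    adj  : ∀ {S Q S′ Q′ w} → Close S Q S′ Q′ → Close (adj w ∷ S) Q (adj w ∷ S′) Q′
    via  : ∀ {S Q S′ Q′ u w} → Close S Q S′ Q′ → Close (via u w ∷ S) Q (via u w ∷ S′) Q′

  -- Vias closed by a segment release their nonterminals, which are collected in the last index.
  data Bridge : List (Item V) → List (Segment V) → List V →
                List (Item V) → List (Segment V) → List V → List V → Set where
    []    : ∀ {Q R} → Bridge [] Q R [] Q R []
    keepᵛ : ∀ {S R S′ Q′ R′ us u w} → Bridge S [] R S′ Q′ R′ us →
            Bridge (via u w ∷ S) [] R (via u w ∷ S′) Q′ R′ us
    via   : ∀ {S Q R S′ Q′ R′ us u w y ys} → Bridge S Q R S′ Q′ R′ us →
            Bridge (via u w ∷ S) ((y , ys) ∷ Q) R (adj y ∷ map adj ys ++ adj w ∷ S′) Q′ R′ (u ∷ us)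
    keepⁿ : ∀ {S Q S′ Q′ R′ us w} → Bridge S Q [] S′ Q′ R′ us →
            Bridge (new w ∷ S) Q [] (new w ∷ S′) Q′ R′ us
    new   : ∀ {S Q R S′ Q′ R′ us u w} → Bridge S Q R S′ Q′ R′ us →
            Bridge (new w ∷ S) Q (u ∷ R) (via u w ∷ S′) Q′ R′ us
    adj   : ∀ {S Q R S′ Q′ R′ us w} → Bridge S Q R S′ Q′ R′ us → Bridge (adj w ∷ S) Q R (adj w ∷ S′) Q′ R′ us

  -- The item `new h` is set apart because no path precedes it, so it is not a gap. A cover by `p`
  -- paths therefore has `p - 1` gaps to offer to at most `p` segments, and one segment may be left
  -- to be attached at the end.
  data Join : List (Item V) → List V → List (Item V) → List V → List (Item V) → List V → Set where
    empty : ∀ {R₁ R₂} → Join [] R₁ [] R₂ [] (R₁ ++ R₂)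
    join  : ∀ {k h S S₁ S′ R₁ T R₂ R₂′ Q Q₁ Q′ us} → pieces (new h ∷ S) ≡ pieces T + k →
            Split k T [] Q → Close S Q S₁ Q₁ → Bridge S₁ Q₁ (vias T ʳ++ R₂) S′ Q′ R₂′ us →
            Join (new h ∷ S) R₁ T R₂ (new h ∷ S′ ++ attached Q′) ((us ʳ++ R₁) ++ R₂′)

  -- Leaving the weight arbitrary makes one identity serve several ends: weight 1 compares lengths,
  -- and the indicator of a vertex gives membership and absence of repetitions.
  weight : (V → ℕ) → List V → ℕ
  weight f []       = 0
  weight f (v ∷ vs) = f v + weight f vs

  -- Multiset equality, in a form whose instances are semiring identities.
  infix 4 _≋_
  _≋_ : List V → List V → Set
  xs ≋ ys = ∀ f → weight f xs ≡ weight f ys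

  weight-++ : ∀ f xs {ys} → weight f (xs ++ ys) ≡ weight f xs + weight f ys
  weight-++ f []       = refl
  weight-++ f (x ∷ xs) = trans (cong (f x +_) (weight-++ f xs)) (sym (+-assoc (f x) _ _))

  weight-ʳ++ : ∀ f xs {ys} → weight f (xs ʳ++ ys) ≡ weight f xs + weight f ys
  weight-ʳ++ f []            = refl
  weight-ʳ++ f (x ∷ xs) {ys} = trans (weight-ʳ++ f xs)
    (solve 3 (λ a b c → b :+ (a :+ c) := a :+ b :+ c) refl (f x) (weight f xs) (weight f ys))

  weight-links : ∀ f ys {S} → weight f (verts (map adj ys ++ S)) ≡ weight f ys + weight f (verts S)
  weight-links f []       = refl
  weight-links f (y ∷ ys) = trans (cong (f y +_) (weight-links f ys)) (sym (+-assoc (f y) _ _))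

  weight-items : ∀ f S {S′} → weight f (verts (S ++ S′)) ≡ weight f (verts S) + weight f (verts S′)
  weight-items f []            = refl
  weight-items f (new w ∷ S)   = trans (cong (f w +_) (weight-items f S)) (sym (+-assoc (f w) _ _))
  weight-items f (adj w ∷ S)   = trans (cong (f w +_) (weight-items f S)) (sym (+-assoc (f w) _ _))
  weight-items f (via u w ∷ S) {S′} = trans (cong (λ z → f u + (f w + z)) (weight-items f S))
    (solve 4 (λ a b c d → a :+ (b :+ (c :+ d)) := a :+ (b :+ c) :+ d) refl (f u) (f w) (weight f (verts S))
      (weight f (verts S′)))

  weight-segments : ∀ f Q → weight f (verts (segments Q)) ≡ weight f (vertsOf Q)
  weight-segments f []             = refl
  weight-segments f ((y , ys) ∷ Q) = cong (f y +_) (trans (weight-links f ys)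
    (trans (cong (weight f ys +_) (weight-segments f Q)) (sym (weight-++ f ys))))

  weight-attached : ∀ f Q → weight f (verts (attached Q)) ≡ weight f (vertsOf Q)
  weight-attached f []             = refl
  weight-attached f ((y , ys) ∷ Q) = weight-segments f ((y , ys) ∷ Q)

  Split-weight : ∀ {k S p Q} f → Split k S p Q →
                 weight f (verts S) ≡ weight f (vias S) + (weight f p + weight f (vertsOf Q))
  Split-opened : ∀ {k S p Q} f w → Split k S p Q →
                 f w + weight f (verts S) ≡ weight f (vias S) + weight f (vertsOf ((w , p) ∷ Q))
  Split-opened {S = S} {p} {Q} f w x = trans (cong (f w +_) (Split-weight f x))
    (trans (solve 4 (λ a b c d → a :+ (b :+ (c :+ d)) := b :+ (a :+ (c :+ d))) refl (f w) (weight f (vias S))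
      (weight f p) (weight f (vertsOf Q)))
      (cong (λ z → weight f (vias S) + (f w + z)) (sym (weight-++ f p))))
  Split-weight f []      = refl
  Split-weight f (new {w = w} x) = Split-opened f w x
  Split-weight f (cut {w = w} x) = Split-opened f w x
  Split-weight f (via {u = u} {w} x) = trans (cong (f u +_) (Split-opened f w x)) (sym (+-assoc (f u) _ _))
  Split-weight f (adj {S} {p} {Q} {w} x) = trans (cong (f w +_) (Split-weight f x))
    (solve 4 (λ a b c d → a :+ (b :+ (c :+ d)) := b :+ (a :+ c :+ d)) refl (f w) (weight f (vias S)) (weight f p)
      (weight f (vertsOf Q)))

  weight-insert : ∀ f y ys {S S′ Q Q′} w → weight f (verts S) + weight f (vertsOf Q) ≡ weight f (verts S′) + weight f
    (vertsOf Q′) →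
                  (f w + weight f (verts S)) + weight f (vertsOf ((y , ys) ∷ Q)) ≡
                  weight f (verts (adj y ∷ map adj ys ++ adj w ∷ S′)) + weight f (vertsOf Q′)
  weight-insert f y ys {S} {S′} {Q} {Q′} w eq
    rewrite weight-++ f ys {vertsOf Q} | weight-links f ys {adj w ∷ S′} =
    trans (solve 5 (λ a b c d e → (a :+ b) :+ (c :+ (d :+ e)) := (a :+ (c :+ d)) :+ (b :+ e)) refl
            (f w) (weight f (verts S)) (f y) (weight f ys) (weight f (vertsOf Q)))
      (trans (cong (f w + (f y + weight f ys) +_) eq)
        (solve 5 (λ a b c d e → (a :+ (c :+ d)) :+ (b :+ e) := c :+ (d :+ (a :+ b)) :+ e) refl
          (f w) (weight f (verts S′)) (f y) (weight f ys) (weight f (vertsOf Q′))))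

  +-assoc-cong : ∀ a {b c d e} → b + c ≡ d + e → (a + b) + c ≡ (a + d) + e
  +-assoc-cong a {b} {c} {d} {e} eq = trans (+-assoc a b c) (trans (cong (a +_) eq) (sym (+-assoc a d e)))

  Close-weight : ∀ {S Q S′ Q′} f → Close S Q S′ Q′ →
                 weight f (verts S) + weight f (vertsOf Q) ≡ weight f (verts S′) + weight f (vertsOf Q′)
  Close-weight f []                  = refl
  Close-weight f (keep {w = w} x)    = +-assoc-cong (f w) (Close-weight f x)
  Close-weight f (new {S} {Q} {S′} {Q′} {w} {y} {ys} x) = weight-insert f y ys {S} {S′} {Q} {Q′} w (Close-weight f x)
  Close-weight f (adj {w = w} x)     = +-assoc-cong (f w) (Close-weight f x)
  Close-weight f (via {u = u} {w} x) = +-assoc-cong (f u) (+-assoc-cong (f w) (Close-weight f x))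

  Bridge-weight : ∀ {S Q R S′ Q′ R′ us} f → Bridge S Q R S′ Q′ R′ us →
                  weight f (verts S) + weight f (vertsOf Q) + weight f R ≡
                  weight f (verts S′) + weight f (vertsOf Q′) + (weight f R′ + weight f us)
  Bridge-weight f ([] {Q} {R}) = cong (weight f (vertsOf Q) +_) (sym (+-identityʳ _))
  Bridge-weight f (keepᵛ {S} {R} {S′} {Q′} {R′} {us} {u} {w} x) = trans
    (solve 4 (λ a b c d → (a :+ (b :+ c)) :+ con 0 :+ d := (a :+ b) :+ (c :+ con 0 :+ d)) refl (f u) (f w)
      (weight f (verts S)) (weight f R))
    (trans (cong (f u + f w +_) (Bridge-weight f x))
      (solve 5 (λ a b c d e → (a :+ b) :+ (c :+ d :+ e) := (a :+ (b :+ c)) :+ d :+ e) refl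
        (f u) (f w) (weight f (verts S′)) (weight f (vertsOf Q′)) (weight f R′ + weight f us)))
  Bridge-weight f (keepⁿ {S} {Q} {S′} {Q′} {R′} {us} {w} x) = trans
    (solve 3 (λ a b c → (a :+ b) :+ c :+ con 0 := a :+ (b :+ c :+ con 0)) refl (f w) (weight f (verts S))
      (weight f (vertsOf Q)))
    (trans (cong (f w +_) (Bridge-weight f x))
      (solve 4 (λ a b c d → a :+ (b :+ c :+ d) := (a :+ b) :+ c :+ d) refl
        (f w) (weight f (verts S′)) (weight f (vertsOf Q′)) (weight f R′ + weight f us)))
  Bridge-weight f (adj {S} {Q} {R} {S′} {Q′} {R′} {us} {w} x) = trans
    (solve 4 (λ a b c d → (a :+ b) :+ c :+ d := a :+ (b :+ c :+ d)) refl (f w) (weight f (verts S))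
      (weight f (vertsOf Q)) (weight f R))
    (trans (cong (f w +_) (Bridge-weight f x))
      (solve 4 (λ a b c d → a :+ (b :+ c :+ d) := (a :+ b) :+ c :+ d) refl
        (f w) (weight f (verts S′)) (weight f (vertsOf Q′)) (weight f R′ + weight f us)))
  Bridge-weight f (new {S} {Q} {R} {S′} {Q′} {R′} {us} {u} {w} x) = trans
    (solve 5 (λ a b c d e → (a :+ b) :+ c :+ (e :+ d) := (e :+ a) :+ (b :+ c :+ d)) refl
      (f w) (weight f (verts S)) (weight f (vertsOf Q)) (weight f R) (f u))
    (trans (cong (f u + f w +_) (Bridge-weight f x))
      (solve 5 (λ a b c d e → (a :+ b) :+ (c :+ d :+ e) := (a :+ (b :+ c)) :+ d :+ e) refl
        (f u) (f w) (weight f (verts S′)) (weight f (vertsOf Q′)) (weight f R′ + weight f us)))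
  Bridge-weight f (via {S} {Q} {R} {S′} {Q′} {R′} {us} {u} {w} {y} {ys} x)
    rewrite weight-++ f ys {vertsOf Q} | weight-links f ys {adj w ∷ S′} = trans
    (solve 7 (λ u w a y s q r → (u :+ (w :+ a)) :+ (y :+ (s :+ q)) :+ r := (u :+ w :+ y :+ s) :+ (a :+ q :+ r)) refl
      (f u) (f w) (weight f (verts S)) (f y) (weight f ys) (weight f (vertsOf Q)) (weight f R))
    (trans (cong (f u + f w + f y + weight f ys +_) (Bridge-weight f x))
      (solve 8 (λ u w a y s q r v → (u :+ w :+ y :+ s) :+ (a :+ q :+ (r :+ v)) := (y :+ (s :+ (w :+ a))) :+ q :+
        (r :+ (u :+ v))) refl
        (f u) (f w) (weight f (verts S′)) (f y) (weight f ys) (weight f (vertsOf Q′)) (weight f R′) (weight f us)))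

  Join-weight : ∀ {S R T U S′ R′} → Join S R T U S′ R′ → ∀ f →
                weight f (verts S′ ++ R′) ≡ weight f (verts S ++ R) + weight f (verts T ++ U)
  Join-weight (empty {R₁} {R₂}) f = weight-++ f R₁
  Join-weight (join {k} {h} {S} {S₁} {S′} {R₁} {T} {R₂} {R₂′} {Q} {Q₁} {Q′} {us} _ x y z) f
    rewrite weight-++ f (verts (S′ ++ attached Q′)) {(us ʳ++ R₁) ++ R₂′} | weight-++ f (us ʳ++ R₁) {R₂′} | weight-ʳ++ f us {R₁}
          | weight-items f S′ {attached Q′} | weight-attached f Q′ | weight-++ f (verts S) {R₁} | weight-++ f (verts T) {R₂}
          | Split-weight f x = begin
      f h + (s′ + q′ + (u + r₁ + r₂′))       ≡⟨ solve 6 (λ h s q u a b → h :+ (s :+ q :+ (u :+ a :+ b)) := (h :+ a) :+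
        (s :+ q :+ (b :+ u))) refl (f h) s′ q′ u r₁ r₂′ ⟩
      (f h + r₁) + (s′ + q′ + (r₂′ + u))     ≡⟨ cong (f h + r₁ +_) (sym (Bridge-weight f z)) ⟩
      (f h + r₁) + (s₁ + q₁ + weight f (vias T ʳ++ R₂)) ≡⟨ cong (λ a → (f h + r₁) + (s₁ + q₁ + a)) (weight-ʳ++ f (vias T)) ⟩
      (f h + r₁) + (s₁ + q₁ + (t + r₂))      ≡⟨ cong (λ a → (f h + r₁) + (a + (t + r₂))) (sym (Close-weight f y)) ⟩
      (f h + r₁) + (s + q + (t + r₂))        ≡⟨ solve 6 (λ h s q a t b → (h :+ a) :+ (s :+ q :+ (t :+ b)) :=
        (h :+ (s :+ a)) :+ (t :+ q :+ b)) refl (f h) s q r₁ t r₂ ⟩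
      (f h + (s + r₁)) + (t + q + r₂)        ∎
    where
    open ≡-Reasoning
    s = weight f (verts S)
    s₁ = weight f (verts S₁)
    s′ = weight f (verts S′)
    q = weight f (vertsOf Q)
    q₁ = weight f (vertsOf Q₁)
    q′ = weight f (vertsOf Q′)
    r₁ = weight f R₁
    r₂ = weight f R₂
    r₂′ = weight f R₂′
    t = weight f (vias T)
    u = weight f us

-- Counting pieces

module _ {V : Set} where

  pieces-++ : ∀ (S : List (Item V)) {S′} → pieces (S ++ S′) ≡ pieces S + pieces S′
  pieces-++ []            = refl
  pieces-++ (new w ∷ S)   = cong suc (pieces-++ S)
  pieces-++ (adj w ∷ S)   = pieces-++ S
  pieces-++ (via u w ∷ S) = cong suc (pieces-++ S)

  breaks-++ : ∀ (S : List (Item V)) {S′} → breaks (S ++ S′) ≡ breaks S + breaks S′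
  breaks-++ []            = refl
  breaks-++ (new w ∷ S)   = cong suc (breaks-++ S)
  breaks-++ (adj w ∷ S)   = breaks-++ S
  breaks-++ (via u w ∷ S) = breaks-++ S

  breaks≤pieces : ∀ (S : List (Item V)) → breaks S ≤ pieces S
  breaks≤pieces []            = z≤n
  breaks≤pieces (new w ∷ S)   = s≤s (breaks≤pieces S)
  breaks≤pieces (adj w ∷ S)   = breaks≤pieces S
  breaks≤pieces (via u w ∷ S) = m≤n⇒m≤1+n (breaks≤pieces S)

  pieces-links : ∀ ys {S : List (Item V)} → pieces (map adj ys ++ S) ≡ pieces S
  pieces-links []       = refl
  pieces-links (y ∷ ys) = pieces-links ys

  breaks-links : ∀ ys {S : List (Item V)} → breaks (map adj ys ++ S) ≡ breaks S
  breaks-links []       = refl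
  breaks-links (y ∷ ys) = breaks-links ys

  pieces-segments : ∀ (Q : List (Segment V)) → pieces (segments Q) ≡ length Q
  pieces-segments []             = refl
  pieces-segments ((y , ys) ∷ Q) = cong suc (trans (pieces-links ys) (pieces-segments Q))

  pieces-attached : ∀ (Q : List (Segment V)) → pieces (attached Q) ≡ pred (length Q)
  pieces-attached []             = refl
  pieces-attached ((y , ys) ∷ Q) = trans (pieces-links ys) (pieces-segments Q)

  Split-zero : ∀ {S : List (Item V)} {p Q} → Split 0 S p Q → length Q ≡ pieces S
  Split-zero []      = refl
  Split-zero (new x) = cong suc (Split-zero x)
  Split-zero (via x) = cong suc (Split-zero x)
  Split-zero (adj x) = Split-zero x

  Split-bound : ∀ {k} {S : List (Item V)} {p Q} → Split k S p Q → length Q ≤ pieces S + k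
  Split-bound []      = z≤n
  Split-bound (new x) = s≤s (Split-bound x)
  Split-bound (via x) = s≤s (Split-bound x)
  Split-bound {S = adj w ∷ S} (cut {k} x) = ≤-trans (s≤s (Split-bound x)) (≤-reflexive (sym (+-suc (pieces S) k)))
  Split-bound (adj x) = Split-bound x

  -- A link is kept only when no cuts are left to make. So either all `k` cuts are made, or every
  -- link is cut and each item is a segment of its own.
  Split-exact : ∀ {k} {S : List (Item V)} {p Q} → Split k S p Q → length Q ≡ pieces S + k ⊎ length Q ≡ length S
  Split-exact []      = inj₂ refl
  Split-exact (new x) with Split-exact x
  ... | inj₁ eq = inj₁ (cong suc eq)
  ... | inj₂ eq = inj₂ (cong suc eq)
  Split-exact (via x) with Split-exact x
  ... | inj₁ eq = inj₁ (cong suc eq)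
  ... | inj₂ eq = inj₂ (cong suc eq)
  Split-exact {S = adj w ∷ S} (cut {k} x) with Split-exact x
  ... | inj₁ eq = inj₁ (trans (cong suc eq) (sym (+-suc (pieces S) k)))
  ... | inj₂ eq = inj₂ (cong suc eq)
  Split-exact {S = adj w ∷ S} (adj x) = inj₁ (trans (Split-zero x) (sym (+-identityʳ (pieces S))))

  -- Each inserted segment merges two paths. Counting the segments before and after on opposite
  -- sides avoids subtraction.
  Close-pieces : ∀ {S S′ : List (Item V)} {Q Q′} → Close S Q S′ Q′ → pieces S + length Q′ ≡ pieces S′ + length Q
  Close-pieces []       = refl
  Close-pieces (keep x) = cong suc (Close-pieces x)
  Close-pieces (new {S′ = S′} {w = w} {ys = ys} x) rewrite pieces-links ys {adj w ∷ S′} =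
    trans (cong suc (Close-pieces x)) (sym (+-suc _ _))
  Close-pieces (adj x)  = Close-pieces x
  Close-pieces (via x)  = cong suc (Close-pieces x)

  Close-breaks : ∀ {S S′ : List (Item V)} {Q Q′} → Close S Q S′ Q′ → breaks S + length Q′ ≡ breaks S′ + length Q
  Close-breaks []       = refl
  Close-breaks (keep x) = cong suc (Close-breaks x)
  Close-breaks (new {S′ = S′} {w = w} {ys = ys} x) rewrite breaks-links ys {adj w ∷ S′} =
    trans (cong suc (Close-breaks x)) (sym (+-suc _ _))
  Close-breaks (adj x)  = Close-breaks x
  Close-breaks (via x)  = Close-breaks x

  Close-exhaust : ∀ {S S′ : List (Item V)} {Q Q′} → Close S Q S′ Q′ → Q′ ≡ [] ⊎ breaks S′ ≡ 0
  Close-exhaust []       = inj₂ refl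
  Close-exhaust (keep x) with Close-exhaust x | Close-breaks x
  ... | inj₁ eq | _ = inj₁ eq
  Close-exhaust {Q′ = []}     (keep x) | inj₂ eq | _ = inj₁ refl
  -- `keep` starts with no segments, so a nonempty remainder would contradict `Close-breaks`.
  Close-exhaust {S} {S′} {Q′ = q ∷ Q′} (keep {S₀} x) | inj₂ eq | eq′
    with () ← trans (sym (+-suc (breaks S₀) (length Q′))) (trans eq′ (trans (+-identityʳ _) eq))
  Close-exhaust (new {S′ = S′} {w = w} {ys = ys} x) with Close-exhaust x
  ... | inj₁ eq = inj₁ eq
  ... | inj₂ eq = inj₂ (trans (breaks-links ys {adj w ∷ S′}) eq)
  Close-exhaust (adj x)  = Close-exhaust x
  Close-exhaust (via x)  = Close-exhaust x

  Bridge-pieces : ∀ {S S′ : List (Item V)} {Q R Q′ R′ us} → Bridge S Q R S′ Q′ R′ us →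
                  pieces S + length Q′ ≡ pieces S′ + length Q
  Bridge-pieces []        = refl
  Bridge-pieces (keepᵛ x) = cong suc (Bridge-pieces x)
  Bridge-pieces (keepⁿ x) = cong suc (Bridge-pieces x)
  Bridge-pieces (new x)   = cong suc (Bridge-pieces x)
  Bridge-pieces (adj x)   = Bridge-pieces x
  Bridge-pieces (via {S′ = S′} {w = w} {ys = ys} x) rewrite pieces-links ys {adj w ∷ S′} =
    trans (cong suc (Bridge-pieces x)) (sym (+-suc _ _))

  Bridge-breaks : ∀ {S S′ : List (Item V)} {Q R Q′ R′ us} → Bridge S Q R S′ Q′ R′ us →
                  breaks S + length R′ ≡ breaks S′ + length R
  Bridge-breaks []        = refl
  Bridge-breaks (keepᵛ x) = Bridge-breaks x
  Bridge-breaks (keepⁿ x) = cong suc (Bridge-breaks x)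
  Bridge-breaks (new {S = S} x) = trans (cong suc (Bridge-breaks x)) (sym (+-suc _ _))
  Bridge-breaks (adj x)   = Bridge-breaks x
  Bridge-breaks (via {S′ = S′} {w = w} {ys = ys} x) rewrite breaks-links ys {adj w ∷ S′} = Bridge-breaks x

  Bridge-breaks-≤ : ∀ {S S′ : List (Item V)} {Q R Q′ R′ us} → Bridge S Q R S′ Q′ R′ us → breaks S′ ≤ breaks S
  Bridge-breaks-≤ []        = z≤n
  Bridge-breaks-≤ (keepᵛ x) = Bridge-breaks-≤ x
  Bridge-breaks-≤ (keepⁿ x) = s≤s (Bridge-breaks-≤ x)
  Bridge-breaks-≤ (new x)   = m≤n⇒m≤1+n (Bridge-breaks-≤ x)
  Bridge-breaks-≤ (adj x)   = Bridge-breaks-≤ x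
  Bridge-breaks-≤ (via {S′ = S′} {w = w} {ys = ys} x) rewrite breaks-links ys {adj w ∷ S′} = Bridge-breaks-≤ x

  Bridge-spare : ∀ {S S′ : List (Item V)} {Q R Q′ R′ us} → Bridge S Q R S′ Q′ R′ us → R′ ≡ [] ⊎ breaks S′ ≡ 0
  Bridge-spare []        = inj₂ refl
  Bridge-spare (keepᵛ x) = Bridge-spare x
  Bridge-spare (keepⁿ {R′ = []} x)    = inj₁ refl
  Bridge-spare (keepⁿ {S} {R′ = r ∷ R′} x) with Bridge-spare x | Bridge-breaks x
  ... | inj₂ eq | eq′ with () ← trans (sym (+-suc (breaks S) (length R′))) (trans eq′ (trans (+-identityʳ _) eq))
  Bridge-spare (new x)   = Bridge-spare x
  Bridge-spare (adj x)   = Bridge-spare x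
  Bridge-spare (via {S′ = S′} {w = w} {ys = ys} x) rewrite breaks-links ys {adj w ∷ S′} = Bridge-spare x

  Bridge-empty : ∀ {S S′ : List (Item V)} {R Q′ R′ us} → Bridge S [] R S′ Q′ R′ us → Q′ ≡ []
  Bridge-empty []        = refl
  Bridge-empty (keepᵛ x) = Bridge-empty x
  Bridge-empty (keepⁿ x) = Bridge-empty x
  Bridge-empty (new x)   = Bridge-empty x
  Bridge-empty (adj x)   = Bridge-empty x

  Bridge-exhaust : ∀ {S S′ : List (Item V)} {Q R Q′ R′ us} → Bridge S Q R S′ Q′ R′ us →
                   breaks S ≡ 0 → Q′ ≡ [] ⊎ pieces S′ ≡ 0
  Bridge-exhaust []        none = inj₂ refl
  Bridge-exhaust (keepᵛ x) none = inj₁ (Bridge-empty x)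
  Bridge-exhaust (adj x)   none = Bridge-exhaust x none
  Bridge-exhaust (via {S′ = S′} {w = w} {ys = ys} x) none rewrite pieces-links ys {adj w ∷ S′} = Bridge-exhaust x none

  length-weight : ∀ (xs : List V) → length xs ≡ weight (λ _ → 1) xs
  length-weight []       = refl
  length-weight (x ∷ xs) = cong suc (length-weight xs)

  length-verts : ∀ (S : List (Item V)) → length (verts S) ≡ length S + length (vias S)
  length-verts []            = refl
  length-verts (new w ∷ S)   = cong suc (length-verts S)
  length-verts (adj w ∷ S)   = cong suc (length-verts S)
  length-verts (via u w ∷ S) = cong suc (trans (cong suc (length-verts S)) (sym (+-suc (length S) _)))

  -- All segments have found a gap, so there are at most `pieces S` of them, one fewer than
  -- `pieces T + k`. The cuts were therefore not all made, and `Split-exact` says that `T` fell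
  -- apart into single terminals.
  exhausted : ∀ {k} {h : V} {S S₁ S′} {T : List (Item V)} {Q Q₁ R R′ us} → pieces (new h ∷ S) ≡ pieces T + k → Split k T [] Q →
              Close S Q S₁ Q₁ → Bridge S₁ Q₁ R S′ [] R′ us → length Q ≡ length T × pieces S′ + length Q ≡ pieces S
  exhausted {k} {h} {S} {S₁} {S′} {T} {Q} {Q₁} eq x y z = exact (Split-exact x) , total
    where
    total : pieces S′ + length Q ≡ pieces S
    total = +-cancelʳ-≡ (length Q₁) _ _ (trans (solve 3 (λ a b c → a :+ b :+ c := (a :+ c) :+ b) refl (pieces S′)
      (length Q) (length Q₁))
      (trans (cong (_+ length Q) (trans (sym (Bridge-pieces z)) (+-identityʳ _))) (sym (Close-pieces y))))
    exact : length Q ≡ pieces T + k ⊎ length Q ≡ length T → length Q ≡ length T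
    exact (inj₂ eq′) = eq′
    exact (inj₁ eq′) = ⊥-elim (1+n≰n (≤-trans (≤-reflexive (sym (trans eq′ (sym eq))))
      (≤-trans (m≤n+m (length Q) (pieces S′)) (≤-reflexive total))))

  -- A segment can remain only when every gap is filled. There are `pieces S` gaps after `h` and at
  -- most one more segment than that, so exactly one remains, and attaching it completes a single
  -- path.
  leftover : ∀ {k} {h : V} {S S₁ S′} {T : List (Item V)} {Q Q₁ R q Q′ R′ us} → pieces (new h ∷ S) ≡ pieces T + k → Split
    k T [] Q →
             Close S Q S₁ Q₁ → Bridge S₁ Q₁ R S′ (q ∷ Q′) R′ us → pieces (S′ ++ attached (q ∷ Q′)) ≡ 0
  leftover {Q₁ = []} eq x y z with () ← Bridge-empty z
  leftover {k} {h} {S} {S₁} {S′} {Q = Q} {q₁ ∷ Q₁} {q = q} {Q′} eq x y z with Close-exhaust y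
  ... | inj₂ none with Bridge-exhaust z none
  ... | inj₂ none′ = n≤0⇒n≡0 (≤-trans (≤-reflexive (trans (pieces-++ S′) (cong₂ _+_ none′ (pieces-attached (q ∷ Q′))))) few)
    where
    total : pieces S + suc (length Q′) ≡ length Q
    total = +-cancelʳ-≡ (suc (length Q₁)) _ _ (trans (solve 3 (λ a b c → a :+ b :+ c := (a :+ c) :+ b) refl (pieces S)
      (suc (length Q′)) (suc (length Q₁)))
      (trans (cong (_+ suc (length Q′)) (Close-pieces y))
        (trans (solve 3 (λ a b c → a :+ b :+ c := (a :+ c) :+ b) refl (pieces S₁) (length Q) (suc (length Q′)))
        (trans (cong (_+ length Q) (trans (Bridge-pieces z) (cong (_+ suc (length Q₁)) none′)))
          (+-comm (suc (length Q₁)) (length Q))))))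
    few : length Q′ ≤ 0
    few = +-cancelˡ-≤ (pieces S) (length Q′) 0 (s≤s⁻¹ (≤-trans (≤-reflexive (sym (+-suc _ _)))
            (≤-trans (≤-reflexive total) (≤-trans (Split-bound x)
              (≤-trans (≤-reflexive (sym eq)) (s≤s (≤-reflexive (sym (+-identityʳ _)))))))))

  -- Either a single path results, or each terminal of the other side was a segment by itself and
  -- merged two paths.
  Join-pieces : ∀ {S R T U S′ R′} → Join {V} S R T U S′ R′ → pieces S′ ≤ 1 ⊎ pieces S′ + length T ≡ pieces S
  Join-pieces empty = inj₁ z≤n
  Join-pieces (join {h = h} {Q′ = q ∷ Q′} eq x y z) = inj₁ (s≤s (≤-reflexive (leftover {h = h} eq x y z)))
  Join-pieces (join {h = h} {S′ = S′} {Q′ = []} eq x y z) rewrite ++-identityʳ S′ with exhausted {h = h} eq x y z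
  ... | eq₁ , eq₂ = inj₂ (cong suc (trans (cong (pieces S′ +_) (sym eq₁)) eq₂))

  -- The analogue for all vertices: if a proper break survives, every segment went into a proper
  -- break and every nonterminal of the other side, former vias included, bridged one, so each
  -- vertex there removed one break.
  Join-breaks : ∀ {S R T U S′ R′} → Join {V} S R T U S′ R′ →
                breaks S′ ≤ 1 ⊎ breaks S′ + length (verts T ++ U) ≡ breaks S
  Join-breaks empty = inj₁ z≤n
  Join-breaks (join {h = h} {S′ = S′} {Q′ = q ∷ Q′} eq x y z) =
    inj₁ (s≤s (≤-trans (breaks≤pieces (S′ ++ attached (q ∷ Q′))) (≤-reflexive (leftover {h = h} eq x y z))))
  Join-breaks (join {k} {h} {S} {S₁} {S′} {T = T} {U} {U′} {Q} {Q₁} {[]} eq x y z) rewrite ++-identityʳ S′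
    with Bridge-spare z | Close-exhaust y
  ... | inj₂ none | _         = inj₁ (s≤s (≤-reflexive none))
  ... | inj₁ refl | inj₂ none = inj₁ (s≤s (≤-trans (Bridge-breaks-≤ z) (≤-reflexive none)))
  ... | inj₁ refl | inj₁ refl = inj₂ (cong suc (begin
    breaks S′ + length (verts T ++ U)                    ≡⟨ cong (breaks S′ +_)
      (trans (length-++ (verts T)) (cong (_+ length U) (length-verts T))) ⟩
    breaks S′ + (length T + length (vias T) + length U)  ≡⟨ solve 4
      (λ a b c d → a :+ (b :+ c :+ d) := a :+ (c :+ d) :+ b) refl (breaks S′) (length T) (length (vias T)) (length U) ⟩
    breaks S′ + (length (vias T) + length U) + length T  ≡⟨ cong (λ n → breaks S′ + n + length T) (sym (length-ʳ++ (vias T))) ⟩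
    breaks S′ + length (vias T ʳ++ U) + length T         ≡⟨ cong (_+ length T) (sym (Bridge-breaks z)) ⟩
    breaks S₁ + 0 + length T                             ≡⟨ cong₂ _+_ (+-identityʳ (breaks S₁))
      (sym (proj₁ (exhausted {h = h} eq x y z))) ⟩
    breaks S₁ + length Q                                 ≡⟨ sym (Close-breaks y) ⟩
    breaks S + 0                                         ≡⟨ +-identityʳ _ ⟩
    breaks S                                             ∎))
    where open ≡-Reasoning

-- Runs of a path inside a set of vertices

ind : Bool → ℕ
ind true  = 1
ind false = 0

starts : Bool → Bool → ℕ
starts p     false = 0
starts true  true  = 0
starts false true  = 1

starts-trans : ∀ p r → starts p true ≤ starts r true + starts p r
starts-trans false false = ≤-refl
starts-trans false true  = ≤-refl
starts-trans true  r     = z≤n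

module _ {V : Set} where

  -- The Boolean tells whether the vertex before `Q` belongs to the set; a whole path starts with
  -- `false`.
  runs : (V → Bool) → Bool → List V → ℕ
  runs f p []      = 0
  runs f p (v ∷ Q) = starts p (f v) + runs f (f v) Q

  count : (V → Bool) → List V → ℕ
  count f = weight (λ v → ind (f v))

  -- A run of `f` begins either where a run of `h` begins or right after a vertex of `g`, and the
  -- latter is charged to that vertex. The term `starts p r` is the charge for a vertex of `g` just
  -- before `Q`.
  runs-join : ∀ {f g h : V → Bool} → (∀ v → h v ≡ f v ∨ g v) → ∀ Q p r →
              runs f p Q ≤ runs h r Q + count g Q + starts p r
  runs-join eq [] p r = z≤n
  runs-join {f} {g} {h} eq (v ∷ Q) p r with runs-join {f} {g} {h} eq Q (f v) (h v)
  ... | ih rewrite eq v with f v | g v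
  ... | false | false = ≤-trans ih (≤-trans (≤-reflexive (+-identityʳ _)) (m≤m+n _ (starts p r)))
  ... | false | true  = ≤-trans ih (≤-trans
    (≤-reflexive (solve 2 (λ b c → b :+ c :+ con 1 := b :+ (con 1 :+ c)) refl (runs h true Q) (count g Q)))
    (≤-trans (+-monoˡ-≤ (suc (count g Q)) (m≤n+m (runs h true Q) (starts r true))) (m≤m+n _ (starts p r))))
  ... | true  | x     = ≤-trans (+-mono-≤ (starts-trans p r) ih) (≤-trans
    (≤-reflexive (solve 4 (λ s t b c → (s :+ t) :+ (b :+ c :+ con 0) := (s :+ b) :+ c :+ t) refl (starts r true)
      (starts p r) (runs h true Q) (count g Q)))
    (+-monoˡ-≤ (starts p r) (+-monoʳ-≤ (starts r true + runs h true Q) (m≤n+m (count g Q) (ind x)))))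

  -- Without edges between the two sets a path cannot step directly from one to the other, so
  -- whenever a run of `f` or of `g` begins a run of `h` begins as well. `local` checks this at a
  -- single edge.
  runs-union : ∀ {f g h : V → Bool} {E : V → V → Set} → (∀ v → h v ≡ f v ∨ g v) → (∀ v → f v ∧ g v ≡ false) →
               (∀ u v → f u ≡ true → g v ≡ true → ¬ E u v × ¬ E v u) → ∀ v Q → Linked E (v ∷ Q) →
               runs f (f v) Q + runs g (g v) Q ≤ runs h (h v) Q
  runs-union eq dis cross v [] _ = z≤n
  runs-union {f} {g} {h} {E} eq dis cross v (w ∷ Q) (e ∷ l) =
    ≤-trans (≤-reflexive (solve 4 (λ a b c d → (a :+ b) :+ (c :+ d) := (a :+ c) :+ (b :+ d)) refl
              (starts (f v) (f w)) (runs f (f w) Q) (starts (g v) (g w)) (runs g (g w) Q)))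
      (+-mono-≤ (local (eq v) (eq w) (dis v) (dis w) (cross v w) (cross w v)) (runs-union {f} {g} {h} eq dis cross w Q l))
    where
    local : ∀ {a b c x y z} → c ≡ a ∨ b → z ≡ x ∨ y → a ∧ b ≡ false → x ∧ y ≡ false →
           (a ≡ true → y ≡ true → ¬ E v w × ¬ E w v) → (x ≡ true → b ≡ true → ¬ E w v × ¬ E v w) →
           starts a x + starts b y ≤ starts c z
    local {true}  {true}                   _    _    () _  _ _
    local {x = true} {true}                _    _    _  () _ _
    local {true}  {false} {x = false} {true}  refl refl _ _ p _ = ⊥-elim (proj₁ (p refl refl) e)
    local {false} {true}  {x = true}  {false} refl refl _ _ _ q = ⊥-elim (proj₂ (q refl refl) e)
    local {true}  {false} {x = true}  {false} refl refl _ _ _ _ = z≤n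
    local {true}  {false} {x = false} {false} refl refl _ _ _ _ = z≤n
    local {false} {true}  {x = false} {true}  refl refl _ _ _ _ = z≤n
    local {false} {true}  {x = false} {false} refl refl _ _ _ _ = z≤n
    local {false} {false} {x = true}  {false} refl refl _ _ _ _ = ≤-refl
    local {false} {false} {x = false} {true}  refl refl _ _ _ _ = ≤-refl
    local {false} {false} {x = false} {false} refl refl _ _ _ _ = z≤n

  runs-union₀ : ∀ {f g h : V → Bool} {E : V → V → Set} → (∀ v → h v ≡ f v ∨ g v) → (∀ v → f v ∧ g v ≡ false) →
                (∀ u v → f u ≡ true → g v ≡ true → ¬ E u v × ¬ E v u) → ∀ Q → Linked E Q →
                runs f false Q + runs g false Q ≤ runs h false Q
  runs-union₀ eq dis cross [] _ = z≤n
  runs-union₀ {f} {g} {h} eq dis cross (v ∷ Q) l =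
    ≤-trans (≤-reflexive (solve 4 (λ a b c d → (a :+ b) :+ (c :+ d) := (a :+ c) :+ (b :+ d)) refl
              (starts false (f v)) (runs f (f v) Q) (starts false (g v)) (runs g (g v) Q)))
      (+-mono-≤ (local {f v} {g v} (eq v) (dis v)) (runs-union {f} {g} {h} eq dis cross v Q l))
    where
    local : ∀ {a b c} → c ≡ a ∨ b → a ∧ b ≡ false → starts false a + starts false b ≤ starts false c
    local {true}  {false} refl _ = ≤-refl
    local {false} {true}  refl _ = ≤-refl
    local {false} {false} refl _ = ≤-refl

  runs-positive : ∀ (f : V → Bool) {v} Q → v ∈ₗ Q → f v ≡ true → ∀ p → 1 ≤ starts false p + runs f p Q
  runs-positive f (v ∷ Q) (here refl) fv true  = s≤s z≤n
  runs-positive f (v ∷ Q) (here refl) fv false rewrite fv = s≤s z≤n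
  runs-positive f (w ∷ Q) (there m)   fv true  = s≤s z≤n
  runs-positive f (w ∷ Q) (there m)   fv false with runs-positive f Q m fv (f w)
  ... | p = p

  weight-mono : ∀ {f g : V → ℕ} → (∀ v → f v ≤ g v) → ∀ Q → weight f Q ≤ weight g Q
  weight-mono le []      = z≤n
  weight-mono le (v ∷ Q) = +-mono-≤ (le v) (weight-mono le Q)

  weight-sum : ∀ (f g : V → ℕ) Q → weight f Q + weight g Q ≡ weight (λ v → f v + g v) Q
  weight-sum f g []      = refl
  weight-sum f g (v ∷ Q) = trans (solve 4 (λ a b c d → (a :+ b) :+ (c :+ d) := (a :+ c) :+ (b :+ d)) refl (f v)
    (weight f Q) (g v) (weight g Q))
    (cong (f v + g v +_) (weight-sum f g Q))

  -- Each counted vertex of `Q` is struck out of `L`; as `Q` has no repetitions, the vertices still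
  -- to come are found among the rest.
  count-unique : ∀ (f : V → Bool) {Q} L → Unique Q → (∀ {v} → v ∈ₗ Q → f v ≡ true → v ∈ₗ L) → count f Q ≤ length L
  count-unique f L [] sub = z≤n
  count-unique f {v ∷ Q} L (v∉ ∷ u) sub with f v in fv
  ... | false = count-unique f L u (sub ∘ there)
  ... | true with ∈-∃++ (sub (here refl) fv)
  ... | xs , ys , refl = ≤-trans (s≤s (count-unique f (xs ++ ys) u sub′))
          (≤-reflexive (trans (cong suc (length-++ xs)) (trans (sym (+-suc (length xs) (length ys))) (sym (length-++ xs)))))
    where
    sub′ : ∀ {w} → w ∈ₗ Q → f w ≡ true → w ∈ₗ xs ++ ys
    sub′ {w} w∈ fw with ∈-++⁻ xs (sub (there w∈) fw)
    ... | inj₁ m           = ∈-++⁺ˡ m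
    ... | inj₂ (here refl) = ⊥-elim (All.lookup v∉ w∈ refl)
    ... | inj₂ (there m)   = ∈-++⁺ʳ xs m

-- Optimal covers

module Cover {V : Set} (_≟_ : DecidableEquality V) (E : V → V → Set) (X : V → Bool) where

  open DecMembership _≟_ using (_∈?_)

  -- The index v is the terminal that precedes S in the cover.
  data Val : V → List (Item V) → Set where
    []  : ∀ {v} → Val v []
    new : ∀ {v w S} → X w ≡ true → Val w S → Val v (new w ∷ S)
    adj : ∀ {v w S} → X w ≡ true → E v w → Val w S → Val v (adj w ∷ S)
    via : ∀ {v u w S} → X u ≡ false → X w ≡ true → E v u → E u w → Val w S → Val v (via u w ∷ S)

  data Valid : List (Item V) → Set where
    []  : Valid []
    new : ∀ {w S} → X w ≡ true → Val w S → Valid (new w ∷ S)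

  Val-++ : ∀ {v S T} → Val v S → Valid T → Val v (S ++ T)
  Val-++ [] []                = []
  Val-++ [] (new x y)         = new x y
  Val-++ (new x s) t          = new x (Val-++ s t)
  Val-++ (adj x e s) t        = adj x e (Val-++ s t)
  Val-++ (via x x′ e e′ s) t  = via x x′ e e′ (Val-++ s t)

  Valid-++ : ∀ {S T} → Valid S → Valid T → Valid (S ++ T)
  Valid-++ [] t        = t
  Valid-++ (new x s) t = new x (Val-++ s t)

  Val-vias : ∀ {v S} → Val v S → All (λ u → X u ≡ false) (vias S)
  Val-vias []                 = []
  Val-vias (new x s)          = Val-vias s
  Val-vias (adj x e s)        = Val-vias s
  Val-vias (via x x′ e e′ s)  = x ∷ Val-vias s

  Valid-vias : ∀ {S} → Valid S → All (λ u → X u ≡ false) (vias S)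
  Valid-vias []        = []
  Valid-vias (new x s) = Val-vias s

  -- Inserting the paths of one side of a join into those of the other

  module Sides (A B : V → Set) (cross : ∀ {a b} → A a → B b → E a b × E b a) where

    Good : V → Set
    Good v = B v × X v ≡ true

    Spare : V → Set
    Spare v = B v × X v ≡ false

    GoodSegment : Segment V → Set
    GoodSegment (y , ys) = Linked E (y ∷ ys) × All Good (y ∷ ys)

    -- As Val, but the breaks and the vias lie between vertices of A.
    data Mid : V → List (Item V) → Set where
      []  : ∀ {v} → A v → Mid v []
      new : ∀ {v w S} → A v → A w → X w ≡ true → Mid w S → Mid v (new w ∷ S)
      adj : ∀ {v w S} → X w ≡ true → E v w → Mid w S → Mid v (adj w ∷ S)
      via : ∀ {v u w S} → A v → A w → X u ≡ false → X w ≡ true → E v u → E u w → Mid w S → Mid v (via u w ∷ S)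

    Split-good : ∀ {v k S p Q} → Val v S → All B (verts S) → Split k S p Q →
                 Linked E (v ∷ p) × All Good p × All GoodSegment Q
    Split-good [] [] [] = [-] , [] , []
    Split-good (new x s) (b ∷ bs) (new y) =
      let l , g , q = Split-good s bs y in [-] , [] , (l , (b , x) ∷ g) ∷ q
    Split-good (via _ x _ _ s) (_ ∷ b ∷ bs) (via y) =
      let l , g , q = Split-good s bs y in [-] , [] , (l , (b , x) ∷ g) ∷ q
    Split-good (adj x _ s) (b ∷ bs) (cut y) =
      let l , g , q = Split-good s bs y in [-] , [] , (l , (b , x) ∷ g) ∷ q
    Split-good (adj x e s) (b ∷ bs) (adj y) =
      let l , g , q = Split-good s bs y in e ∷ l , (b , x) ∷ g , q

    Split-good₀ : ∀ {k S Q} → Valid S → All B (verts S) → Split k S [] Q → All GoodSegment Q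
    Split-good₀ [] [] [] = []
    Split-good₀ (new x s) (b ∷ bs) (new y) =
      let l , g , q = Split-good s bs y in (l , (b , x) ∷ g) ∷ q

    links-mid : ∀ {y ys w S} → Linked E (y ∷ ys) → All Good (y ∷ ys) → A w → X w ≡ true → Mid w S →
                Mid y (map adj ys ++ adj w ∷ S)
    links-mid [-] ((b , _) ∷ []) a x m = adj x (proj₂ (cross a b)) m
    links-mid (e ∷ l) (_ ∷ (b , x′) ∷ g) a x m = adj x′ e (links-mid l ((b , x′) ∷ g) a x m)

    links-val : ∀ {y ys w S} → Linked E (y ∷ ys) → All Good (y ∷ ys) → A w → X w ≡ true → Val w S →
                Val y (map adj ys ++ adj w ∷ S)
    links-val [-] ((b , _) ∷ []) a x m = adj x (proj₂ (cross a b)) m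
    links-val (e ∷ l) (_ ∷ (b , x′) ∷ g) a x m = adj x′ e (links-val l ((b , x′) ∷ g) a x m)

    segments-val : ∀ {y ys Q} → Linked E (y ∷ ys) → All Good (y ∷ ys) → All GoodSegment Q → Val y (map adj ys ++ segments Q)
    segments-val (e ∷ l) (_ ∷ (b , x) ∷ g) q = adj x e (segments-val l ((b , x) ∷ g) q)
    segments-val [-] _ [] = []
    segments-val [-] _ ((l , (b , x) ∷ g) ∷ q) = new x (segments-val l ((b , x) ∷ g) q)

    -- An inserted segment removes the gap into which it goes, so the gaps that survive still have
    -- vertices of `A` at both ends. This lets `Bridge` put vertices of `B` there.
    Close-mid : ∀ {v S Q S′ Q′} → A v → Val v S → All A (verts S) → All GoodSegment Q → Close S Q S′ Q′ →
                Mid v S′ × All GoodSegment Q′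
    Close-mid a [] [] q [] = [] a , q
    Close-mid a (new x s) (a′ ∷ as) q (keep c) =
      let m , q′ = Close-mid a′ s as q c in new a a′ x m , q′
    Close-mid a (new x s) (a′ ∷ as) ((l , (b , x′) ∷ g) ∷ q) (new c) =
      let m , q′ = Close-mid a′ s as q c
      in adj x′ (proj₁ (cross a b)) (links-mid l ((b , x′) ∷ g) a′ x m) , q′
    Close-mid a (adj x e s) (a′ ∷ as) q (adj c) =
      let m , q′ = Close-mid a′ s as q c in adj x e m , q′
    Close-mid a (via x x′ e e′ s) (_ ∷ a′ ∷ as) q (via c) =
      let m , q′ = Close-mid a′ s as q c in via a a′ x x′ e e′ m , q′

    Bridge-val : ∀ {v S Q R S′ Q′ R′ us} → Mid v S → All GoodSegment Q → All Spare R →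
                 Bridge S Q R S′ Q′ R′ us → Val v (S′ ++ attached Q′)
    Bridge-val ([] a) [] r [] = []
    Bridge-val ([] a) ((l , (b , x) ∷ g) ∷ q) r [] = adj x (proj₁ (cross a b)) (segments-val l ((b , x) ∷ g) q)
    Bridge-val (via a a′ x x′ e e′ m) q r (keepᵛ c) = via x x′ e e′ (Bridge-val m q r c)
    Bridge-val {Q′ = Q′} (via a a′ x x′ e e′ m) ((l , (b , y) ∷ g) ∷ q) r (via {S′ = S′} {w = w} {ys = ys} c)
      rewrite ++-assoc (map adj ys) (adj w ∷ S′) (attached Q′) =
      adj y (proj₁ (cross a b)) (links-val l ((b , y) ∷ g) a′ x′ (Bridge-val m q r c))
    Bridge-val (new a a′ x m) q r (keepⁿ c) = new x (Bridge-val m q r c)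
    Bridge-val (new a a′ x m) q ((b , y) ∷ r) (new c) =
      via y x (proj₁ (cross a b)) (proj₂ (cross a′ b)) (Bridge-val m q r c)
    Bridge-val (adj x e m) q r (adj c) = adj x e (Bridge-val m q r c)

    Bridge-rest : ∀ {v S Q R S′ Q′ R′ us} → Mid v S → All Spare R → Bridge S Q R S′ Q′ R′ us →
                  All (λ u → X u ≡ false) R′ × All (λ u → X u ≡ false) us
    Bridge-rest ([] _) r [] = All.map proj₂ r , []
    Bridge-rest (via _ _ _ _ _ _ m) r (keepᵛ c) = Bridge-rest m r c
    Bridge-rest {Q = _ ∷ Q} (via {S = S} _ _ x _ _ _ m) r (via c) = let r′ , u = Bridge-rest m r c in r′ , x ∷ u
    Bridge-rest (new _ _ _ m) r (keepⁿ c) = Bridge-rest m r c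
    Bridge-rest (new _ _ _ m) (_ ∷ r) (new c) = Bridge-rest m r c
    Bridge-rest (adj _ _ m) r (adj c) = Bridge-rest m r c

    Join-valid : ∀ {S R T U S′ R′} → Valid S → Valid T → All A (verts S) → All B (verts T ++ U) →
                 All (λ u → X u ≡ false) R → All (λ u → X u ≡ false) U → Join S R T U S′ R′ →
                 Valid S′ × All (λ u → X u ≡ false) R′
    Join-valid _ _ _ _ r u empty = [] , All.++⁺ r u
    Join-valid {T = T} {U} (new x s) t (a ∷ as) bs r u (join _ c d e) =
      let m , q  = Close-mid a s as (Split-good₀ t (All.++⁻ˡ (verts T) bs) c) d
          spare  = All-ʳ++ (All.zip (vias-B T (All.++⁻ˡ (verts T) bs) , Valid-vias t)) (All.zip (All.++⁻ʳ (verts T) bs , u))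
          r′ , v = Bridge-rest m spare e
      in new x (Bridge-val m q spare e) , All.++⁺ (All-ʳ++ v r) r′
      where
      vias-B : ∀ T → All B (verts T) → All B (vias T)
      vias-B []            bs           = []
      vias-B (new w ∷ T)   (_ ∷ bs)     = vias-B T bs
      vias-B (adj w ∷ T)   (_ ∷ bs)     = vias-B T bs
      vias-B (via u w ∷ T) (b ∷ _ ∷ bs) = b ∷ vias-B T bs

  -- Membership, length and repetitions by weights

  single-weight : V → V → ℕ
  single-weight v w = ind (does (v ≟ w))

  ∈⇒weight : ∀ {v xs} → v ∈ₗ xs → 1 ≤ weight (single-weight v) xs
  ∈⇒weight {v} (here refl) with v ≟ v
  ... | yes _ = s≤s z≤n
  ... | no ¬p = ⊥-elim (¬p refl)
  ∈⇒weight (there m) = ≤-trans (∈⇒weight m) (m≤n+m _ _)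

  weight⇒∈ : ∀ {v} xs → 1 ≤ weight (single-weight v) xs → v ∈ₗ xs
  weight⇒∈ {v} (x ∷ xs) p with v ≟ x
  ... | yes refl = here refl
  ... | no _     = there (weight⇒∈ xs p)

  ≋⇒∈ : ∀ {v xs ys} → xs ≋ ys → v ∈ₗ xs → v ∈ₗ ys
  ≋⇒∈ {v} {ys = ys} eq m = weight⇒∈ ys (≤-trans (∈⇒weight m) (≤-reflexive (eq (single-weight v))))

  ≋⇒length : ∀ {xs ys : List V} → xs ≋ ys → length xs ≡ length ys
  ≋⇒length {xs} {ys} eq = trans (length-weight xs) (trans (eq (λ _ → 1)) (sym (length-weight ys)))

  Unique⇒weight : ∀ {xs} v → Unique xs → weight (single-weight v) xs ≤ 1
  Unique⇒weight v [] = z≤n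
  Unique⇒weight {x ∷ xs} v (x∉ ∷ u) with v ≟ x
  ... | no _     = Unique⇒weight v u
  ... | yes refl with weight (single-weight v) xs in eq
  ... | zero  = ≤-refl
  ... | suc n = ⊥-elim (All.lookup x∉ (weight⇒∈ xs (subst (1 ≤_) (sym eq) (s≤s z≤n))) refl)

  weight⇒Unique : ∀ {xs} → (∀ v → weight (single-weight v) xs ≤ 1) → Unique xs
  weight⇒Unique {[]}     p = []
  weight⇒Unique {x ∷ xs} p = All.tabulate fresh ∷ weight⇒Unique (λ v → ≤-trans (m≤n+m _ _) (p v))
    where
    fresh : ∀ {y} → y ∈ₗ xs → x ≢ y
    fresh m refl with x ≟ x | p x
    ... | yes _ | q = 1+n≰n (≤-trans (s≤s (∈⇒weight m)) q)
    ... | no ¬p | q = ¬p refl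

  Decides : (V → Bool) → List V → Set
  Decides f L = ∀ v → (f v ≡ true → v ∈ₗ L) × (v ∈ₗ L → f v ≡ true)

  member : List V → V → Bool
  member L v = does (v ∈? L)

  member-decides : ∀ L → Decides (member L) L
  member-decides L v with v ∈? L
  ... | yes p = (λ _ → p) , (λ _ → refl)
  ... | no ¬p = (λ ()) , (λ p → ⊥-elim (¬p p))

  decides-∨ : ∀ {f g h A B} → Decides f A → Decides g B → Decides h (A ++ B) → ∀ v → h v ≡ f v ∨ g v
  decides-∨ {f} {g} {h} {A} F G H v with f v in fv | g v in gv | h v in hv
  ... | true  | _     | true  = refl
  ... | false | true  | true  = refl
  ... | false | false | false = refl
  ... | true  | _     | false with () ← trans (sym hv) (proj₂ (H v) (∈-++⁺ˡ (proj₁ (F v) fv)))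
  ... | false | true  | false with () ← trans (sym hv) (proj₂ (H v) (∈-++⁺ʳ A (proj₁ (G v) gv)))
  ... | false | false | true with ∈-++⁻ A (proj₁ (H v) hv)
  ... | inj₁ m with () ← trans (sym fv) (proj₂ (F v) m)
  ... | inj₂ m with () ← trans (sym gv) (proj₂ (G v) m)

  record TerminalPath (Q : List V) : Set where
    field
      linked : Linked E Q
      unique : Unique Q
      covers : ∀ {v} → X v ≡ true → v ∈ₗ Q

  open TerminalPath

  outside : (V → Bool) → V → Bool
  outside f v = f v ∧ not (X v)

  -- S covers the terminals among L, and R consists of the nonterminals of L that S does not use.
  record Summary (L : List V) (S : List (Item V)) (R : List V) : Set where
    field
      same  : verts S ++ R ≋ L
      valid : Valid S
      spare : All (λ u → X u ≡ false) R
      -- Both counts include the leading `new`. Admitting every `f` that decides `L` allows the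
      -- constant `true` at the root.
      lower : ∀ {Q f} → TerminalPath Q → Decides f L →
              pieces S ≤ runs f false Q + count (outside f) Q × breaks S ≤ runs f false Q

  open Summary

  Summary-swap : ∀ {L L′ S R} → Summary (L ++ L′) S R → Summary (L′ ++ L) S R
  Summary-swap {L} {L′} s .same f = trans (s .same f)
    (trans (weight-++ f L) (trans (+-comm (weight f L) _) (sym (weight-++ f L′))))
  Summary-swap s .valid = s .valid
  Summary-swap s .spare = s .spare
  Summary-swap {L} {L′} s .lower Q F = s .lower Q (λ v → (λ e → turn L′ (proj₁ (F v) e)) , (λ m → proj₂ (F v) (turn L m)))
    where
    turn : ∀ {v} A {B} → v ∈ₗ A ++ B → v ∈ₗ B ++ A
    turn A {B} m with ∈-++⁻ A m
    ... | inj₁ a = ∈-++⁺ʳ B a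
    ... | inj₂ b = ∈-++⁺ˡ b

  Summary-terminal : ∀ {v} → X v ≡ true → Summary (v ∷ []) (new v ∷ []) []
  Summary-terminal x .same f  = refl
  Summary-terminal x .valid   = new x []
  Summary-terminal x .spare   = []
  Summary-terminal {v} x .lower {Q} {f} P F = ≤-trans once (m≤m+n _ _) , once
    where once = runs-positive f Q (P .covers x) (proj₂ (F v) (here refl)) false

  Summary-spare : ∀ {v} → X v ≡ false → Summary (v ∷ []) [] (v ∷ [])
  Summary-spare x .same f    = refl
  Summary-spare x .valid     = []
  Summary-spare x .spare     = x ∷ []
  Summary-spare x .lower P F = z≤n , z≤n

  -- Summaries at the inner nodes of the parse tree

  module Node {A B : List V} {S R T U} (s : Summary A S R) (t : Summary B T U)
              (disjoint : ∀ {v} → v ∈ₗ A → v ∈ₗ B → ⊥) where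

    apart : ∀ v → member A v ∧ member B v ≡ false
    apart v with v ∈? A | v ∈? B
    ... | yes a | yes b = ⊥-elim (disjoint a b)
    ... | yes a | no _  = refl
    ... | no _  | _     = refl

    count-outside : ∀ {h} → (∀ v → h v ≡ member A v ∨ member B v) → ∀ Q →
                    count (outside (member A)) Q + count (outside (member B)) Q ≤ count (outside h) Q
    count-outside {h} eq Q = ≤-trans (≤-reflexive (weight-sum _ _ Q)) (weight-mono at-vertex Q)
      where
      at-vertex : ∀ v → ind (outside (member A) v) + ind (outside (member B) v) ≤ ind (outside h v)
      at-vertex v rewrite eq v with member A v | member B v | apart v | X v
      ... | true  | false | _ | true  = z≤n
      ... | true  | false | _ | false = ≤-refl
      ... | false | b     | _ | x     = ≤-refl

    union-summary : (∀ {a b} → a ∈ₗ A → b ∈ₗ B → ¬ E a b × ¬ E b a) → Summary (A ++ B) (S ++ T) (R ++ U)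
    union-summary none .same f rewrite weight-++ f (verts (S ++ T)) {R ++ U} | weight-items f S {T} | weight-++ f R {U}
      | weight-++ f A {B} =
      trans (solve 4 (λ a b c d → (a :+ b) :+ (c :+ d) := (a :+ c) :+ (b :+ d)) refl (weight f (verts S))
        (weight f (verts T)) (weight f R) (weight f U))
        (cong₂ _+_ (trans (sym (weight-++ f (verts S))) (s .same f)) (trans (sym (weight-++ f (verts T))) (t .same f)))
    union-summary none .valid = Valid-++ (s .valid) (t .valid)
    union-summary none .spare = All.++⁺ (s .spare) (t .spare)
    union-summary none .lower {Q} {h} P H =
      (begin
        pieces (S ++ T)      ≡⟨ pieces-++ S ⟩
        pieces S + pieces T  ≤⟨ +-mono-≤ (proj₁ (s .lower P (member-decides A))) (proj₁ (t .lower P (member-decides B))) ⟩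
        (a + a′) + (b + b′)  ≡⟨ solve 4 (λ a b c d → (a :+ b) :+ (c :+ d) := (a :+ c) :+ (b :+ d)) refl a a′ b b′ ⟩
        (a + b) + (a′ + b′)  ≤⟨ +-mono-≤ total (count-outside eq Q) ⟩
        runs h false Q + count (outside h) Q ∎) ,
      (begin
        breaks (S ++ T)      ≡⟨ breaks-++ S ⟩
        breaks S + breaks T  ≤⟨ +-mono-≤ (proj₂ (s .lower P (member-decides A))) (proj₂ (t .lower P (member-decides B))) ⟩
        a + b                ≤⟨ total ⟩
        runs h false Q       ∎)
      where
      open ≤-Reasoning
      a  = runs (member A) false Q
      b  = runs (member B) false Q
      a′ = count (outside (member A)) Q
      b′ = count (outside (member B)) Q
      eq : ∀ v → h v ≡ member A v ∨ member B v
      eq = decides-∨ (member-decides A) (member-decides B) H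
      total : a + b ≤ runs h false Q
      total = runs-union₀ {f = member A} {member B} {h} eq apart
        (λ u v u∈ v∈ → none (proj₁ (member-decides A u) u∈) (proj₁ (member-decides B v) v∈)) Q (P .linked)

    -- Each item has exactly one terminal, so `length T` is the number of terminals covered by `T`.
    ends : List (Item V) → List V
    ends []            = []
    ends (new w ∷ S)   = w ∷ ends S
    ends (adj w ∷ S)   = w ∷ ends S
    ends (via u w ∷ S) = w ∷ ends S

    length-ends : ∀ S → length (ends S) ≡ length S
    length-ends []            = refl
    length-ends (new w ∷ S)   = cong suc (length-ends S)
    length-ends (adj w ∷ S)   = cong suc (length-ends S)
    length-ends (via u w ∷ S) = cong suc (length-ends S)

    ∈-ends : ∀ {v} S → All (λ u → X u ≡ false) (vias S) → X v ≡ true → v ∈ₗ verts S → v ∈ₗ ends S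
    ∈-ends (new w ∷ S)   us       x (here p)          = here p
    ∈-ends (new w ∷ S)   us       x (there m)         = there (∈-ends S us x m)
    ∈-ends (adj w ∷ S)   us       x (here p)          = here p
    ∈-ends (adj w ∷ S)   us       x (there m)         = there (∈-ends S us x m)
    ∈-ends (via u w ∷ S) (y ∷ us) x (here refl)       with () ← trans (sym x) y
    ∈-ends (via u w ∷ S) (y ∷ us) x (there (here p))  = here p
    ∈-ends (via u w ∷ S) (y ∷ us) x (there (there m)) = there (∈-ends S us x m)

    terminals-B : ∀ {v} → v ∈ₗ B → X v ≡ true → v ∈ₗ ends T
    terminals-B {v} v∈ x with ∈-++⁻ (verts T) (≋⇒∈ (λ f → sym (t .same f)) v∈)
    ... | inj₁ m = ∈-ends T (Valid-vias (t .valid)) x m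
    ... | inj₂ m with () ← trans (sym x) (All.lookup (t .spare) m)

    module _ {Q h} (P : TerminalPath Q) (H : Decides h (A ++ B)) where

      eq : ∀ v → h v ≡ member A v ∨ member B v
      eq = decides-∨ (member-decides A) (member-decides B) H

      runs-A : runs (member A) false Q ≤ runs h false Q + count (member B) Q
      runs-A = ≤-trans (runs-join {f = member A} {member B} {h} eq Q false false) (≤-reflexive (+-identityʳ _))

      count-B : count (member B) Q ≤ length (verts T ++ U)
      count-B = ≤-trans (count-unique (member B) B (P .unique) (λ {v} _ → proj₁ (member-decides B v)))
        (≤-reflexive (sym (≋⇒length {verts T ++ U} {B} (t .same))))

      -- Vertices of `B` on `Q` are split into nonterminals and terminals; the latter all occur in
      -- `ends T`, and `Q` meets each at most once.
      count-terminals : count (member B) Q ≤ count (outside (member B)) Q + length T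
      count-terminals = ≤-trans (weight-mono at-vertex Q) (≤-trans (≤-reflexive (sym (weight-sum _ _ Q)))
        (+-monoʳ-≤ (count (outside (member B)) Q) (≤-trans (count-unique inside (ends T) (P .unique) sub)
          (≤-reflexive (length-ends T)))))
        where
        inside : V → Bool
        inside v = member B v ∧ X v
        at-vertex : ∀ v → ind (member B v) ≤ ind (outside (member B) v) + ind (inside v)
        at-vertex v with member B v | X v
        ... | true  | true  = ≤-refl
        ... | true  | false = ≤-refl
        ... | false | _     = z≤n
        sub : ∀ {v} → v ∈ₗ Q → inside v ≡ true → v ∈ₗ ends T
        sub {v} _ p with member B v in m | X v in x
        ... | true | true = terminals-B (proj₁ (member-decides B v) m) x

    join-summary : ∀ {S′ R′} → (∀ {a b} → a ∈ₗ A → b ∈ₗ B → E a b × E b a) → Join S R T U S′ R′ → Summary (A ++ B) S′ R′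
    join-summary {S′} {R′} cross j = record
      { same  = conserved
      ; valid = proj₁ both
      ; spare = proj₂ both
      ; lower = λ P H → bound₁ P H (Join-pieces j) , bound₂ P H (Join-breaks j) }
      where
      open ≤-Reasoning
      conserved : verts S′ ++ R′ ≋ A ++ B
      conserved f = trans (Join-weight j f) (trans (cong₂ _+_ (s .same f) (t .same f)) (sym (weight-++ f A)))
      both = Sides.Join-valid (_∈ₗ A) (_∈ₗ B) cross (s .valid) (t .valid)
               (All.++⁻ˡ (verts S) (All.tabulate (λ m → ≋⇒∈ (s .same) m))) (All.tabulate (λ m → ≋⇒∈ (t .same) m))
                 (s .spare) (t .spare) j
      -- A nonempty cover begins with a terminal; every terminal path contains it, so the set
      -- decided by `h` is met by at least one run.
      some : ∀ {Q h} S″ → Valid S″ → (∀ {v} → v ∈ₗ verts S″ → v ∈ₗ A ++ B) → TerminalPath Q → Decides h (A ++ B) →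
             ∀ {k} → k ≤ pieces S″ → k ≤ 1 → k ≤ runs h false Q
      some [] [] _ P H z≤n _ = z≤n
      some {Q} {h} (new w ∷ S″) (new x _) sub P H _ k≤1 =
        ≤-trans k≤1 (runs-positive h Q (P .covers x) (proj₂ (H w) (sub (here refl))) false)
      inside : ∀ {v} → v ∈ₗ verts S′ → v ∈ₗ A ++ B
      inside m = ≋⇒∈ conserved (∈-++⁺ˡ m)
      bound₁ : ∀ {Q h} → TerminalPath Q → Decides h (A ++ B) → pieces S′ ≤ 1 ⊎ pieces S′ + length T ≡ pieces S →
               pieces S′ ≤ runs h false Q + count (outside h) Q
      bound₁ P H (inj₁ few) = ≤-trans (some S′ (proj₁ both) inside P H ≤-refl few) (m≤m+n _ _)
      -- The terminals of the other side lowered `pieces` by `length T`, and they can give `Q` at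
      -- most `length T` additional runs in `A`: this amount cancels. The nonterminals of both sides
      -- remain as the nonterminals of `Q` inside the join.
      bound₁ {Q} {h} P H (inj₂ same) = +-cancelʳ-≤ (length T) _ _ (begin
        pieces S′ + length T                                        ≡⟨ same ⟩
        pieces S                                                    ≤⟨ proj₁ (s .lower P (member-decides A)) ⟩
        runs (member A) false Q + count (outside (member A)) Q      ≤⟨ +-monoˡ-≤ _
          (≤-trans (runs-A P H) (+-monoʳ-≤ (runs h false Q) (count-terminals P H))) ⟩
        (r + (b + length T)) + a                                    ≡⟨ solve 4
          (λ r b t a → (r :+ (b :+ t)) :+ a := (r :+ (a :+ b)) :+ t) refl r b (length T) a ⟩
        (r + (a + b)) + length T                                    ≤⟨ +-monoˡ-≤ (length T)
          (+-monoʳ-≤ r (count-outside (eq P H) Q)) ⟩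
        runs h false Q + count (outside h) Q + length T             ∎)
        where
        r = runs h false Q
        a = count (outside (member A)) Q
        b = count (outside (member B)) Q
      bound₂ : ∀ {Q h} → TerminalPath Q → Decides h (A ++ B) → breaks S′ ≤ 1 ⊎ breaks S′ + length (verts T ++ U) ≡ breaks S →
               breaks S′ ≤ runs h false Q
      bound₂ P H (inj₁ few) = some S′ (proj₁ both) inside P H (breaks≤pieces S′) few
      -- Here every vertex of the other side, terminal or not, removed a break, and the number of
      -- all of them cancels.
      bound₂ {Q} {h} P H (inj₂ same) = +-cancelʳ-≤ (length (verts T ++ U)) _ _ (begin
        breaks S′ + length (verts T ++ U)          ≡⟨ same ⟩
        breaks S                                   ≤⟨ proj₂ (s .lower P (member-decides A)) ⟩
        runs (member A) false Q                    ≤⟨ runs-A P H ⟩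
        runs h false Q + count (member B) Q        ≤⟨ +-monoʳ-≤ (runs h false Q) (count-B P H) ⟩
        runs h false Q + length (verts T ++ U)     ∎)

-- Tokens on stacks

-- A vertex is stored in unary behind a flag that says how it is linked to its predecessor in a cover;
-- a `bridge` is the nonterminal of a `via` and `bridged` is the terminal after it.
data Flag : Set where
  linked broken bridged bridge : Flag

-- Together with `marked` a prefix code, so at most three pops identify the flag.
flagged : Flag → List Bool → List Bool
flagged linked  r = false ∷ false ∷ r
flagged broken  r = false ∷ true ∷ r
flagged bridged r = true ∷ false ∷ r
flagged bridge  r = true ∷ true ∷ false ∷ r

-- The remaining code word; it delimits the entries of `MS` and `MR`.
marked : List Bool → List Bool
marked r = true ∷ true ∷ true ∷ r

unary : ℕ → List Bool → List Bool
unary zero    r = false ∷ r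
unary (suc k) r = true ∷ unary k r

trues : ℕ → List Bool
trues k = replicate k true

module _ {K : ℕ} where

  popFlag : Fin K → (empty mark : Prog K) → (Flag → Prog K) → Prog K
  popFlag i e m k = pop i e (pop i e (k linked) (k broken)) (pop i e (k bridged) (pop i e (k bridge) m))

  pushFlag : Fin K → Flag → Prog K
  pushFlag i linked  = push i false ⟫ push i false
  pushFlag i broken  = push i true ⟫ push i false
  pushFlag i bridged = push i false ⟫ push i true
  pushFlag i bridge  = push i false ⟫ push i true ⟫ push i true

  pushMark : Fin K → Prog K
  pushMark i = push i true ⟫ push i true ⟫ push i true

  -- The terminator is pushed first so that it ends up below the copied units. The `false` that ends
  -- the loop is the terminator of the source.
  moveUnary : Fin K → Fin K → Prog K
  moveUnary i j = push j false ⟫ loop (pop i (ret false) (ret false) (push j true))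

  move : Fin K → Fin K → Flag → Prog K
  move i j f = moveUnary i j ⟫ pushFlag j f

  -- Reverses the order of the tokens while each token stays readable from its flag on. It ends at
  -- the bottom of the source or at a mark, which it removes.
  pour : Fin K → Fin K → Prog K
  pour i j = loop (popFlag i (ret false) (ret false) (move i j))

  swap : (i j a b : Fin K) → Prog K
  swap i j a b = pour i a ⟫ pour j b ⟫ pour a j ⟫ pour b i

  module _ {i j : Fin K} (i≢j : i ≢ j) where

    -- A normal form for states that differ from `s` in two stacks: `set₁` and `set₂` bring further
    -- updates back into it.
    with₂ : Stacks K → List Bool → List Bool → Stacks K
    with₂ s x y = (s [ i ]≔ x) [ j ]≔ y

    look₁ : ∀ (s : Stacks K) x y → Vec.lookup (with₂ s x y) i ≡ x
    look₁ s x y = trans (lookup∘update′ i≢j (s [ i ]≔ x) y) (lookup∘update i s x)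

    look₂ : ∀ (s : Stacks K) x y → Vec.lookup (with₂ s x y) j ≡ y
    look₂ s x y = lookup∘update j (s [ i ]≔ x) y

    set₁ : ∀ (s : Stacks K) x y x′ → with₂ s x y [ i ]≔ x′ ≡ with₂ s x′ y
    set₁ s x y x′ = trans ([]≔-commutes (s [ i ]≔ x) j i (i≢j ∘ sym)) (cong (_[ j ]≔ y) ([]≔-idempotent s i))

    set₂ : ∀ (s : Stacks K) x y y′ → with₂ s x y [ j ]≔ y′ ≡ with₂ s x y′
    set₂ s x y y′ = []≔-idempotent (s [ i ]≔ x) j

    with₂-self : ∀ (s : Stacks K) {x y} → Vec.lookup s i ≡ x → s [ j ]≔ y ≡ with₂ s x y
    with₂-self s {y = y} refl = cong (_[ j ]≔ y) (sym ([]≔-lookup s i))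

  module _ {N : ℕ} where

    popFlag-∅ : ∀ {i e m k s b s′} → Vec.lookup s i ≡ [] → Run N e s b s′ → Run N (popFlag i e m k) s b s′
    popFlag-∅ = pop∅

    popFlag-flag : ∀ f (k : Flag → Prog K) {i e m s r b s′} → Vec.lookup s i ≡ flagged f r → Run N (k f) (s [ i ]≔ r) b s′ →
                   Run N (popFlag i e m k) s b s′
    popFlag-flag linked k {i} {s = s} {r} eq x = pop₀ eq (pop₀ (lookup∘update i s _)
      (subst (λ u → Run N (k linked) u _ _) (sym ([]≔-idempotent s i)) x))
    popFlag-flag broken k {i} {s = s} {r} eq x = pop₀ eq (pop₁ (lookup∘update i s _)
      (subst (λ u → Run N (k broken) u _ _) (sym ([]≔-idempotent s i)) x))
    popFlag-flag bridged k {i} {s = s} {r} eq x = pop₁ eq (pop₀ (lookup∘update i s _)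
      (subst (λ u → Run N (k bridged) u _ _) (sym ([]≔-idempotent s i)) x))
    popFlag-flag bridge k {i} {s = s} {r} eq x = pop₁ eq (pop₁ (lookup∘update i s _) (pop₀ (lookup∘update i (s [ i ]≔ _) _)
      (subst (λ u → Run N (k bridge) u _ _) (sym (trans ([]≔-idempotent (s [ i ]≔ _) i) ([]≔-idempotent s i))) x)))

    popFlag-mark : ∀ {i e m k s r b s′} → Vec.lookup s i ≡ marked r → Run N m (s [ i ]≔ r) b s′ →
                   Run N (popFlag i e m k) s b s′
    popFlag-mark {i} {m = m} {k} {s} {r} eq x = pop₁ eq (pop₁ (lookup∘update i s _) (pop₁ (lookup∘update i (s [ i ]≔ _) _)
      (subst (λ u → Run N m u _ _) (sym (trans ([]≔-idempotent (s [ i ]≔ _) i) ([]≔-idempotent s i))) x)))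

    push-run : ∀ {i a} (s : Stacks K) {y} → Vec.lookup s i ≡ y → Run N (push i a) s true (s [ i ]≔ (a ∷ y))
    push-run s refl = push

    push-again : ∀ {i a} (s : Stacks K) {y} → Run N (push i a) (s [ i ]≔ y) true (s [ i ]≔ (a ∷ y))
    push-again {i} {a} s {y} = subst (λ u → Run N (push i a) (s [ i ]≔ y) true u)
      ([]≔-idempotent s i) (push-run (s [ i ]≔ y) (lookup∘update i s y))

    pushFlag-run : ∀ f {i} (s : Stacks K) {y} → Vec.lookup s i ≡ y → Run N (pushFlag i f) s true (s [ i ]≔ flagged f y)
    pushFlag-run linked  s eq = push-run s eq ⟫ push-again s
    pushFlag-run broken  s eq = push-run s eq ⟫ push-again s
    pushFlag-run bridged s eq = push-run s eq ⟫ push-again s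
    pushFlag-run bridge  s eq = push-run s eq ⟫ push-again s ⟫ push-again s

    module _ {i j : Fin K} (i≢j : i ≢ j) where

      moves : ∀ (s : Stacks K) v k {x y} →
              Iter N (pop i (ret false) (ret false) (push j true)) v
                (with₂ i≢j s (unary v x) (unary k y)) (with₂ i≢j s (false ∷ x) (unary (v + k) y))
      moves s zero    k = []
      moves s (suc v) k {x} {y} = pop₁ (look₁ i≢j s _ _) one ∷
        subst (λ n → Iter N (pop i (ret false) (ret false) (push j true)) v (with₂ i≢j s (unary v x) (unary (suc k) y))
                       (with₂ i≢j s (false ∷ x) (unary n y))) (+-suc v k) (moves s v (suc k))
        where
        one : Run N (push j true) (with₂ i≢j s (unary (suc v) x) (unary k y) [ i ]≔ unary v x) true
                (with₂ i≢j s (unary v x) (unary (suc k) y))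
        one rewrite set₁ i≢j s (unary (suc v) x) (unary k y) (unary v x) =
          subst (λ u → Run N (push j true) (with₂ i≢j s (unary v x) (unary k y)) true u) (set₂ i≢j s _ _ _)
            (push-run (with₂ i≢j s (unary v x) (unary k y)) (look₂ i≢j s _ _))

      moveUnary-run : ∀ (s : Stacks K) {v x y} → v ≤ N → Vec.lookup s i ≡ unary v x → Vec.lookup s j ≡ y →
                      Run N (moveUnary i j) s false (with₂ i≢j s x (unary v y))
      moveUnary-run s {v} {x} {y} v≤N eq eq′ = push-run s eq′ ⟫
        subst₂ (λ a n → Run N (loop (pop i (ret false) (ret false) (push j true))) a false (with₂ i≢j s x (unary n y)))
          (sym (with₂-self i≢j s eq)) (+-identityʳ v)
          (loop (moves s v 0) v≤N (pop₀ (look₁ i≢j s _ _) (subst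
            (λ u → Run N (ret false) u false (with₂ i≢j s x (unary (v + 0) y))) (sym (set₁ i≢j s _ _ x)) ret)))

      move-run : ∀ f (s : Stacks K) {v x y} → v ≤ N → Vec.lookup s i ≡ unary v x → Vec.lookup s j ≡ y →
                 Run N (move i j f) s true (with₂ i≢j s x (flagged f (unary v y)))
      move-run f s {v} {x} {y} v≤N eq eq′ = moveUnary-run s v≤N eq eq′ ⟫
        subst (λ u → Run N (pushFlag j f) (with₂ i≢j s x (unary v y)) true u) (set₂ i≢j s _ _ _)
          (pushFlag-run f (with₂ i≢j s x (unary v y)) (look₂ i≢j s _ _))

module Tokens {V : Set} (val : V → ℕ) {N : ℕ} (val≤ : ∀ v → val v ≤ N) where

  Token : Set
  Token = Flag × V

  enc : List Token → List Bool → List Bool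
  enc []             r = r
  enc ((f , v) ∷ ts) r = flagged f (unary (val v) (enc ts r))

  toks : List (Item V) → List Token
  toks []            = []
  toks (new w ∷ S)   = (broken , w) ∷ toks S
  toks (adj w ∷ S)   = (linked , w) ∷ toks S
  toks (via u w ∷ S) = (bridge , u) ∷ (bridged , w) ∷ toks S

  loose : List V → List Token
  loose = map (bridge ,_)

  toks-++ : ∀ S {T} → toks (S ++ T) ≡ toks S ++ toks T
  toks-++ []            = refl
  toks-++ (new w ∷ S)   = cong (_ ∷_) (toks-++ S)
  toks-++ (adj w ∷ S)   = cong (_ ∷_) (toks-++ S)
  toks-++ (via u w ∷ S) = cong (λ z → (bridge , u) ∷ (bridged , w) ∷ z) (toks-++ S)

  length-toks : ∀ S → length (toks S) ≡ length (verts S)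
  length-toks []            = refl
  length-toks (new w ∷ S)   = cong suc (length-toks S)
  length-toks (adj w ∷ S)   = cong suc (length-toks S)
  length-toks (via u w ∷ S) = cong (λ n → suc (suc n)) (length-toks S)

  module _ {K : ℕ} {i j : Fin K} (i≢j : i ≢ j) where

    move-step : ∀ f g (s : Stacks K) v {x y m} → Vec.lookup s i ≡ flagged f (unary (val v) x) → Vec.lookup s j ≡ y →
                (k : Flag → Prog K) → k f ≡ move i j g →
                Run N (popFlag i (ret false) m k) s true (with₂ i≢j s x (flagged g (unary (val v) y)))
    move-step f g s v {x} {y} eq eq′ k kf = popFlag-flag f k eq
      (subst₂ (λ p u → Run N p (s [ i ]≔ unary (val v) x) true u) (sym kf) (cong (_[ j ]≔ _) ([]≔-idempotent s i))
        (move-run i≢j g (s [ i ]≔ unary (val v) x) (val≤ v) (lookup∘update i s _) (trans (lookup∘update′ (i≢j ∘ sym) s _) eq′)))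

    pours : ∀ ts (s : Stacks K) {us r y m} →
            Iter N (popFlag i (ret false) m (move i j)) (length ts)
              (with₂ i≢j s (enc ts r) (enc us y)) (with₂ i≢j s r (enc (ts ʳ++ us) y))
    pours []             s = []
    pours ((f , v) ∷ ts) s {us} {r} {y} {m} =
      subst (λ u → Run N (popFlag i (ret false) m (move i j)) (with₂ i≢j s (enc ((f , v) ∷ ts) r) (enc us y)) true u)
        (trans (cong (_[ j ]≔ _) (set₁ i≢j s _ _ _)) (set₂ i≢j s _ _ _))
        (move-step f f (with₂ i≢j s (enc ((f , v) ∷ ts) r) (enc us y)) v (look₁ i≢j s _ _) (look₂ i≢j s _ _) (move i j) refl)
      ∷ pours ts s

    with₂-id : ∀ (s : Stacks K) {x y} → Vec.lookup s i ≡ x → Vec.lookup s j ≡ y → s ≡ with₂ i≢j s x y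
    with₂-id s refl refl = sym (trans (cong (λ u → u [ j ]≔ Vec.lookup s j) ([]≔-lookup s i)) ([]≔-lookup s j))

    pour-run : ∀ (s : Stacks K) ts us {y} → length ts ≤ N → Vec.lookup s i ≡ enc ts [] → Vec.lookup s j ≡ enc us y →
               Run N (pour i j) s false (with₂ i≢j s [] (enc (ts ʳ++ us) y))
    pour-run s ts us {y} len eq eq′ = subst (λ u → Run N (pour i j) u false (with₂ i≢j s [] (enc (ts ʳ++ us) y)))
      (sym (with₂-id s eq eq′))
      (loop (pours ts s) len (popFlag-∅ {K} {i = i} {m = ret false} {move i j} (look₁ i≢j s [] _) ret))

    unload-run : ∀ (s : Stacks K) ts us {r y} → length ts ≤ N → Vec.lookup s i ≡ enc ts (marked r) → Vec.lookup s j ≡ enc us y →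
                 Run N (pour i j) s false (with₂ i≢j s r (enc (ts ʳ++ us) y))
    unload-run s ts us {r} {y} len eq eq′ = subst (λ u → Run N (pour i j) u false (with₂ i≢j s r (enc (ts ʳ++ us) y)))
      (sym (with₂-id s eq eq′))
      (loop (pours ts s) len (popFlag-mark {K} {i = i} {e = ret false} {k = move i j} (look₁ i≢j s (marked r) _)
        (subst (λ u → Run N (ret false) u false (with₂ i≢j s r (enc (ts ʳ++ us) y))) (sym (set₁ i≢j s (marked r) _ r)) ret)))

-- The program

-- T holds the parse tree in postfix order; MS and MR hold, for the subtrees still to be combined, the reversed covers and the
-- unused nonterminals; S₁ R₁ and S₂ R₂ are the operands of a node, K₁ and K₂ are counters.  The tree is read from O, the
-- terminal set from P; later both are scratch, and O receives the output.
O P T MS MR S₁ S₂ R₁ R₂ K₁ K₂ : Fin 11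
O  = # 0
P  = # 1
T  = # 2
MS = # 3
MR = # 4
S₁ = # 5
S₂ = # 6
R₁ = # 7
R₂ = # 8
K₁ = # 9
K₂ = # 10

st : (o p t ms mr s₁ s₂ r₁ r₂ k₁ k₂ : List Bool) → Stacks 11
st o p t ms mr s₁ s₂ r₁ r₂ k₁ k₂ = o ∷ p ∷ t ∷ ms ∷ mr ∷ s₁ ∷ s₂ ∷ r₁ ∷ r₂ ∷ k₁ ∷ k₂ ∷ []

skip halt : Prog 11
skip = ret true
halt = ret false

tally₁ tally₂ : Flag → Prog 11
tally₁ linked  = skip
tally₁ bridge  = skip
tally₁ broken  = push K₁ true
tally₁ bridged = push K₁ true
tally₂ linked  = skip
tally₂ bridge  = skip
tally₂ broken  = pop K₁ (push K₂ true) skip skip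
tally₂ bridged = pop K₁ (push K₂ true) skip skip

countFlag₁ countFlag₂ : Flag → Prog 11
countFlag₁ f = tally₁ f ⟫ move S₁ O f
countFlag₂ f = tally₂ f ⟫ move S₂ O f

forEach : Fin 11 → (Flag → Prog 11) → Prog 11
forEach i k = loop (popFlag i halt halt k)

-- Leaves the difference of the numbers of pieces on K₁ or K₂.
comparePieces : Prog 11
comparePieces = (forEach S₁ countFlag₁ ⟫ pour O S₁) ⟫ (forEach S₂ countFlag₂ ⟫ pour O S₂)

-- A nonempty `K₂` means that the second cover has more paths; then the operands trade places and
-- the difference moves to `K₁`. The unit consumed by the test is restored by the first push on
-- `K₁`.
exchange : Prog 11
exchange = pop K₂ skip skip
  (push K₁ true ⟫ loop (pop K₂ halt halt (push K₁ true)) ⟫ swap S₁ S₂ O P ⟫ swap R₁ R₂ O P)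

splitFlag : Flag → Prog 11
splitFlag broken  = move S₂ O broken
splitFlag bridged = move S₂ O broken
splitFlag bridge  = move S₂ R₂ bridge
-- `K₁` holds the number of cuts still to be made.
splitFlag linked  = pop K₁ (move S₂ O linked) skip (move S₂ O broken)

-- Cuts for which there was no link are still on `K₁` after the pass; the last loop clears them.
split : Prog 11
split = forEach S₂ splitFlag ⟫ pour O S₂ ⟫ loop (pop K₁ halt skip skip)

segmentFlag : Flag → Prog 11
segmentFlag linked = move S₂ O linked
-- This flag belongs to the next segment and is put back.
segmentFlag broken = pushFlag S₂ broken ⟫ halt
segmentFlag _      = halt

-- Moves the first segment of S₂; its first flag has already been removed.
segment : Prog 11
segment = move S₂ O linked ⟫ forEach S₂ segmentFlag

-- The first vertex is moved past with its `broken` flag unchanged, since no gap precedes it.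
first : Prog 11
first = popFlag S₁ skip skip (move S₁ O)

closeFlag bridgeFlag : Flag → Prog 11
closeFlag broken  = popFlag S₂ (move S₁ O broken) halt (λ _ → segment ⟫ move S₁ O linked)
closeFlag f       = move S₁ O f
-- If a segment is available it takes the place of the connector, which goes to `R₁`; the `bridged`
-- terminal behind it is consumed in the same iteration and becomes `linked`.
bridgeFlag bridge = popFlag S₂ (move S₁ O bridge) halt
  (λ _ → move S₁ R₁ bridge ⟫ segment ⟫ popFlag S₁ halt halt (λ _ → move S₁ O linked))
bridgeFlag broken = popFlag R₂ (move S₁ O broken) halt (λ _ → move R₂ O bridge ⟫ move S₁ O bridged)
bridgeFlag f      = move S₁ O f

closeBreaks bridgeBreaks attach : Prog 11
closeBreaks  = first ⟫ forEach S₁ closeFlag ⟫ pour O S₁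
bridgeBreaks = first ⟫ forEach S₁ bridgeFlag ⟫ pour O S₁
-- Turning the flag of the segment that is left, if any, into `linked` makes it continue the last
-- path of `S₁` once `store` concatenates the two stacks.
attach       = popFlag S₂ skip skip (λ _ → pushFlag S₂ linked)

mergeCovers joinCovers : Prog 11
mergeCovers = split ⟫ closeBreaks ⟫ bridgeBreaks ⟫ attach
joinCovers  = comparePieces ⟫ exchange ⟫ mergeCovers

-- Correctness of the passes that make up a join

module Passes {V : Set} (val : V → ℕ) {N : ℕ} (val≤ : ∀ v → val v ≤ N) where

  open Tokens val val≤

  addHeads : List Token → ℕ → ℕ
  addHeads []                   k = k
  addHeads ((broken  , _) ∷ ts) k = addHeads ts (suc k)
  addHeads ((bridged , _) ∷ ts) k = addHeads ts (suc k)
  addHeads ((linked  , _) ∷ ts) k = addHeads ts k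
  addHeads ((bridge  , _) ∷ ts) k = addHeads ts k

  addHeads-toks : ∀ S k → addHeads (toks S) k ≡ pieces S + k
  addHeads-toks []            k = refl
  addHeads-toks (new w ∷ S)   k = trans (addHeads-toks S (suc k)) (+-suc (pieces S) k)
  addHeads-toks (adj w ∷ S)   k = addHeads-toks S k
  addHeads-toks (via u w ∷ S) k = trans (addHeads-toks S (suc k)) (+-suc (pieces S) k)

  pay : ℕ × ℕ → ℕ × ℕ
  pay (zero  , b) = zero , suc b
  pay (suc a , b) = a , b

  payHeads : List Token → ℕ × ℕ → ℕ × ℕ
  payHeads []                   ab = ab
  payHeads ((broken  , _) ∷ ts) ab = payHeads ts (pay ab)
  payHeads ((bridged , _) ∷ ts) ab = payHeads ts (pay ab)
  payHeads ((linked  , _) ∷ ts) ab = payHeads ts ab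
  payHeads ((bridge  , _) ∷ ts) ab = payHeads ts ab

  -- With this invariant the two counters are the positive and the negative part of the difference.
  OneSided : ℕ × ℕ → Set
  OneSided (a , b) = a ≡ 0 ⊎ b ≡ 0

  pay-oneSided : ∀ {ab} → OneSided ab → OneSided (pay ab)
  pay-oneSided {zero  , b} o = inj₁ refl
  pay-oneSided {suc a , b} (inj₂ refl) = inj₂ refl

  pay-balance : ∀ ab {c} m → proj₁ (pay ab) + proj₂ c ≡ m + proj₂ (pay ab) + proj₁ c →
                proj₁ ab + proj₂ c ≡ suc m + proj₂ ab + proj₁ c
  pay-balance (zero  , b) {c} m eq = trans eq (cong (_+ proj₁ c) (+-suc m b))
  pay-balance (suc a , b) {c} m eq = cong suc eq

  payHeads-toks : ∀ S ab → OneSided ab → OneSided (payHeads (toks S) ab) ×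
                  proj₁ ab + proj₂ (payHeads (toks S) ab) ≡ pieces S + proj₂ ab + proj₁ (payHeads (toks S) ab)
  payHeads-toks []            ab o = o , +-comm (proj₁ ab) (proj₂ ab)
  payHeads-toks (new w ∷ S)   ab o = let o′ , eq = payHeads-toks S (pay ab) (pay-oneSided o) in o′ , pay-balance ab (pieces S) eq
  payHeads-toks (adj w ∷ S)   ab o = payHeads-toks S ab o
  payHeads-toks (via u w ∷ S) ab o = let o′ , eq = payHeads-toks S (pay ab) (pay-oneSided o) in o′ , pay-balance ab (pieces S) eq

  links : List V → List Token
  links = map (linked ,_)

  toks-links : ∀ ys {S us} → toks (map adj ys ++ S) ʳ++ us ≡ toks S ʳ++ (links ys ʳ++ us)
  toks-links []       = refl
  toks-links (y ∷ ys) = toks-links ys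

  reverse² : (ts : List Token) → (ts ʳ++ []) ʳ++ [] ≡ ts
  reverse² = reverse-involutive

  pieces≤verts : ∀ (S : List (Item V)) → pieces S ≤ length (verts S)
  pieces≤verts []            = z≤n
  pieces≤verts (new w ∷ S)   = s≤s (pieces≤verts S)
  pieces≤verts (adj w ∷ S)   = m≤n⇒m≤1+n (pieces≤verts S)
  pieces≤verts (via u w ∷ S) = s≤s (m≤n⇒m≤1+n (pieces≤verts S))

  -- What the passes need to know of a valid cover: if it is not empty, its first item opens a path.
  data Open : List (Item V) → Set where
    []  : Open []
    new : ∀ {w S} → Open (new w ∷ S)

  module _ {t ms mr : List Bool} where

    count₁ : ∀ ts us k {p s₂ r₁ r₂ k₂} → Iter N (popFlag S₁ halt halt countFlag₁) (length ts)
             (st (enc us []) p t ms mr (enc ts []) s₂ r₁ r₂ (trues k) k₂)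
             (st (enc (ts ʳ++ us) []) p t ms mr [] s₂ r₁ r₂ (trues (addHeads ts k)) k₂)
    count₁ [] us k = []
    count₁ ((linked , v) ∷ ts) us k =
      popFlag-flag linked countFlag₁ refl (ret ⟫ move-run (λ ()) linked _ (val≤ v) refl refl) ∷ count₁ ts _ k
    count₁ ((bridge , v) ∷ ts) us k =
      popFlag-flag bridge countFlag₁ refl (ret ⟫ move-run (λ ()) bridge _ (val≤ v) refl refl) ∷ count₁ ts _ k
    count₁ ((broken , v) ∷ ts) us k =
      popFlag-flag broken countFlag₁ refl (push ⟫ move-run (λ ()) broken _ (val≤ v) refl refl) ∷ count₁ ts _ (suc k)
    count₁ ((bridged , v) ∷ ts) us k =
      popFlag-flag bridged countFlag₁ refl (push ⟫ move-run (λ ()) bridged _ (val≤ v) refl refl) ∷ count₁ ts _ (suc k)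

    count₂ : ∀ ts us ab {p s₁ r₁ r₂} → Iter N (popFlag S₂ halt halt countFlag₂) (length ts)
             (st (enc us []) p t ms mr s₁ (enc ts []) r₁ r₂ (trues (proj₁ ab)) (trues (proj₂ ab)))
             (st (enc (ts ʳ++ us) []) p t ms mr s₁ [] r₁ r₂ (trues (proj₁ (payHeads ts ab))) (trues (proj₂ (payHeads ts ab))))
    count₂ [] us ab = []
    count₂ ((linked , v) ∷ ts) us ab =
      popFlag-flag linked countFlag₂ refl (ret ⟫ move-run (λ ()) linked _ (val≤ v) refl refl) ∷ count₂ ts _ ab
    count₂ ((bridge , v) ∷ ts) us ab =
      popFlag-flag bridge countFlag₂ refl (ret ⟫ move-run (λ ()) bridge _ (val≤ v) refl refl) ∷ count₂ ts _ ab
    count₂ ((broken , v) ∷ ts) us (zero , b) =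
      popFlag-flag broken countFlag₂ refl (pop∅ refl push ⟫ move-run (λ ()) broken _ (val≤ v) refl refl) ∷ count₂ ts _
        (zero , suc b)
    count₂ ((broken , v) ∷ ts) us (suc a , b) =
      popFlag-flag broken countFlag₂ refl (pop₁ refl ret ⟫ move-run (λ ()) broken _ (val≤ v) refl refl) ∷ count₂ ts _ (a , b)
    count₂ ((bridged , v) ∷ ts) us (zero , b) =
      popFlag-flag bridged countFlag₂ refl (pop∅ refl push ⟫ move-run (λ ()) bridged _ (val≤ v) refl refl) ∷ count₂ ts _
        (zero , suc b)
    count₂ ((bridged , v) ∷ ts) us (suc a , b) =
      popFlag-flag bridged countFlag₂ refl (pop₁ refl ret ⟫ move-run (λ ()) bridged _ (val≤ v) refl refl) ∷ count₂ ts _ (a , b)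

    restore₁ : ∀ ts {p s₂ r₁ r₂ k₁ k₂} → length ts ≤ N →
               Run N (pour O S₁) (st (enc (ts ʳ++ []) []) p t ms mr [] s₂ r₁ r₂ k₁ k₂) false
                 (st [] p t ms mr (enc ts []) s₂ r₁ r₂ k₁ k₂)
    restore₁ ts {p} {s₂} {r₁} {r₂} {k₁} {k₂} len =
      subst (λ us → Run N (pour O S₁) (st (enc (ts ʳ++ []) []) p t ms mr [] s₂ r₁ r₂ k₁ k₂) false
        (st [] p t ms mr (enc us []) s₂ r₁ r₂ k₁ k₂))
        (reverse² ts) (pour-run (λ ()) _ (ts ʳ++ []) [] (≤-trans (≤-reflexive (length-reverse ts)) len) refl refl)

    restore₂ : ∀ ts {p s₁ r₁ r₂ k₁ k₂} → length ts ≤ N →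
               Run N (pour O S₂) (st (enc (ts ʳ++ []) []) p t ms mr s₁ [] r₁ r₂ k₁ k₂) false
                 (st [] p t ms mr s₁ (enc ts []) r₁ r₂ k₁ k₂)
    restore₂ ts {p} {s₁} {r₁} {r₂} {k₁} {k₂} len =
      subst (λ us → Run N (pour O S₂) (st (enc (ts ʳ++ []) []) p t ms mr s₁ [] r₁ r₂ k₁ k₂) false
        (st [] p t ms mr s₁ (enc us []) r₁ r₂ k₁ k₂))
        (reverse² ts) (pour-run (λ ()) _ (ts ʳ++ []) [] (≤-trans (≤-reflexive (length-reverse ts)) len) refl refl)

    swap-S : ∀ xs ys {r₁ r₂ k₁ k₂} → length xs ≤ N → length ys ≤ N →
             Run N (swap S₁ S₂ O P) (st [] [] t ms mr (enc xs []) (enc ys []) r₁ r₂ k₁ k₂) false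
                                    (st [] [] t ms mr (enc ys []) (enc xs []) r₁ r₂ k₁ k₂)
    swap-S xs ys {r₁} {r₂} {k₁} {k₂} len len′ =
      pour-run (λ ()) _ xs [] len refl refl ⟫ pour-run (λ ()) _ ys [] len′ refl refl ⟫ restore₂ xs len ⟫
      subst (λ us → Run N (pour P S₁) (st [] (enc (ys ʳ++ []) []) t ms mr [] (enc xs []) r₁ r₂ k₁ k₂) false
                                      (st [] [] t ms mr (enc us []) (enc xs []) r₁ r₂ k₁ k₂))
        (reverse² ys) (pour-run (λ ()) _ (ys ʳ++ []) [] (≤-trans (≤-reflexive (length-reverse ys)) len′) refl refl)

    swap-R : ∀ xs ys {s₁ s₂ k₁ k₂} → length xs ≤ N → length ys ≤ N →
             Run N (swap R₁ R₂ O P) (st [] [] t ms mr s₁ s₂ (enc xs []) (enc ys []) k₁ k₂) false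
                                    (st [] [] t ms mr s₁ s₂ (enc ys []) (enc xs []) k₁ k₂)
    swap-R xs ys {s₁} {s₂} {k₁} {k₂} len len′ =
      pour-run (λ ()) _ xs [] len refl refl ⟫ pour-run (λ ()) _ ys [] len′ refl refl ⟫
      subst (λ us → Run N (pour O R₂) (st (enc (xs ʳ++ []) []) (enc (ys ʳ++ []) []) t ms mr s₁ s₂ [] [] k₁ k₂) false
                                      (st [] (enc (ys ʳ++ []) []) t ms mr s₁ s₂ [] (enc us []) k₁ k₂))
        (reverse² xs) (pour-run (λ ()) _ (xs ʳ++ []) [] (≤-trans (≤-reflexive (length-reverse xs)) len) refl refl) ⟫
      subst (λ us → Run N (pour P R₁) (st [] (enc (ys ʳ++ []) []) t ms mr s₁ s₂ [] (enc xs []) k₁ k₂) false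
                                      (st [] [] t ms mr s₁ s₂ (enc us []) (enc xs []) k₁ k₂))
        (reverse² ys) (pour-run (λ ()) _ (ys ʳ++ []) [] (≤-trans (≤-reflexive (length-reverse ys)) len′) refl refl)

    compare-run : ∀ S S′ {r₁ r₂} → length (toks S) ≤ N → length (toks S′) ≤ N → ∃ λ a → ∃ λ b →
                  (a ≡ 0 ⊎ b ≡ 0) × pieces S + b ≡ pieces S′ + a ×
                  Run N comparePieces (st [] [] t ms mr (enc (toks S) []) (enc (toks S′) []) r₁ r₂ [] []) false
                                      (st [] [] t ms mr (enc (toks S) []) (enc (toks S′) []) r₁ r₂ (trues a) (trues b))
    compare-run S S′ len len′ =
      let ab = addHeads (toks S) 0 , 0
          o , eq = payHeads-toks S′ ab (inj₂ refl)
          eq′ = trans (cong (_+ proj₂ (payHeads (toks S′) ab)) (sym (trans (addHeads-toks S 0) (+-identityʳ _))))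
                  (trans eq (cong (_+ proj₁ (payHeads (toks S′) ab)) (+-identityʳ _)))
      in proj₁ (payHeads (toks S′) ab) , proj₂ (payHeads (toks S′) ab) , o , eq′ ,
         (loop (count₁ (toks S) [] 0) len (pop∅ refl ret) ⟫ restore₁ (toks S) len) ⟫
         (loop (count₂ (toks S′) [] ab) len′ (pop∅ refl ret) ⟫ restore₂ (toks S′) len′)

    transfer : ∀ a b {s₁ s₂ r₁ r₂} → Iter N (pop K₂ halt halt (push K₁ true)) b
               (st [] [] t ms mr s₁ s₂ r₁ r₂ (trues a) (trues b)) (st [] [] t ms mr s₁ s₂ r₁ r₂ (trues (b + a)) [])
    transfer a zero    = []
    transfer a (suc b) {s₁} {s₂} {r₁} {r₂} = pop₁ refl push ∷
      subst (λ n → Iter N (pop K₂ halt halt (push K₁ true)) b (st [] [] t ms mr s₁ s₂ r₁ r₂ (trues (suc a)) (trues b))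
                          (st [] [] t ms mr s₁ s₂ r₁ r₂ (trues n) [])) (+-suc b a) (transfer (suc a) b)

    drain : ∀ k {o p s₁ s₂ r₁ r₂ k₂} → Iter N (pop K₁ halt skip skip) k
            (st o p t ms mr s₁ s₂ r₁ r₂ (trues k) k₂) (st o p t ms mr s₁ s₂ r₁ r₂ [] k₂)
    drain zero    = []
    drain (suc k) = pop₁ refl ret ∷ drain k

    -- `Split`, like `Close` and `Bridge` below, is a trace of its loop, so one recursion yields
    -- both the derivation and the run. The witness `k′` is the number of cuts not made.
    splits : ∀ S k us rs {p s₁ r₁ k₂} → ∃ λ q → ∃ λ Q → ∃ λ k′ → k′ ≤ k × Split k S q Q ×
             Iter N (popFlag S₂ halt halt splitFlag) (length (toks S))
               (st (enc us []) p t ms mr s₁ (enc (toks S) []) r₁ (enc (loose rs) []) (trues k) k₂)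
               (st (enc (toks (map adj q ++ segments Q) ʳ++ us) []) p t ms mr s₁ [] r₁ (enc (loose (vias S ʳ++ rs)) [])
                 (trues k′) k₂)
    splits [] k us rs = [] , [] , k , ≤-refl , [] , []
    splits (new w ∷ S) k us rs =
      let q , Q , k′ , le , sp , it = splits S k ((broken , w) ∷ us) rs
      in [] , (w , q) ∷ Q , k′ , le , new sp ,
         popFlag-flag broken splitFlag refl (move-run (λ ()) broken _ (val≤ w) refl refl) ∷ it
    splits (via u w ∷ S) k us rs =
      let q , Q , k′ , le , sp , it = splits S k ((broken , w) ∷ us) (u ∷ rs)
      in [] , (w , q) ∷ Q , k′ , le , via sp ,
         popFlag-flag bridge splitFlag refl (move-run (λ ()) bridge _ (val≤ u) refl refl) ∷
         popFlag-flag bridged splitFlag refl (move-run (λ ()) broken _ (val≤ w) refl refl) ∷ it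
    splits (adj w ∷ S) zero us rs =
      let q , Q , k′ , le , sp , it = splits S zero ((linked , w) ∷ us) rs
      in w ∷ q , Q , k′ , le , adj sp ,
         popFlag-flag linked splitFlag refl (pop∅ refl (move-run (λ ()) linked _ (val≤ w) refl refl)) ∷ it
    splits (adj w ∷ S) (suc k) us rs =
      let q , Q , k′ , le , sp , it = splits S k ((broken , w) ∷ us) rs
      in [] , (w , q) ∷ Q , k′ , m≤n⇒m≤1+n le , cut sp ,
         popFlag-flag linked splitFlag refl (pop₁ refl (move-run (λ ()) broken _ (val≤ w) refl refl)) ∷ it

    takes : ∀ ys us Q {p s₁ r₁ r₂ k₁ k₂} → Iter N (popFlag S₂ halt halt segmentFlag) (length ys)
            (st (enc us []) p t ms mr s₁ (enc (toks (map adj ys ++ segments Q)) []) r₁ r₂ k₁ k₂)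
            (st (enc (links ys ʳ++ us) []) p t ms mr s₁ (enc (toks (segments Q)) []) r₁ r₂ k₁ k₂)
    takes []       us Q = []
    takes (y ∷ ys) us Q =
      popFlag-flag linked segmentFlag refl (move-run (λ ()) linked _ (val≤ y) refl refl) ∷ takes ys _ Q

    segment-run : ∀ y ys us Q {p s₁ r₁ r₂ k₁ k₂} → length ys ≤ N →
                  Run N segment (st (enc us []) p t ms mr s₁ (unary (val y) (enc (toks (map adj ys ++ segments Q)) []))
                    r₁ r₂ k₁ k₂) false
                                (st (enc (links ys ʳ++ ((linked , y) ∷ us)) []) p t ms mr s₁
                                  (enc (toks (segments Q)) []) r₁ r₂ k₁ k₂)
    segment-run y ys us [] len = move-run (λ ()) linked _ (val≤ y) refl refl ⟫
      loop (takes ys ((linked , y) ∷ us) []) len (pop∅ refl ret)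
    segment-run y ys us ((z , zs) ∷ Q) len = move-run (λ ()) linked _ (val≤ y) refl refl ⟫
      loop (takes ys ((linked , y) ∷ us) ((z , zs) ∷ Q)) len
        (popFlag-flag broken segmentFlag refl (pushFlag-run broken _ refl ⟫ ret))

    Short : List (Segment V) → Set
    Short Q = length (vertsOf Q) ≤ N

    short-head : ∀ {y ys Q} → Short ((y , ys) ∷ Q) → length ys ≤ N
    short-head {ys = ys} le = ≤-trans (≤-trans (m≤m+n (length ys) _) (≤-reflexive (sym (length-++ ys)))) (<⇒≤ le)

    short-tail : ∀ {y ys Q} → Short ((y , ys) ∷ Q) → Short Q
    short-tail {ys = ys} {Q} le = ≤-trans (≤-trans (m≤n+m (length (vertsOf Q)) (length ys))
      (≤-reflexive (sym (length-++ ys)))) (<⇒≤ le)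

    recast : ∀ {p : Prog 11} {k s a x s₁ s₂ r₁ r₂ k₁ k₂} {us us′ : List Token} → us ≡ us′ →
             Iter N p k s (st (enc us x) a t ms mr s₁ s₂ r₁ r₂ k₁ k₂) →
             Iter N p k s (st (enc us′ x) a t ms mr s₁ s₂ r₁ r₂ k₁ k₂)
    recast refl it = it

    inserted : ∀ y ys w S {us} → toks S ʳ++ ((linked , w) ∷ (links ys ʳ++ ((linked , y) ∷ us))) ≡
               toks (adj y ∷ map adj ys ++ adj w ∷ S) ʳ++ us
    inserted y ys w S = sym (toks-links ys)

    closes : ∀ S Q us {p r₁ r₂ k₁ k₂} → Short Q → ∃ λ S′ → ∃ λ Q′ → Close S Q S′ Q′ ×
             Iter N (popFlag S₁ halt halt closeFlag) (length (toks S))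
               (st (enc us []) p t ms mr (enc (toks S) []) (enc (toks (segments Q)) []) r₁ r₂ k₁ k₂)
               (st (enc (toks S′ ʳ++ us) []) p t ms mr [] (enc (toks (segments Q′)) []) r₁ r₂ k₁ k₂)
    closes [] Q us _ = [] , Q , [] , []
    closes (new w ∷ S) [] us sh =
      let S′ , Q′ , c , it = closes S [] ((broken , w) ∷ us) sh
      in new w ∷ S′ , Q′ , keep c ,
         popFlag-flag broken closeFlag refl (pop∅ refl (move-run (λ ()) broken _ (val≤ w) refl refl)) ∷ it
    closes (new w ∷ S) ((y , ys) ∷ Q) us sh =
      let S′ , Q′ , c , it = closes S Q ((linked , w) ∷ (links ys ʳ++ ((linked , y) ∷ us))) (short-tail {y} {ys} {Q} sh)
      in adj y ∷ map adj ys ++ adj w ∷ S′ , Q′ , new c ,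
         popFlag-flag broken closeFlag refl
           (popFlag-flag broken (λ _ → segment ⟫ move S₁ O linked) refl
             (segment-run y ys us Q (short-head {y} {ys} {Q} sh) ⟫ move-run (λ ()) linked _ (val≤ w) refl refl)) ∷
         recast (inserted y ys w S′) it
    closes (adj w ∷ S) Q us sh =
      let S′ , Q′ , c , it = closes S Q ((linked , w) ∷ us) sh
      in adj w ∷ S′ , Q′ , adj c ,
         popFlag-flag linked closeFlag refl (move-run (λ ()) linked _ (val≤ w) refl refl) ∷ it
    closes (via u w ∷ S) Q us sh =
      let S′ , Q′ , c , it = closes S Q ((bridged , w) ∷ (bridge , u) ∷ us) sh
      in via u w ∷ S′ , Q′ , via c ,
         popFlag-flag bridge closeFlag refl (move-run (λ ()) bridge _ (val≤ u) refl refl) ∷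
         popFlag-flag bridged closeFlag refl (move-run (λ ()) bridged _ (val≤ w) refl refl) ∷ it

    -- The number `k` of iterations may be smaller than the number of tokens, because replacing a
    -- connector by a segment consumes two tokens at once.
    bridges : ∀ S Q R us rs {p k₁ k₂} → Short Q → ∃ λ S′ → ∃ λ Q′ → ∃ λ R′ → ∃ λ vs → ∃ λ k →
              Bridge S Q R S′ Q′ R′ vs × k ≤ length (toks S) ×
              Iter N (popFlag S₁ halt halt bridgeFlag) k
                (st (enc us []) p t ms mr (enc (toks S) []) (enc (toks (segments Q)) []) (enc (loose rs) [])
                  (enc (loose R) []) k₁ k₂)
                (st (enc (toks S′ ʳ++ us) []) p t ms mr [] (enc (toks (segments Q′)) []) (enc (loose (vs ʳ++ rs)) [])
                  (enc (loose R′) []) k₁ k₂)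
    bridges [] Q R us rs sh = [] , Q , R , [] , 0 , [] , z≤n , []
    bridges (new w ∷ S) Q [] us rs sh =
      let S′ , Q′ , R′ , vs , k , b , le , it = bridges S Q [] ((broken , w) ∷ us) rs sh
      in new w ∷ S′ , Q′ , R′ , vs , suc k , keepⁿ b , s≤s le ,
         popFlag-flag broken bridgeFlag refl (pop∅ refl (move-run (λ ()) broken _ (val≤ w) refl refl)) ∷ it
    bridges (new w ∷ S) Q (u ∷ R) us rs sh =
      let S′ , Q′ , R′ , vs , k , b , le , it = bridges S Q R ((bridged , w) ∷ (bridge , u) ∷ us) rs sh
      in via u w ∷ S′ , Q′ , R′ , vs , suc k , new b , s≤s le ,
         popFlag-flag broken bridgeFlag refl
           (popFlag-flag bridge (λ _ → move R₂ O bridge ⟫ move S₁ O bridged) refl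
             (move-run (λ ()) bridge _ (val≤ u) refl refl ⟫ move-run (λ ()) bridged _ (val≤ w) refl refl)) ∷ it
    bridges (adj w ∷ S) Q R us rs sh =
      let S′ , Q′ , R′ , vs , k , b , le , it = bridges S Q R ((linked , w) ∷ us) rs sh
      in adj w ∷ S′ , Q′ , R′ , vs , suc k , adj b , s≤s le ,
         popFlag-flag linked bridgeFlag refl (move-run (λ ()) linked _ (val≤ w) refl refl) ∷ it
    bridges (via u w ∷ S) [] R us rs sh =
      let S′ , Q′ , R′ , vs , k , b , le , it = bridges S [] R ((bridged , w) ∷ (bridge , u) ∷ us) rs sh
      in via u w ∷ S′ , Q′ , R′ , vs , 2 + k , keepᵛ b , s≤s (s≤s le) ,
         popFlag-flag bridge bridgeFlag refl (pop∅ refl (move-run (λ ()) bridge _ (val≤ u) refl refl)) ∷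
         popFlag-flag bridged bridgeFlag refl (move-run (λ ()) bridged _ (val≤ w) refl refl) ∷ it
    bridges (via u w ∷ S) ((y , ys) ∷ Q) R us rs sh =
      let S′ , Q′ , R′ , vs , k , b , le , it = bridges S Q R ((linked , w) ∷ (links ys ʳ++ ((linked , y) ∷ us))) (u ∷ rs) (short-tail {y} {ys} {Q} sh)
      in adj y ∷ map adj ys ++ adj w ∷ S′ , Q′ , R′ , u ∷ vs , suc k , via b , s≤s (m≤n⇒m≤1+n le) ,
         popFlag-flag bridge bridgeFlag refl
           (popFlag-flag broken (λ _ → move S₁ R₁ bridge ⟫ segment ⟫ popFlag S₁ halt halt (λ _ → move S₁ O linked)) refl
             (move-run (λ ()) bridge _ (val≤ u) refl refl ⟫ segment-run y ys us Q (short-head {y} {ys} {Q} sh) ⟫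
              popFlag-flag bridged (λ _ → move S₁ O linked) refl (move-run (λ ()) linked _ (val≤ w) refl refl))) ∷
         recast (inserted y ys w S′) it

    splits-open : ∀ {S} → Open S → ∀ k us rs {p s₁ r₁ k₂} → ∃ λ Q → ∃ λ k′ → k′ ≤ k × Split k S [] Q ×
             Iter N (popFlag S₂ halt halt splitFlag) (length (toks S))
               (st (enc us []) p t ms mr s₁ (enc (toks S) []) r₁ (enc (loose rs) []) (trues k) k₂)
               (st (enc (toks (segments Q) ʳ++ us) []) p t ms mr s₁ [] r₁ (enc (loose (vias S ʳ++ rs)) []) (trues k′) k₂)
    splits-open []          k us rs = let _ , Q , k′ , x = splits [] k us rs in Q , k′ , x
    splits-open (new {w} {S}) k us rs = let _ , Q , k′ , x = splits (new w ∷ S) k us rs in Q , k′ , x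

    attach-run : ∀ Q {o p s₁ r₁ r₂ k₁ k₂} →
                 Run N attach (st o p t ms mr s₁ (enc (toks (segments Q)) []) r₁ r₂ k₁ k₂) true
                              (st o p t ms mr s₁ (enc (toks (attached Q)) []) r₁ r₂ k₁ k₂)
    attach-run []             = pop∅ refl ret
    attach-run ((y , ys) ∷ Q) = popFlag-flag broken (λ _ → pushFlag S₂ linked) refl (pushFlag-run linked _ refl)

    Merged : List (Item V) → List V → List (Item V) → List V → Stacks 11 → Set
    Merged S R S′ R′ s = ∃ λ S₊ → ∃ λ T₊ → ∃ λ R₊ → ∃ λ U₊ → Join S R S′ R′ (S₊ ++ T₊) (R₊ ++ U₊) ×
      Run N mergeCovers s true
        (st [] [] t ms mr (enc (toks S₊) []) (enc (toks T₊) []) (enc (loose R₊) []) (enc (loose U₊) []) [] [])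

    -- Every loop must be shown to run at most `N` times. The passes only move vertices around, so
    -- each list in play is part of the fixed total `whole`, which is at most `N`; the identities
    -- `total-…` write this out stage by stage.
    merge-run : ∀ {S S′} R U k → Open S → Open S′ → pieces S ≡ pieces S′ + k →
                length (verts S ++ R) + length (verts S′ ++ U) ≤ N →
                Merged S R S′ U (st [] [] t ms mr (enc (toks S) []) (enc (toks S′) []) (enc (loose R) [])
                  (enc (loose U) []) (trues k) [])
    merge-run R U zero [] [] eq small = [] , [] , R , U , empty ,
      (loop [] z≤n (pop∅ refl ret) ⟫ restore₂ [] z≤n ⟫ loop [] z≤n (pop∅ refl ret)) ⟫
      (pop∅ refl ret ⟫ loop [] z≤n (pop∅ refl ret) ⟫ restore₁ [] z≤n) ⟫
      (pop∅ refl ret ⟫ loop [] z≤n (pop∅ refl ret) ⟫ restore₁ [] z≤n) ⟫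
      pop∅ refl ret
    merge-run {S′ = S′} R U (suc k) [] _ eq _ with () ← trans eq (+-suc (pieces S′) k)
    merge-run {new h ∷ S} {S′} R U k new open′ eq small =
      let Q , k′ , k′≤ , sp , it₁      = splits-open open′ k [] U
          q≤                           = fits {weight one (vertsOf Q)} (total-S sp)
          Z₁ , Q₁ , c , it₂            = closes S Q ((broken , h) ∷ []) (short Q q≤)
          q₁≤                          = fits {weight one (vertsOf Q₁)} (total-Q₁ sp c)
          Z₂ , Q₂ , U₂ , vs , j , b , j≤ , it₃ = bridges Z₁ Q₁ (vias S′ ʳ++ U) ((broken , h) ∷ []) R (short Q₁ q₁≤)
          s₁≤                          = toks≤ (new h ∷ Z₁) (fits (total-S₁ sp c))
          s₂≤                          = toks≤ (new h ∷ Z₂) (fits (total-S₂ sp c b))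
      in new h ∷ Z₂ , attached Q₂ , vs ʳ++ R , U₂ , join eq sp c b ,
         (loop it₁ (toks≤ S′ (fits total-S′)) (pop∅ refl ret) ⟫
          restore₂ (toks (segments Q)) (toks≤ (segments Q) (≤-trans (≤-reflexive (weight-segments one Q)) q≤)) ⟫
          loop (drain k′) (≤-trans k′≤ k≤) (pop∅ refl ret)) ⟫
         (popFlag-flag broken (move S₁ O) refl (move-run (λ ()) broken _ (val≤ h) refl refl) ⟫
          loop it₂ (≤-trans (n≤1+n _) (toks≤ (new h ∷ S) (fits total-S₀))) (pop∅ refl ret) ⟫
          restore₁ (toks (new h ∷ Z₁)) s₁≤) ⟫
         (popFlag-flag broken (move S₁ O) refl (move-run (λ ()) broken _ (val≤ h) refl refl) ⟫
          loop it₃ (≤-trans j≤ (≤-trans (n≤1+n _) s₁≤)) (pop∅ refl ret) ⟫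
          restore₁ (toks (new h ∷ Z₂)) s₂≤) ⟫
         attach-run Q₂
      where
      one : V → ℕ
      one _ = 1
      a = weight one (verts S)
      r = weight one R
      u = weight one U
      v = weight one (vias S′)
      whole = (suc a + r) + (weight one (verts S′) + u)
      fits : ∀ {x y} → x + y ≡ whole → x ≤ N
      fits {x} {y} p = ≤-trans (m≤m+n x y) (≤-trans (≤-reflexive (trans p (sym (cong₂ _+_
        (trans (length-weight (h ∷ verts S ++ R)) (weight-++ one (h ∷ verts S)))
        (trans (length-weight (verts S′ ++ U)) (weight-++ one (verts S′))))))) small)
      toks≤ : ∀ Z → weight one (verts Z) ≤ N → length (toks Z) ≤ N
      toks≤ Z le = ≤-trans (≤-reflexive (trans (length-toks Z) (length-weight (verts Z)))) le
      short : ∀ Q → weight one (vertsOf Q) ≤ N → Short Q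
      short Q le = ≤-trans (≤-reflexive (length-weight (vertsOf Q))) le
      total-S₀ : suc a + (r + (weight one (verts S′) + u)) ≡ whole
      total-S₀ = sym (+-assoc (suc a) r _)
      total-S′ : weight one (verts S′) + (suc a + r + u) ≡ whole
      total-S′ = solve 4 (λ s a r u → s :+ (a :+ r :+ u) := (a :+ r) :+ (s :+ u)) refl (weight one (verts S′)) (suc a) r u
      k≤ : k ≤ N
      k≤ = ≤-trans (≤-trans (m≤n+m k (pieces S′)) (≤-reflexive (sym eq)))
        (≤-trans (s≤s (≤-trans (pieces≤verts S) (≤-reflexive (length-weight (verts S))))) (fits total-S₀))
      total-S : ∀ {Q} → Split k S′ [] Q → weight one (vertsOf Q) + (v + (suc a + r + u)) ≡ whole
      total-S {Q} sp rewrite Split-weight one sp = solve 5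
        (λ q v a r u → q :+ (v :+ (a :+ r :+ u)) := (a :+ r) :+ (v :+ q :+ u)) refl (weight one (vertsOf Q)) v (suc a) r u
      total-Q₁ : ∀ {Q S₁ Q₁} → Split k S′ [] Q → Close S Q S₁ Q₁ → weight one (vertsOf Q₁) +
        (weight one (verts S₁) + (suc v + r + u)) ≡ whole
      total-Q₁ {Q} {S₁} {Q₁} sp c = trans
        (solve 5 (λ q s v r u → q :+ (s :+ (v :+ r :+ u)) := (s :+ q) :+ (v :+ r :+ u)) refl (weight one (vertsOf Q₁))
          (weight one (verts S₁)) (suc v) r u)
        (trans (cong (_+ (suc v + r + u)) (sym (Close-weight one c)))
          (trans (solve 5 (λ a q v r u → (a :+ q) :+ (con 1 :+ v :+ r :+ u) := q :+ (v :+ (con 1 :+ a :+ r :+ u))) refl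
            a (weight one (vertsOf Q)) v r u) (total-S sp)))
      total-S₁ : ∀ {Q S₁ Q₁} → Split k S′ [] Q → Close S Q S₁ Q₁ → suc (weight one (verts S₁)) +
        (weight one (vertsOf Q₁) + (v + r + u)) ≡ whole
      total-S₁ {Q} {S₁} {Q₁} sp c = trans
        (solve 5 (λ s q v r u → (con 1 :+ s) :+ (q :+ (v :+ r :+ u)) := q :+ (s :+ (con 1 :+ v :+ r :+ u))) refl
          (weight one (verts S₁)) (weight one (vertsOf Q₁)) v r u)
        (total-Q₁ sp c)
      total-S₂ : ∀ {Q S₁ Q₁ S₂ Q₂ U₂ vs} → Split k S′ [] Q → Close S Q S₁ Q₁ → Bridge S₁ Q₁ (vias S′ ʳ++ U) S₂ Q₂ U₂ vs →
                 suc (weight one (verts S₂)) + (weight one (vertsOf Q₂) + (weight one U₂ + weight one vs) + r) ≡ whole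
      total-S₂ {Q} {S₁} {Q₁} {S₂} {Q₂} {U₂} {vs} sp c b = trans
        (solve 4 (λ s q w r → (con 1 :+ s) :+ (q :+ w :+ r) := con 1 :+ (s :+ q :+ w) :+ r) refl (weight one (verts S₂))
          (weight one (vertsOf Q₂)) (weight one U₂ + weight one vs) r)
        (trans (cong (λ z → suc z + r) (sym (Bridge-weight one b)))
          (trans (cong (λ z → suc (weight one (verts S₁) + weight one (vertsOf Q₁) + z) + r) (weight-ʳ++ one (vias S′)))
            (trans (solve 5 (λ s q v u r → con 1 :+ (s :+ q :+ (v :+ u)) :+ r := (con 1 :+ s) :+ (q :+ (v :+ r :+ u))) refl
                     (weight one (verts S₁)) (weight one (vertsOf Q₁)) v u r) (total-S₁ sp c))))

    Joined : List (Item V) → List V → List (Item V) → List V → Set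
    Joined S R S′ U = ∃ λ S₊ → ∃ λ T₊ → ∃ λ R₊ → ∃ λ U₊ →
      (Join S R S′ U (S₊ ++ T₊) (R₊ ++ U₊) ⊎ Join S′ U S R (S₊ ++ T₊) (R₊ ++ U₊)) ×
      Run N joinCovers
        (st [] [] t ms mr (enc (toks S) []) (enc (toks S′) []) (enc (loose R) []) (enc (loose U) []) [] []) true
        (st [] [] t ms mr (enc (toks S₊) []) (enc (toks T₊) []) (enc (loose R₊) []) (enc (loose U₊) []) [] [])

    join-run : ∀ {S S′} R U → Open S → Open S′ → length (verts S ++ R) + length (verts S′ ++ U) ≤ N → Joined S R S′ U
    join-run {S} {S′} R U o o′ small = dispatch (compare-run S S′ len len′)
      where
      left≤ : length (verts S) + length R ≤ N
      left≤ = ≤-trans (≤-reflexive (sym (length-++ (verts S)))) (≤-trans (m≤m+n _ _) small)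
      right≤ : length (verts S′) + length U ≤ N
      right≤ = ≤-trans (≤-reflexive (sym (length-++ (verts S′)))) (≤-trans (m≤n+m _ _) small)
      len : length (toks S) ≤ N
      len = ≤-trans (≤-reflexive (length-toks S)) (≤-trans (m≤m+n _ _) left≤)
      len′ : length (toks S′) ≤ N
      len′ = ≤-trans (≤-reflexive (length-toks S′)) (≤-trans (m≤m+n _ _) right≤)
      lenR : length (loose R) ≤ N
      lenR = ≤-trans (≤-reflexive (length-map _ R)) (≤-trans (m≤n+m _ _) left≤)
      lenU : length (loose U) ≤ N
      lenU = ≤-trans (≤-reflexive (length-map _ U)) (≤-trans (m≤n+m _ _) right≤)
      Compared : Set
      Compared = ∃ λ a → ∃ λ b → (a ≡ 0 ⊎ b ≡ 0) × pieces S + b ≡ pieces S′ + a ×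
        Run N comparePieces (st [] [] t ms mr (enc (toks S) []) (enc (toks S′) []) (enc (loose R) []) (enc (loose U) [])
          [] []) false
          (st [] [] t ms mr (enc (toks S) []) (enc (toks S′) []) (enc (loose R) []) (enc (loose U) []) (trues a) (trues b))
      dispatch : Compared → Joined S R S′ U
      dispatch (a , zero , _ , eq , compared) =
        let S₊ , T₊ , R₊ , U₊ , j , merged = merge-run R U a o o′ (trans (sym (+-identityʳ _)) eq) small
        in S₊ , T₊ , R₊ , U₊ , inj₁ j , compared ⟫ pop∅ refl ret ⟫ merged
      dispatch (zero , suc b , _ , eq , compared) =
        let S₊ , T₊ , R₊ , U₊ , j , merged = merge-run U R (suc b) o′ o (sym (trans eq (+-identityʳ _)))
                                               (≤-trans (≤-reflexive (+-comm (length (verts S′ ++ U)) _)) small)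
        in S₊ , T₊ , R₊ , U₊ , inj₂ j , compared ⟫
           pop₁ refl (push ⟫ loop (transfer 1 b) b≤ (pop∅ refl ret) ⟫ swap-S (toks S) (toks S′) len len′ ⟫ swap-R
             (loose R) (loose U) lenR lenU) ⟫
           subst (λ n → Run N mergeCovers (st [] [] t ms mr (enc (toks S′) []) (enc (toks S) []) (enc (loose U) [])
             (enc (loose R) []) (trues n) []) true
                          (st [] [] t ms mr (enc (toks S₊) []) (enc (toks T₊) []) (enc (loose R₊) [])
                            (enc (loose U₊) []) [] []))
             (+-comm 1 b) merged
        where
        b≤ : b ≤ N
        b≤ = ≤-trans (n≤1+n b) (≤-trans (m≤n+m (suc b) (pieces S)) (≤-trans (≤-reflexive (trans eq (+-identityʳ _)))
               (≤-trans (pieces≤verts S′) (≤-trans (m≤m+n _ _) right≤))))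
      dispatch (suc a , suc b , inj₁ () , _)
      dispatch (suc a , suc b , inj₂ () , _)

-- The flags are reused to label the nodes of the parse tree on the stack T.
nodeFlag : Bool → Flag
nodeFlag false = linked
nodeFlag true  = bridged

leafFlag : Bool → Flag
leafFlag false = bridge
leafFlag true  = broken

-- `K₁` holds the number of leaves read so far, which is the number of the next vertex; `K₂` keeps
-- it while it is copied to `T`.
parseNode parseLeaf parse : Prog 11
parseNode = pop O halt (pushFlag T linked) (pushFlag T bridged)
parseLeaf = push T false ⟫ loop (pop K₁ halt halt (push T true ⟫ push K₂ true)) ⟫
            loop (pop K₂ halt halt (push K₁ true)) ⟫ push K₁ true ⟫
            pop P halt (pushFlag T bridge) (pushFlag T broken)
parse     = loop (pop O halt parseNode parseLeaf) ⟫ loop (pop K₁ halt skip skip)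

-- The right subtree is finished before the left one, so the upper entries of `MS` and `MR` belong
-- to the left subtree.
load store : Prog 11
load  = pour MS S₁ ⟫ pour MR R₁ ⟫ pour MS S₂ ⟫ pour MR R₂
store = pushMark MS ⟫ pour S₁ MS ⟫ pour S₂ MS ⟫ pushMark MR ⟫ pour R₁ MR ⟫ pour R₂ MR ⟫ skip

processFlag : Flag → Prog 11
processFlag broken  = pushMark MS ⟫ pushMark MR ⟫ move T MS broken
processFlag bridge  = pushMark MS ⟫ pushMark MR ⟫ move T MR bridge
processFlag linked  = load ⟫ store
processFlag bridged = load ⟫ joinCovers ⟫ store

-- If there are no terminals the cover is empty and the path consisting of vertex 0 is printed.
emit : Prog 11
emit = forEach MS (λ _ → moveUnary MS O ⟫ skip) ⟫ pop O (push O false) (push O false) (push O true)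

-- Opaque, so that the machine compiled from it is never normalised.
opaque
  main : Prog 11
  main = parse ⟫ forEach T processFlag ⟫ emit

-- Correctness of parsing, traversal and output

data Tree (V : Set) : Set where
  leaf : V → Tree V
  node : Bool → Tree V → Tree V → Tree V

module _ {V : Set} where

  leaves : Tree V → List V
  leaves (leaf v)     = v ∷ []
  leaves (node b l r) = leaves l ++ leaves r

  nodes : Tree V → ℕ
  nodes (leaf v)     = 1
  nodes (node b l r) = suc (nodes l + nodes r)

  prefix : Tree V → List Bool → List Bool
  prefix (leaf v)     w = true ∷ w
  prefix (node b l r) w = false ∷ b ∷ prefix l (prefix r w)

  next : Tree V → ℕ → ℕ
  next (leaf v)     k = suc k
  next (node b l r) k = next r (next l k)

Iter-++ : ∀ {K N} {p : Prog K} {j k s s′ s″} → Iter N p j s s′ → Iter N p k s′ s″ → Iter N p (j + k) s s″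
Iter-++ []       ys = ys
Iter-++ (x ∷ xs) ys = x ∷ Iter-++ xs ys

recount : ∀ {K N} {p : Prog K} {j k s s′} → j ≡ k → Iter N p j s s′ → Iter N p k s s′
recount refl it = it

module Phases {V : Set} (_≟_ : DecidableEquality V) (E : V → V → Set) (X : V → Bool)
              (val : V → ℕ) {N : ℕ} (val≤ : ∀ v → val v ≤ N) where

  open Cover _≟_ E X
  open Tokens val val≤
  open Passes val val≤

  terminals : Tree V → List Bool → List Bool
  terminals (leaf v)     w = X v ∷ w
  terminals (node b l r) w = terminals l (terminals r w)

  -- Pushing tokens while reading a prefix code reverses their order: the right subtree comes out
  -- first, and a node after both of its subtrees.
  postfix : Tree V → List Bool → List Bool
  postfix (leaf v)     w = flagged (leafFlag (X v)) (unary (val v) w)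
  postfix (node b l r) w = postfix r (postfix l (flagged (nodeFlag b) w))

  Numbered : ℕ → Tree V → Set
  Numbered k (leaf v)     = val v ≡ k
  Numbered k (node b l r) = Numbered k l × Numbered (next l k) r

  copies : ∀ k j {o p w ms mr s₁ s₂ r₁ r₂ k₂} → Iter N (pop K₁ halt halt (push T true ⟫ push K₂ true)) k
           (st o p (unary j w) ms mr s₁ s₂ r₁ r₂ (trues k) k₂) (st o p (unary (k + j) w) ms mr s₁ s₂ r₁ r₂ [] (trues k ++ k₂))
  copies zero    j = []
  copies (suc k) j {o} {p} {w} {ms} {mr} {s₁} {s₂} {r₁} {r₂} {k₂} = pop₁ refl (push ⟫ push) ∷
    subst₂ (λ n x → Iter N (pop K₁ halt halt (push T true ⟫ push K₂ true)) k
             (st o p (unary (suc j) w) ms mr s₁ s₂ r₁ r₂ (trues k) (true ∷ k₂)) (st o p (unary n w) ms mr s₁ s₂ r₁ r₂ [] x))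
      (+-suc k j) (shift k) (copies k (suc j))
    where
    shift : ∀ k → trues k ++ true ∷ k₂ ≡ true ∷ trues k ++ k₂
    shift zero    = refl
    shift (suc k) = cong (true ∷_) (shift k)

  returns : ∀ k j {o p t ms mr s₁ s₂ r₁ r₂} → Iter N (pop K₂ halt halt (push K₁ true)) k
            (st o p t ms mr s₁ s₂ r₁ r₂ (trues j) (trues k)) (st o p t ms mr s₁ s₂ r₁ r₂ (trues (k + j)) [])
  returns zero    j = []
  returns (suc k) j {o} {p} {t} {ms} {mr} {s₁} {s₂} {r₁} {r₂} = pop₁ refl push ∷
    subst (λ n → Iter N (pop K₂ halt halt (push K₁ true)) k
             (st o p t ms mr s₁ s₂ r₁ r₂ (trues (suc j)) (trues k)) (st o p t ms mr s₁ s₂ r₁ r₂ (trues n) []))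
      (+-suc k j) (returns k (suc j))

  parses : ∀ t k {o p w} → Numbered k t → Iter N (pop O halt parseNode parseLeaf) (nodes t)
           (st (prefix t o) (terminals t p) w [] [] [] [] [] [] (trues k) [])
           (st o p (postfix t w) [] [] [] [] [] [] (trues (next t k)) [])
  parses (leaf v) k {o} {p} {w} refl = pop₁ refl
    (push ⟫
     subst₂ (λ n x → Run N (loop (pop K₁ halt halt (push T true ⟫ push K₂ true)))
               (st o (X v ∷ p) (unary 0 w) [] [] [] [] [] [] (trues k) []) false
               (st o (X v ∷ p) (unary n w) [] [] [] [] [] [] [] x)) (+-identityʳ k) (++-identityʳ (trues k))
       (loop (copies k 0) (val≤ v) (pop∅ refl ret)) ⟫
     subst (λ n → Run N (loop (pop K₂ halt halt (push K₁ true)))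
               (st o (X v ∷ p) (unary k w) [] [] [] [] [] [] [] (trues k)) false
               (st o (X v ∷ p) (unary k w) [] [] [] [] [] [] (trues n) [])) (+-identityʳ k)
       (loop (returns k 0) (val≤ v) (pop∅ refl ret)) ⟫
     push ⟫
     terminal (X v)) ∷ []
    where
    terminal : ∀ x → Run N (pop P halt (pushFlag T bridge) (pushFlag T broken))
               (st o (x ∷ p) (unary k w) [] [] [] [] [] [] (trues (suc k)) []) true
               (st o p (flagged (leafFlag x) (unary k w)) [] [] [] [] [] [] (trues (suc k)) [])
    terminal false = pop₀ refl (pushFlag-run bridge _ refl)
    terminal true  = pop₁ refl (pushFlag-run broken _ refl)
  parses (node false l r) k (n , n′) =
    pop₀ refl (pop₀ refl (pushFlag-run linked _ refl)) ∷ Iter-++ (parses l k n) (parses r (next l k) n′)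
  parses (node true l r) k (n , n′) =
    pop₀ refl (pop₁ refl (pushFlag-run bridged _ refl)) ∷ Iter-++ (parses l k n) (parses r (next l k) n′)

  -- Covers are kept reversed, so that a single `pour` restores their order, and so that `emit`,
  -- which builds the output from its end, can read them directly.
  entryS : List (Item V) → List Bool → List Bool
  entryS S w = enc (toks S ʳ++ []) (marked w)

  entryR : List V → List Bool → List Bool
  entryR R w = enc (loose R ʳ++ []) (marked w)

  Small : List (Item V) → List V → Set
  Small S R = length (verts S ++ R) ≤ N

  small-S : ∀ S R → Small S R → length (toks S) ≤ N
  small-S S R le = ≤-trans (≤-reflexive (length-toks S))
    (≤-trans (m≤m+n _ (length R)) (≤-trans (≤-reflexive (sym (length-++ (verts S)))) le))

  small-R : ∀ S R → Small S R → length (loose R) ≤ N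
  small-R S R le = ≤-trans (≤-reflexive (length-map _ R))
    (≤-trans (m≤n+m _ (length (verts S))) (≤-trans (≤-reflexive (sym (length-++ (verts S)))) le))

  unload : ∀ {K} {i j : Fin K} (i≢j : i ≢ j) (s : Stacks K) ts {r} → length ts ≤ N →
           Vec.lookup s i ≡ enc (ts ʳ++ []) (marked r) → Vec.lookup s j ≡ [] →
           Run N (pour i j) s false (with₂ i≢j s r (enc ts []))
  unload {i = i} {j} i≢j s ts {r} len eq eq′ =
    subst (λ us → Run N (pour i j) s false (with₂ i≢j s r (enc us []))) (reverse² ts)
      (unload-run i≢j s (ts ʳ++ []) [] (≤-trans (≤-reflexive (length-reverse ts)) len) eq eq′)

  load-run : ∀ S R S′ U {t ms mr} → Small S R → Small S′ U →
             Run N load (st [] [] t (entryS S (entryS S′ ms)) (entryR R (entryR U mr)) [] [] [] [] [] []) false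
                        (st [] [] t ms mr (enc (toks S) []) (enc (toks S′) []) (enc (loose R) []) (enc (loose U) []) [] [])
  load-run S R S′ U sm sm′ =
    unload (λ ()) _ (toks S) (small-S S R sm) refl refl ⟫ unload (λ ()) _ (loose R) (small-R S R sm) refl refl ⟫
    unload (λ ()) _ (toks S′) (small-S S′ U sm′) refl refl ⟫ unload (λ ()) _ (loose U) (small-R S′ U sm′) refl refl

  store-run : ∀ S R S′ U {t ms mr} → length (toks S) ≤ N → length (toks S′) ≤ N → length (loose R) ≤ N → length (loose U) ≤ N →
              Run N store (st [] [] t ms mr (enc (toks S) []) (enc (toks S′) []) (enc (loose R) []) (enc (loose U) [])
                [] []) true
                          (st [] [] t (entryS (S ++ S′) ms) (entryR (R ++ U) mr) [] [] [] [] [] [])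
  store-run S R S′ U {t} {ms} {mr} a b c d =
    subst₂ (λ x y → Run N store (st [] [] t ms mr (enc (toks S) []) (enc (toks S′) []) (enc (loose R) [])
      (enc (loose U) []) [] []) true
                      (st [] [] t (enc x (marked ms)) (enc y (marked mr)) [] [] [] [] [] []))
      (trans (sym (++-ʳ++ (toks S))) (cong (_ʳ++ []) (sym (toks-++ S))))
      (trans (sym (++-ʳ++ (loose R))) (cong (_ʳ++ []) (sym (map-++ (bridge ,_) R U))))
      ((push ⟫ push ⟫ push) ⟫ pour-run (λ ()) _ (toks S) [] a refl refl ⟫ pour-run (λ ()) _ (toks S′) (toks S ʳ++ []) b
        refl refl ⟫
       (push ⟫ push ⟫ push) ⟫ pour-run (λ ()) _ (loose R) [] c refl refl ⟫ pour-run (λ ()) _ (loose U) (loose R ʳ++ [])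
         d refl refl ⟫ ret)

  Crossing : Bool → List V → List V → Set
  Crossing true  A B = ∀ {a b} → a ∈ₗ A → b ∈ₗ B → E a b × E b a
  Crossing false A B = ∀ {a b} → a ∈ₗ A → b ∈ₗ B → ¬ E a b × ¬ E b a

  Presents : Tree V → Set
  Presents (leaf v)     = ⊤
  Presents (node b l r) = Presents l × Presents r × (∀ {v} → v ∈ₗ leaves l → v ∈ₗ leaves r → ⊥) × Crossing b (leaves l)
    (leaves r)

  Valid⇒Open : ∀ {S} → Valid S → Open S
  Valid⇒Open []        = []
  Valid⇒Open (new _ _) = new

  open Summary

  length-summary : ∀ {L S R} → Summary L S R → length (verts S ++ R) ≡ length L
  length-summary {L} {S} {R} s = ≋⇒length {verts S ++ R} {L} (s .same)

  parts : ∀ S S′ (R U : List V) → length (verts (S ++ S′) ++ (R ++ U)) ≤ N →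
          length (toks S) ≤ N × length (toks S′) ≤ N × length (loose R) ≤ N × length (loose U) ≤ N
  parts S S′ R U le =
      within (≤-trans (m≤m+n a b) (m≤m+n (a + b) (c + d)))
    , within (≤-trans (m≤n+m b a) (m≤m+n (a + b) (c + d)))
    , within (≤-trans (≤-reflexive (length-map _ R)) (≤-trans (m≤m+n c d) (m≤n+m (c + d) (a + b))))
    , within (≤-trans (≤-reflexive (length-map _ U)) (≤-trans (m≤n+m d c) (m≤n+m (c + d) (a + b))))
    where
    a = length (toks S)
    b = length (toks S′)
    c = length R
    d = length U
    eq : length (verts (S ++ S′) ++ (R ++ U)) ≡ (a + b) + (c + d)
    eq = trans (length-++ (verts (S ++ S′))) (cong₂ _+_
      (trans (sym (length-toks (S ++ S′))) (trans (cong length (toks-++ S)) (length-++ (toks S)))) (length-++ R))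
    within : ∀ {x} → x ≤ (a + b) + (c + d) → x ≤ N
    within p = ≤-trans p (≤-trans (≤-reflexive (sym eq)) le)

  Processed : Tree V → Set
  Processed t = ∀ w ms mr → ∃ λ S → ∃ λ R → Summary (leaves t) S R ×
    Iter N (popFlag T halt halt processFlag) (nodes t)
      (st [] [] (postfix t w) ms mr [] [] [] [] [] []) (st [] [] w (entryS S ms) (entryR R mr) [] [] [] [] [] [])

  process : ∀ t → Presents t → length (leaves t) ≤ N → Processed t
  process (leaf v) _ _ w ms mr with X v in x
  ... | true  = new v ∷ [] , [] , Summary-terminal x ,
    popFlag-flag broken processFlag refl ((push ⟫ push ⟫ push) ⟫ (push ⟫ push ⟫ push) ⟫ move-run (λ ()) broken _
      (val≤ v) refl refl) ∷ []
  ... | false = [] , v ∷ [] , Summary-spare x ,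
    popFlag-flag bridge processFlag refl ((push ⟫ push ⟫ push) ⟫ (push ⟫ push ⟫ push) ⟫ move-run (λ ()) bridge _
      (val≤ v) refl refl) ∷ []
  process (node b l r) (pl , pr , disjoint , crossing) small w ms mr =
    let S′ , U , s′ , runs′ = process r pr (≤-trans (m≤n+m _ _) small′) (postfix l (flagged (nodeFlag b) w)) ms mr
        S  , R , s  , runs  = process l pl (≤-trans (m≤m+n _ _) small′) (flagged (nodeFlag b) w) (entryS S′ ms) (entryR U mr)
        S″ , R″ , s″ , last = combine b crossing s s′
    in S″ , R″ , s″ , recount order (Iter-++ runs′ (Iter-++ runs (last ∷ [])))
    where
    small′ : length (leaves l) + length (leaves r) ≤ N
    small′ = ≤-trans (≤-reflexive (sym (length-++ (leaves l)))) small
    order : nodes r + (nodes l + 1) ≡ suc (nodes l + nodes r)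
    order = solve 2 (λ a b → b :+ (a :+ con 1) := con 1 :+ (a :+ b)) refl (nodes l) (nodes r)
    Combined : Bool → List (Item V) → List V → List (Item V) → List V → Set
    Combined b S R S′ U = ∃ λ S″ → ∃ λ R″ → Summary (leaves l ++ leaves r) S″ R″ ×
      Run N (popFlag T halt halt processFlag)
        (st [] [] (flagged (nodeFlag b) w) (entryS S (entryS S′ ms)) (entryR R (entryR U mr)) [] [] [] [] [] []) true
        (st [] [] w (entryS S″ ms) (entryR R″ mr) [] [] [] [] [] [])
    combine : ∀ b {S R S′ U} → Crossing b (leaves l) (leaves r) → Summary (leaves l) S R → Summary (leaves r) S′ U →
      Combined b S R S′ U
    combine b {S} {R} {S′} {U} crossing s s′ = by-label b crossing
      where
      sm : Small S R
      sm = ≤-trans (≤-reflexive (length-summary s)) (≤-trans (m≤m+n _ _) small′)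
      sm′ : Small S′ U
      sm′ = ≤-trans (≤-reflexive (length-summary s′)) (≤-trans (m≤n+m _ _) small′)
      stored : ∀ S₊ T₊ R₊ U₊ {t ms mr} → Summary (leaves l ++ leaves r) (S₊ ++ T₊) (R₊ ++ U₊) →
               Run N store (st [] [] t ms mr (enc (toks S₊) []) (enc (toks T₊) []) (enc (loose R₊) [])
                 (enc (loose U₊) []) [] []) true
                           (st [] [] t (entryS (S₊ ++ T₊) ms) (entryR (R₊ ++ U₊) mr) [] [] [] [] [] [])
      stored S₊ T₊ R₊ U₊ summary =
        let a , b , c , d = parts S₊ T₊ R₊ U₊ (≤-trans (≤-reflexive (length-summary summary)) small)
        in store-run S₊ R₊ T₊ U₊ a b c d
      summarise : ∀ {Z Y} → Crossing true (leaves l) (leaves r) → Join S R S′ U Z Y ⊎ Join S′ U S R Z Y → Summary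
        (leaves l ++ leaves r) Z Y
      summarise cross (inj₁ j) = Node.join-summary s s′ disjoint cross j
      -- The right cover had more paths and the operands were exchanged, so the summary is obtained
      -- for the leaves in the opposite order.
      summarise cross (inj₂ j) = Summary-swap {leaves r} {leaves l}
        (Node.join-summary s′ s (λ a b → disjoint b a) (λ a b → proj₂ (cross b a) , proj₁ (cross b a)) j)
      by-label : ∀ b → Crossing b (leaves l) (leaves r) → Combined b S R S′ U
      by-label false none =
        let summary = Node.union-summary s s′ disjoint none
        in S ++ S′ , R ++ U , summary ,
           popFlag-flag linked processFlag refl (load-run S R S′ U sm sm′ ⟫ stored S S′ R U summary)
      by-label true cross =
        let S₊ , T₊ , R₊ , U₊ , j , joined = join-run R U (Valid⇒Open (s .valid)) (Valid⇒Open (s′ .valid))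
              (≤-trans (≤-reflexive (cong₂ _+_ (length-summary s) (length-summary s′))) small′)
            summary = summarise cross j
        in S₊ ++ T₊ , R₊ ++ U₊ , summary ,
           popFlag-flag bridged processFlag refl (load-run S R S′ U sm sm′ ⟫ joined ⟫ stored S₊ T₊ R₊ U₊ summary)

  spell : List V → List Bool
  spell []       = []
  spell (v ∷ vs) = unary (val v) (spell vs)

  spellTokens : List Token → List Bool → List Bool
  spellTokens []             w = w
  spellTokens ((_ , v) ∷ ts) w = unary (val v) (spellTokens ts w)

  spell-toks : ∀ S → spellTokens (toks S) [] ≡ spell (verts S)
  spell-toks []            = refl
  spell-toks (new w ∷ S)   = cong (unary (val w)) (spell-toks S)
  spell-toks (adj w ∷ S)   = cong (unary (val w)) (spell-toks S)
  spell-toks (via u w ∷ S) = cong (λ z → unary (val u) (unary (val w) z)) (spell-toks S)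

  emitted : List Token → List Bool → List Bool
  emitted []             w = w
  emitted ((_ , v) ∷ ts) w = emitted ts (unary (val v) w)

  emitted-reverse : ∀ ts {us w} → emitted (ts ʳ++ us) w ≡ emitted us (spellTokens ts w)
  emitted-reverse []       = refl
  emitted-reverse (t ∷ ts) = emitted-reverse ts

  emits : ∀ ts {o r mr} → Iter N (popFlag MS halt halt (λ _ → moveUnary MS O ⟫ skip)) (length ts)
          (st o [] [] (enc ts r) mr [] [] [] [] [] []) (st (emitted ts o) [] [] r mr [] [] [] [] [] [])
  emits []             = []
  emits ((f , v) ∷ ts) = popFlag-flag f (λ _ → moveUnary MS O ⟫ skip) refl
    (moveUnary-run (λ ()) _ (val≤ v) refl refl ⟫ ret) ∷ emits ts

  answer : List V → List Bool
  answer []       = false ∷ []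
  answer (v ∷ vs) = spell (v ∷ vs)

  answer-run : ∀ vs {mr} → Run N (pop O (push O false) (push O false) (push O true))
               (st (spell vs) [] [] [] mr [] [] [] [] [] []) true (st (answer vs) [] [] [] mr [] [] [] [] [] [])
  answer-run []       = pop∅ refl push
  answer-run (v ∷ vs) = restore (val v)
    where
    restore : ∀ k {w mr} → Run N (pop O (push O false) (push O false) (push O true))
              (st (unary k w) [] [] [] mr [] [] [] [] [] []) true (st (unary k w) [] [] [] mr [] [] [] [] [] [])
    restore zero    = pop₀ refl push
    restore (suc k) = pop₁ refl push

  emit-run : ∀ S {mr} → length (toks S) ≤ N → Run N emit
             (st [] [] [] (entryS S []) mr [] [] [] [] [] []) true (st (answer (verts S)) [] [] [] mr [] [] [] [] [] [])
  emit-run S {mr} len =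
    subst (λ o → Run N (forEach MS (λ _ → moveUnary MS O ⟫ skip)) (st [] [] [] (entryS S []) mr [] [] [] [] [] []) false
                   (st o [] [] [] mr [] [] [] [] [] []))
      (trans (emitted-reverse (toks S)) (spell-toks S))
      (loop (emits (toks S ʳ++ [])) (≤-trans (≤-reflexive (length-reverse (toks S))) len)
        (popFlag-mark {k = λ _ → moveUnary MS O ⟫ skip} refl ret)) ⟫
    answer-run (verts S)

  opaque
    unfolding main

    main-run : ∀ t → Presents t → Numbered 0 t → length (leaves t) ≤ N → nodes t ≤ N → next t 0 ≤ N →
               ∃ λ S → ∃ λ R → ∃ λ ss → Summary (leaves t) S R ×
               Run N main (st (prefix t []) (terminals t []) [] [] [] [] [] [] [] [] []) true (answer (verts S) ∷ ss)
    main-run t pr num small few counted =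
      let S , R , s , runs = process t pr small [] [] []
      in S , R , _ , s ,
         (loop (parses t 0 num) few (pop∅ refl ret) ⟫ loop (drain (next t 0)) counted (pop∅ refl ret)) ⟫
         loop runs few (pop∅ refl ret) ⟫
         emit-run S (small-S S R (≤-trans (≤-reflexive (length-summary s)) small))

-- Parse trees

toTree : ∀ {V m} → Cotree m → (Fin m → V) → Tree V
toTree leaf                 ι = leaf (ι zero)
toTree (node {m} {n} b l r) ι = node b (toTree l (ι ∘ (_↑ˡ n))) (toTree r (ι ∘ (m ↑ʳ_)))

bits-prefix : ∀ {V m} (t : Cotree m) (ι : Fin m → V) w → bits (prefix (toTree t ι) w) ≡ encTree t ++ bits w
bits-prefix leaf ι w = refl
bits-prefix (node {m} {n} b l r) ι w = cong (λ z → b0 ∷ bit b ∷ z)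
  (trans (bits-prefix l (ι ∘ (_↑ˡ n)) _) (trans (cong (encTree l ++_) (bits-prefix r (ι ∘ (m ↑ʳ_)) w))
    (sym (++-assoc (encTree l) (encTree r) (bits w)))))

nodes≤prefix : ∀ {V} (t : Tree V) w → nodes t + length w ≤ length (prefix t w)
nodes≤prefix (leaf v)     w = ≤-refl
nodes≤prefix (node b l r) w = s≤s (m≤n⇒m≤1+n (≤-trans (≤-reflexive (+-assoc (nodes l) (nodes r) (length w)))
  (≤-trans (+-monoʳ-≤ (nodes l) (nodes≤prefix r w)) (nodes≤prefix l (prefix r w)))))

next-toTree : ∀ {V m} (t : Cotree m) (ι : Fin m → V) k → next (toTree t ι) k ≡ m + k
next-toTree leaf ι k = refl
next-toTree (node {m} {n} b l r) ι k = trans (next-toTree r (ι ∘ (m ↑ʳ_)) _)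
  (trans (cong (n +_) (next-toTree l (ι ∘ (_↑ˡ n)) k)) (trans (sym (+-assoc n m k)) (cong (_+ k) (+-comm n m))))

tabulate-+ : ∀ {A : Set} m {n} (f : Fin (m + n) → A) → tabulate f ≡ tabulate (f ∘ (_↑ˡ n)) ++ tabulate (f ∘ (m ↑ʳ_))
tabulate-+ zero    f = refl
tabulate-+ (suc m) f = cong (f zero ∷_) (tabulate-+ m (f ∘ suc))

leaves-toTree : ∀ {V m} (t : Cotree m) (ι : Fin m → V) → leaves (toTree t ι) ≡ tabulate ι
leaves-toTree leaf ι = refl
leaves-toTree (node {m} {n} b l r) ι = trans
  (cong₂ _++_ (leaves-toTree l (ι ∘ (_↑ˡ n))) (leaves-toTree r (ι ∘ (m ↑ʳ_)))) (sym (tabulate-+ m ι))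

∈-leaves⁻ : ∀ {V m} (t : Cotree m) (ι : Fin m → V) {v} → v ∈ₗ leaves (toTree t ι) → ∃ λ i → v ≡ ι i
∈-leaves⁻ t ι {v} m = ∈-tabulate⁻ (subst (v ∈ₗ_) (leaves-toTree t ι) m)

↑ˡ≢↑ʳ : ∀ {m n} (i : Fin m) (j : Fin n) → i ↑ˡ n ≢ m ↑ʳ j
↑ˡ≢↑ʳ {m} {n} i j eq with trans (sym (splitAt-↑ˡ m i n)) (trans (cong (splitAt m) eq) (splitAt-↑ʳ m n j))
... | ()

module _ {m n : ℕ} (b : Bool) (l : Cotree m) (r : Cotree n) where

  Adj-ˡ : ∀ i j → Adj (node b l r) (i ↑ˡ n) (j ↑ˡ n) ≡ Adj l i j
  Adj-ˡ i j rewrite splitAt-↑ˡ m i n | splitAt-↑ˡ m j n = refl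

  Adj-ʳ : ∀ i j → Adj (node b l r) (m ↑ʳ i) (m ↑ʳ j) ≡ Adj r i j
  Adj-ʳ i j rewrite splitAt-↑ʳ m n i | splitAt-↑ʳ m n j = refl

  Adj-ˡʳ : ∀ i j → Adj (node b l r) (i ↑ˡ n) (m ↑ʳ j) ≡ Bool.T b
  Adj-ˡʳ i j rewrite splitAt-↑ˡ m i n | splitAt-↑ʳ m n j = refl

  Adj-ʳˡ : ∀ i j → Adj (node b l r) (m ↑ʳ j) (i ↑ˡ n) ≡ Bool.T b
  Adj-ʳˡ i j rewrite splitAt-↑ˡ m i n | splitAt-↑ʳ m n j = refl

-- From the summary at the root to an optimal path

module Instance {n : ℕ} (G : Cotree n) (Y : Subset n) where

  X : Fin n → Bool
  X = Vec.lookup Y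

  tree : Tree (Fin n)
  tree = toTree G id

  symbols : List Sym
  symbols = bits (prefix tree []) ++ sep ∷ bits (Vec.toList Y)

  -- The input length bounds the vertex numbers, the nodes of the parse tree and the lists of
  -- vertices, hence the iterations of every loop.
  N : ℕ
  N = length symbols

  n≤N : n ≤ N
  n≤N = ≤-trans (≤-reflexive (sym (trans (length-map bit (Vec.toList Y)) (length-toList Y))))
    (≤-trans (n≤1+n _) (≤-trans (m≤n+m _ (length (bits (prefix tree []))))
      (≤-reflexive (sym (length-++ (bits (prefix tree [])))))))

  nodes≤N : nodes tree ≤ N
  nodes≤N = ≤-trans (≤-trans (m≤m+n (nodes tree) 0) (nodes≤prefix tree []))
    (≤-trans (≤-reflexive (sym (length-map bit (prefix tree []))))
      (≤-trans (m≤m+n _ _) (≤-reflexive (sym (length-++ (bits (prefix tree [])))))))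

  open Phases {Fin n} _≟_ (Adj G) X toℕ {N} (λ v → ≤-trans (<⇒≤ (toℕ<n v)) n≤N)
  open Cover {Fin n} _≟_ (Adj G) X

  terminals-toTree : ∀ {m} (t : Cotree m) (ι : Fin m → Fin n) (Z : Vec Bool m) → (∀ i → Vec.lookup Z i ≡ X (ι i)) →
                     ∀ w → terminals (toTree t ι) w ≡ Vec.toList Z ++ w
  terminals-toTree leaf ι (z ∷ []) eq w = cong (_∷ w) (sym (eq zero))
  terminals-toTree (node {m} {k} b l r) ι Z eq w with Vec.splitAt m Z
  ... | Z₁ , Z₂ , refl = trans
    (terminals-toTree l (ι ∘ (_↑ˡ k)) Z₁ (λ i → trans (sym (lookup-++ˡ Z₁ Z₂ i)) (eq (i ↑ˡ k))) _)
    (trans (cong (Vec.toList Z₁ ++_) (terminals-toTree r (ι ∘ (m ↑ʳ_)) Z₂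
      (λ i → trans (sym (lookup-++ʳ Z₁ Z₂ i)) (eq (m ↑ʳ i))) w))
      (trans (sym (++-assoc (Vec.toList Z₁) (Vec.toList Z₂) w)) (cong (_++ w) (sym (toList-++ Z₁ Z₂)))))

  numbered : ∀ {m} (t : Cotree m) (ι : Fin m → Fin n) k → (∀ i → toℕ (ι i) ≡ toℕ i + k) → Numbered k (toTree t ι)
  numbered leaf ι k eq = eq zero
  numbered (node {m} {j} b l r) ι k eq =
    numbered l (ι ∘ (_↑ˡ j)) k (λ i → trans (eq (i ↑ˡ j)) (cong (_+ k) (toℕ-↑ˡ i j))) ,
    numbered r (ι ∘ (m ↑ʳ_)) _ (λ i → trans (eq (m ↑ʳ i)) (trans (cong (_+ k) (trans (toℕ-↑ʳ m i) (+-comm m (toℕ i))))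
      (trans (+-assoc (toℕ i) m k) (cong (toℕ i +_) (sym (next-toTree l (ι ∘ (_↑ˡ j)) k))))))

  presents : ∀ {m} (t : Cotree m) (ι : Fin m → Fin n) → (∀ {i j} → ι i ≡ ι j → i ≡ j) →
             (∀ i j → Adj G (ι i) (ι j) ≡ Adj t i j) → Presents (toTree t ι)
  presents leaf ι inj agree = tt
  presents (node {m} {k} b l r) ι inj agree =
    presents l (ι ∘ (_↑ˡ k)) (λ e → ↑ˡ-injective k _ _ (inj e)) (λ i j → trans (agree _ _) (Adj-ˡ b l r i j)) ,
    presents r (ι ∘ (m ↑ʳ_)) (λ e → ↑ʳ-injective m _ _ (inj e)) (λ i j → trans (agree _ _) (Adj-ʳ b l r i j)) ,
    disjoint ,
    crossing b refl
    where
    disjoint : ∀ {v} → v ∈ₗ leaves (toTree l (ι ∘ (_↑ˡ k))) → v ∈ₗ leaves (toTree r (ι ∘ (m ↑ʳ_))) → ⊥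
    disjoint p q with ∈-leaves⁻ l (ι ∘ (_↑ˡ k)) p | ∈-leaves⁻ r (ι ∘ (m ↑ʳ_)) q
    ... | i , refl | j , eq = ↑ˡ≢↑ʳ i j (inj eq)
    crossing : ∀ b′ → b ≡ b′ → Crossing b′ (leaves (toTree l (ι ∘ (_↑ˡ k)))) (leaves (toTree r (ι ∘ (m ↑ʳ_))))
    crossing true  refl p q with ∈-leaves⁻ l (ι ∘ (_↑ˡ k)) p | ∈-leaves⁻ r (ι ∘ (m ↑ʳ_)) q
    ... | i , refl | j , refl = subst id (sym (trans (agree _ _) (Adj-ˡʳ true l r i j))) tt ,
                                subst id (sym (trans (agree _ _) (Adj-ʳˡ true l r i j))) tt
    crossing false refl p q with ∈-leaves⁻ l (ι ∘ (_↑ˡ k)) p | ∈-leaves⁻ r (ι ∘ (m ↑ʳ_)) q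
    ... | i , refl | j , refl = (λ e → subst id (trans (agree _ _) (Adj-ˡʳ false l r i j)) e) ,
                                (λ e → subst id (trans (agree _ _) (Adj-ʳˡ false l r i j)) e)

  unary-bits : ∀ k w → bits (unary k w) ≡ (replicate k b1 ++ b0 ∷ []) ++ bits w
  unary-bits zero    w = refl
  unary-bits (suc k) w = cong (b1 ∷_) (unary-bits k w)

  spell-encPath : ∀ vs → bits (spell vs) ≡ encPath vs
  spell-encPath []       = refl
  spell-encPath (v ∷ vs) = trans (unary-bits (toℕ v) (spell vs))
    (cong ((replicate (toℕ v) b1 ++ b0 ∷ []) ++_) (spell-encPath vs))

  everything : Decides (λ _ → true) (leaves tree)
  everything v = (λ _ → subst (v ∈ₗ_) (sym (leaves-toTree G id)) (∈-tabulate⁺ v)) , (λ _ → refl)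

  runs-everything : ∀ (Q : List (Fin n)) → runs (λ _ → true) true Q ≡ 0
  runs-everything []      = refl
  runs-everything (v ∷ Q) = runs-everything Q

  runs≤1 : ∀ (Q : List (Fin n)) → runs (λ _ → true) false Q ≤ 1
  runs≤1 []      = z≤n
  runs≤1 (v ∷ Q) = s≤s (≤-reflexive (runs-everything Q))

  nonTerminals-count : ∀ Q → nonTerminals Y Q ≡ count (outside (λ _ → true)) Q
  nonTerminals-count []      = refl
  nonTerminals-count (v ∷ Q) with Vec.lookup Y v
  ... | true  = nonTerminals-count Q
  ... | false = cong suc (nonTerminals-count Q)

  terminalPath : ∀ {Q} → IsSimplePath G Q → Covers Y Q → TerminalPath Q
  terminalPath (_ , u , l) c = record { linked = l ; unique = u ; covers = λ {v} x → c v (lookup⇒[]= v Y x) }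

  linked-verts : ∀ {v S} → Val v S → breaks S ≡ 0 → Linked (Adj G) (v ∷ verts S)
  linked-verts []                _ = [-]
  linked-verts (adj _ e s)       z = e ∷ linked-verts s z
  linked-verts (via _ _ e e′ s)  z = e ∷ e′ ∷ linked-verts s z

  -- Without proper breaks every path after the first is opened by a `via`, which contributes one
  -- nonterminal.
  nonTerminals-verts : ∀ {v S} → Val v S → breaks S ≡ 0 → nonTerminals Y (verts S) ≡ pieces S
  nonTerminals-verts []                _ = refl
  nonTerminals-verts (adj x _ s)       z rewrite x = nonTerminals-verts s z
  nonTerminals-verts (via x x′ _ _ s)  z rewrite x | x′ = cong suc (nonTerminals-verts s z)

  origin : Fin n → ∃ λ z → toℕ {n} z ≡ 0
  origin zero    = zero , refl
  origin (suc _) = zero , refl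

  -- A path through all terminals is one run of the whole vertex set. Applied to the given path, the
  -- bound on `breaks` leaves only the leading `new`, so the cover with its connectors is a path;
  -- applied to a competitor, the bound on `pieces` gives minimality.
  optimal : ∀ {S R} → Summary (leaves tree) S R → (∃ λ Q → IsSimplePath G Q × Covers Y Q) →
            Σ (List (Fin n)) λ P → Optimal G Y P × (bits (answer (verts S)) ≡ encPath P)
  optimal {[]} s ([] , (nonempty , _) , _) = ⊥-elim (nonempty refl)
  -- An empty cover means that there are no terminals. Every path then has at least one nonterminal,
  -- so the single vertex 0, which `answer` prints, is optimal.
  optimal {[]} {R} s (v ∷ Q , _ , _) =
    let z , z≡0 = origin v in
    z ∷ [] ,
    (((λ ()) , [] ∷ [] , [-]) ,
     (λ x x∈ → ⊥-elim (true≢false (trans (sym ([]=⇒lookup x∈)) (none x)))) ,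
     minimal z) ,
    cong (λ k → (replicate k b1 ++ b0 ∷ []) ++ []) (sym z≡0)
    where
    true≢false : true ≢ false
    true≢false ()
    none : ∀ v → X v ≡ false
    none v = All.lookup (Summary.spare s) (≋⇒∈ (λ f → sym (Summary.same s f)) (proj₁ (everything v) refl))
    minimal : ∀ z Q → IsSimplePath G Q → Covers Y Q → nonTerminals Y (z ∷ []) ≤ nonTerminals Y Q
    minimal z []      (nonempty , _) _ = ⊥-elim (nonempty refl)
    minimal z (v ∷ Q) _ _ rewrite none z | none v = s≤s z≤n
  optimal {new w ∷ S} {R} s (Q₀ , path₀ , cov₀) with Summary.valid s
  ... | new x val = w ∷ verts S ,
    (((λ ()) , unique , linked-verts val unbroken) , covers , minimal) ,
    spell-encPath (w ∷ verts S)
    where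
    unbroken : breaks S ≡ 0
    unbroken = n≤0⇒n≡0 (s≤s⁻¹ (≤-trans (proj₂ (Summary.lower s (terminalPath path₀ cov₀) everything)) (runs≤1 Q₀)))
    unique : Unique (w ∷ verts S)
    unique = weight⇒Unique λ v → ≤-trans (≤-trans (m≤m+n _ _)
      (≤-reflexive (trans (sym (weight-++ (single-weight v) (w ∷ verts S))) (Summary.same s _))))
      (Unique⇒weight v (subst Unique (sym (leaves-toTree G id)) (tabulate⁺ id)))
    covers : Covers Y (w ∷ verts S)
    covers v v∈ with ∈-++⁻ (w ∷ verts S) (≋⇒∈ (λ f → sym (Summary.same s f)) (proj₁ (everything v) refl))
    ... | inj₁ m = m
    ... | inj₂ m with () ← trans (sym ([]=⇒lookup v∈)) (All.lookup (Summary.spare s) m)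
    minimal : ∀ Q → IsSimplePath G Q → Covers Y Q → nonTerminals Y (w ∷ verts S) ≤ nonTerminals Y Q
    minimal Q path cov rewrite x | nonTerminals-verts val unbroken | nonTerminals-count Q =
      -- The leading path counts 1 in `pieces` and the single run of `Q` counts 1 in the bound;
      -- these cancel, leaving the two numbers of nonterminals.
      s≤s⁻¹ (≤-trans (proj₁ (Summary.lower s (terminalPath path cov) everything)) (+-monoˡ-≤ _ (runs≤1 Q)))

  length-leaves : length (leaves tree) ≤ N
  length-leaves = ≤-trans (≤-reflexive (trans (cong length (leaves-toTree G id)) (length-tabulate id))) n≤N

  terminals≡ : terminals tree [] ≡ Vec.toList Y
  terminals≡ = trans (terminals-toTree G id Y (λ _ → refl) []) (++-identityʳ (Vec.toList Y))

  encInput≡ : encInput G Y ≡ symbols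
  encInput≡ = cong (_++ (sep ∷ bits (Vec.toList Y))) (sym (trans (bits-prefix G id []) (++-identityʳ (encTree G))))

  open Machine main using (time; toTM; halts)

  solved : ∀ {t} → time N ≤ t → Σ (List Sym) λ out → HaltsWithin toTM (encInput G Y) t out ×
           ((∃ λ P → IsSimplePath G P × Covers Y P) → Σ (List (Fin n)) λ P → Optimal G Y P × (out ≡ encPath P))
  solved {t} time≤t =
    let S , R , ss , s , ran = main-run tree (presents G id id (λ _ _ → refl)) (numbered G id 0 (λ i → sym (+-identityʳ (toℕ i))))
                                 length-leaves nodes≤N (≤-trans (≤-reflexive (trans (next-toTree G id 0) (+-identityʳ n))) n≤N)
        started = subst (λ w → Run N main (st (prefix tree []) w [] [] [] [] [] [] [] [] []) true
          (answer (verts S) ∷ ss)) terminals≡ ran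
    in bits (answer (verts S)) ,
       subst (λ w → HaltsWithin toTM w t (bits (answer (verts S)))) (sym encInput≡)
         (halts (prefix tree []) (Vec.toList Y) started time≤t) ,
       optimal s

theorem4 : Σ TM λ M → Σ ℕ λ c → Σ ℕ λ k →
    ∀ {n} (G : Cotree n) (X : Subset n) → Connected G →
    Σ (List Sym) λ out →
    HaltsWithin M (encInput G X) (c * length (encInput G X) ^ k + c) out ×
    ((∃ λ P → IsSimplePath G P × Covers X P) →
    Σ (List (Fin n)) λ P → Optimal G X P × (out ≡ encPath P))
theorem4 = Machine.toTM main , proj₁ bound , proj₁ (proj₂ bound) , λ G X _ →
  Instance.solved G X (≤-trans (proj₂ (proj₂ bound) (Instance.N G X) (nonempty G X))
    (≤-reflexive (cong (λ w → proj₁ bound * length w ^ proj₁ (proj₂ bound) + proj₁ bound) (sym (Instance.encInput≡ G X)))))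
  where
  bound = poly-bound (Machine.poly-time main)
  -- `poly-bound` requires a positive length.
  nonempty : ∀ {n} (G : Cotree n) (X : Subset n) → 1 ≤ Instance.N G X
  nonempty leaf         X = s≤s z≤n
  nonempty (node b l r) X = s≤s z≤n
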